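{- Let $q$ be a prime power and let $\zeta$ be a generator of $\mathbf{F}_{q^2}^\times$. Let $S_{211}=\{\zeta^i \mid 0<i\le (q+1)/2\}$ and let $T_{211}$ be the set of homogenized minimal polynomials over $\mathbf{F}_q$ of the elements of $S_{211}$. Then the set $\{xyg \mid g\in T_{211}\}$ is a complete set of unique representatives for the action of $\mathrm{PGL}_2(\mathbf{F}_q)$ on the monic separable homogeneous quartics in $\mathbf{F}_q[x,y]$ that have exactly one irreducible quadratic factor.
   Context: For a finite field $k$, a homogeneous polynomial $f\in k[x,y]$ is called monic if $f(x,1)$ is monic, and separable if over $\bar k$ it is a constant times a product of distinct monic linear factors. $\mathrm{PGL}_2(k)$ acts on monic homogeneous polynomials: if $\Gamma$ is represented by $\begin{bmatrix}a&b\\c&d\end{bmatrix}$, then $\Gamma(f)$ is the unique monic scalar multiple of $f(dx-by,-cx+ay)$. The homogenized minimal polynomial of $\alpha$ of degree $m$ with minimal polynomial $h(x)$ is $y^mh(x/y)$. A complete set of unique representatives means a set containing exactly one element of each orbit. -}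

module Defs where

import Level
open import Level using (0ℓ; Lift)
open import Data.Nat using (ℕ; zero; suc; _+_; _≤_; _<_; _^_; ⌊_/2⌋)
open import Data.Nat.Primality using (Prime)
open import Data.Fin using (Fin; toℕ)
open import Data.Vec using (Vec; []; _∷_; _∷ʳ_; map; zipWith; lookup; last)
open import Data.List using (List; length)
open import Data.List.Membership.Propositional using (_∈_)
open import Data.List.Relation.Unary.Unique.Propositional using (Unique)
open import Data.Product using (Σ; ∃; _×_; _,_)
open import Relation.Binary.PropositionalEquality using (_≡_; _≢_)
open import Algebra.Structures using (IsCommutativeRing)

record Field : Set₁ where
  field
    Carrier : Set
    _⊕_ _⊗_ : Carrier → Carrier → Carrier
    ⊝_      : Carrier → Carrier
    0# 1#   : Carrier
    isCommutativeRing : IsCommutativeRing (_≡_ {A = Carrier}) _⊕_ _⊗_ ⊝_ 0# 1#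
    0≢1     : 0# ≢ 1#
    inverse : ∀ x → x ≢ 0# → ∃ λ y → x ⊗ y ≡ 1#

HasSize : Field → ℕ → Set
HasSize F n = Σ (List (Field.Carrier F)) λ xs →
  Unique xs × (∀ x → x ∈ xs) × length xs ≡ n

IsPrimePower : ℕ → Set
IsPrimePower q = Σ ℕ λ p → Σ ℕ λ k → Prime p × q ≡ p ^ suc k

record Embedding (K E : Field) : Set where
  open Field
  field
    ι      : Carrier K → Carrier E
    ι-⊕    : ∀ a b → ι (_⊕_ K a b) ≡ _⊕_ E (ι a) (ι b)
    ι-⊗    : ∀ a b → ι (_⊗_ K a b) ≡ _⊗_ E (ι a) (ι b)
    ι-1    : ι (1# K) ≡ 1# E

-- Homogeneous forms over a field.
-- A form of degree n is a vector v : Vec K (suc n), where lookup v i is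
-- the coefficient of x^i y^(n-i).

module Poly (F : Field) where
  open Field F

  _^F_ : Carrier → ℕ → Carrier
  a ^F zero = 1#
  a ^F suc n = a ⊗ (a ^F n)

  HForm : Set
  HForm = Σ ℕ λ n → Vec Carrier (suc n)

  form : ∀ n → Vec Carrier (suc n) → HForm
  form n v = (n , v)

  scale : ∀ {n} → Carrier → Vec Carrier n → Vec Carrier n
  scale c = map (c ⊗_)

  pad : ∀ k {n} → Vec Carrier (suc n) → Vec Carrier (suc (k + n))
  pad zero v = v
  pad (suc k) v = pad k v ∷ʳ 0#

  mul : ∀ {m n} → Vec Carrier (suc m) → Vec Carrier (suc n) → Vec Carrier (suc (m + n))
  mul {zero} (a ∷ []) g = scale a g
  mul {suc m} (a ∷ f) g = zipWith _⊕_ (pad (suc m) (scale a g)) (0# ∷ mul f g)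

  powL : ∀ n → Vec Carrier 2 → Vec Carrier (suc n)
  powL zero L = 1# ∷ []
  powL (suc n) L = mul L (powL n L)

  subst : ∀ {n} → Vec Carrier 2 → Vec Carrier 2 → Vec Carrier (suc n) → Vec Carrier (suc n)
  subst {zero} L1 L2 (a ∷ []) = a ∷ []
  subst {suc n} L1 L2 (a ∷ f) = zipWith _⊕_ (scale a (powL (suc n) L2)) (mul L1 (subst L1 L2 f))

  xy : Vec Carrier 3
  xy = 0# ∷ 1# ∷ 0# ∷ []

  xyTimes : HForm → HForm
  xyTimes (m , h) = (2 + m , mul xy h)

  -- monic: f(x,1) is monic, i.e. the nonzero coefficient of highest x-power is 1
  Monic : ∀ {n} → Vec Carrier n → Set
  Monic {n} v = Σ (Fin n) λ i → lookup v i ≡ 1# × (∀ j → toℕ i < toℕ j → lookup v j ≡ 0#)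

  Divides : ∀ {m} → Vec Carrier (suc m) → HForm → Set
  Divides {m} g f = Σ ℕ λ k → Σ (Vec Carrier (suc k)) λ h → form (m + k) (mul g h) ≡ f

  Irreducible : HForm → Set
  Irreducible (n , v) = 1 ≤ n × (∀ m k (g : Vec Carrier (suc m)) (h : Vec Carrier (suc k)) →
    1 ≤ m → 1 ≤ k → form (m + k) (mul g h) ≢ form n v)

  ExactlyOneIrrQuadFactor : HForm → Set
  ExactlyOneIrrQuadFactor f = Σ (Vec Carrier 3) λ g → P g × (∀ g' → P g' → g' ≡ g)
    where
    P : Vec Carrier 3 → Set
    P g = Monic g × Irreducible (2 , g) × Divides g f

  -- the action of [[a,b],[c,d]] : Γ(f) is the monic scalar multiple of f(dx-by, -cx+ay)
  -- ActsTo a b c d f f'  means  Γ(f) = f'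
  ActsTo : Carrier → Carrier → Carrier → Carrier → HForm → HForm → Set
  ActsTo a b c d (n , v) (n' , v') =
    Monic v' × Σ Carrier λ s → form n (scale s (subst (⊝ b ∷ d ∷ []) (a ∷ ⊝ c ∷ []) v)) ≡ form n' v'

  -- same PGL₂-orbit: some Γ ∈ PGL₂ (represented by an invertible matrix) maps f to f'
  InOrbit : HForm → HForm → Set
  InOrbit f f' = Σ Carrier λ a → Σ Carrier λ b → Σ Carrier λ c → Σ Carrier λ d →
    ((a ⊗ d) ⊕ (⊝ (b ⊗ c))) ≢ 0# × ActsTo a b c d f f'

  CompleteReps : (X R : HForm → Set₁) → Set₁
  CompleteReps X R =
    (∀ r → R r → X r) ×
    (∀ f → X f → Σ HForm λ r → R r × InOrbit r f) ×
    (∀ r r' → R r → R r' → InOrbit r r' → r ≡ r')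

module _ (E : Field) where
  open Field E
  open Poly E
  prodLin : ∀ {n} → Vec (Vec Carrier 2) n → Vec Carrier (suc n)
  prodLin [] = 1# ∷ []
  prodLin (l ∷ ls) = mul l (prodLin ls)

module Over (K : Field) where
  open Field K
  open Poly K

  -- separable: over some extension field E of K (equivalently over K̄),
  -- f is a constant times a product of distinct monic linear factors
  Separable : HForm → Set₁
  Separable (n , v) = Σ Field λ E → Σ (Embedding K E) λ emb →
    Σ (Field.Carrier E) λ c → Σ (Vec (Vec (Field.Carrier E) 2) n) λ ls →
      (∀ i → Poly.Monic E (lookup ls i)) ×
      (∀ i j → i ≢ j → lookup ls i ≢ lookup ls j) ×
      map (Embedding.ι emb) v ≡ Poly.scale E c (prodLin E ls)

  Quartic211 : HForm → Set₁
  Quartic211 (n , v) = Lift (Level.suc 0ℓ) (n ≡ 4 × Monic v × ExactlyOneIrrQuadFactor (n , v)) × Separable (n , v)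

  module _ (L : Field) (emb : Embedding K L) where
    private module L = Field L
    eval : ∀ {m} → L.Carrier → Vec Carrier (suc m) → L.Carrier
    eval {zero} α (a ∷ []) = Embedding.ι emb a
    eval {suc m} α (a ∷ h) = Embedding.ι emb a L.⊕ (α L.⊗ eval α h)

    -- g is the homogenized minimal polynomial of α over K:
    -- g = y^m h(x/y), h monic of degree m with h(α) = 0, and no nonzero
    -- polynomial of smaller degree vanishes at α
    HomMinPoly : L.Carrier → HForm → Set
    HomMinPoly α (m , h) = last h ≡ 1# × eval α h ≡ L.0# ×
      (∀ k → k < m → (p : Vec Carrier (suc k)) → eval α p ≡ L.0# → ∀ i → lookup p i ≡ 0#)

    R211 : ℕ → L.Carrier → HForm → Set₁
    R211 q ζ f = Lift (Level.suc 0ℓ) (Σ ℕ λ i → 0 < i × i ≤ ⌊ suc q /2⌋ ×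
      Σ HForm λ g → HomMinPoly (Poly._^F_ L ζ i) g × f ≡ xyTimes g)
  
Generator : (L : Field) → Field.Carrier L → Set
Generator L ζ = ζ ≢ 0# × (∀ x → x ≢ 0# → Σ ℕ λ i → ζ ^F i ≡ x)
  where open Field L
        open Poly L

{-# OPTIONS --safe #-}
module Submission where

-- Counting elements shows that ζⁿ ∈ K exactly when q + 1 divides n, and that every monic
-- quadratic over K has a root in L.  A quartic as in the theorem is g·ℓ₁·ℓ₂ with g irreducible
-- and ℓ₁, ℓ₂ independent linear forms; if β ∈ L is a root of g, then γ = ℓ₁(β)/ℓ₂(β) = ζⁿ is
-- irrational, and rescaling ℓ₂ multiplies γ by any element of K^×.  The conjugate of ζⁱ is
-- norm·ζ⁻ⁱ, so modulo K^× and conjugation only ±n mod q + 1 matters, and 0 < i ≤ (q + 1)/2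
-- lists each class once.  Conversely, a projectivity between two of the quartics xyg preserves
-- the rational zeros {0, ∞}, so it is diagonal or antidiagonal and changes the exponent of a
-- root of g only by a sign modulo q + 1.

open import Defs
open import Level using (0ℓ; lift)
open import Function using (_∘_)
open import Algebra.Bundles using (CommutativeRing)
import Algebra.Properties.AbelianGroup as AbelianGroupProperties
import Algebra.Properties.Ring as RingProperties
import Algebra.Properties.Semiring.Exp as Exp
import Algebra.Properties.Semiring.Mult.TCOptimised as Mult
import Algebra.Solver.Ring as RingSolver
open import Algebra.Solver.Ring.AlmostCommutativeRing using (fromCommutativeRing; _-Raw-AlmostCommutative⟶_)
open import Data.Bool using (Bool; true; false; T; not)
open import Data.Bool.Properties using (not-injective) renaming (_≟_ to _≟ᵇ_)
open import Data.Empty using (⊥; ⊥-elim)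
open import Data.Fin using (Fin; zero; suc; toℕ)
open import Data.Fin.Patterns
import Data.Fin.Properties as Fin
open import Data.Integer using (ℤ; +_; -[1+_]; _⊖_; _◃_)
import Data.Integer as ℤ
import Data.Integer.Properties as ℤ
open import Data.List as List using (List; []; _∷_; _++_; length)
import Data.List.Membership.DecPropositional as DecMembership
open import Data.List.Membership.Propositional using (_∈_; lose)
open import Data.List.Membership.Propositional.Properties
  using (∈-∃++; ∈-++⁻; ∈-++⁺ˡ; ∈-++⁺ʳ; ∈-map⁺; ∈-map⁻; ∈-cartesianProductWith⁺; ∈-cartesianProductWith⁻;
         ∈-cartesianProduct⁺; ∈-cartesianProduct⁻; ∈-upTo⁺; ∈-upTo⁻; ∈-filter⁺; ∈-filter⁻)
import Data.List.Properties as List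
open import Data.List.Relation.Unary.All as All using (All)
open import Data.List.Relation.Unary.All.Properties using (¬Any⇒All¬)
open import Data.List.Relation.Unary.AllPairs using (_∷_)
open import Data.List.Relation.Unary.Any as Any using (here; there)
open import Data.List.Relation.Unary.Any.Properties using (lookup-index)
open import Data.List.Relation.Unary.Unique.Propositional using (Unique)
import Data.List.Relation.Unary.Unique.Propositional.Properties as Unique
import Data.Maybe as Maybe
open import Data.Nat as ℕ using (ℕ; zero; suc)
open import Data.Nat.DivMod using (_/_; _%_; m≡m%n+[m/n]*n; m%n<n)
open import Data.Nat.Divisibility using (_∣_; divides; m%n≡0⇒n∣m; ∣⇒≤; >⇒∤)
import Data.Nat.Properties as ℕ
open import Data.Nat.Solver using (module +-*-Solver)
open import Data.Product using (Σ; ∃; _×_; _,_; proj₁; proj₂)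
open import Data.Product.Properties using (≡-dec)
import Data.Sign as Sign
open import Data.Sum as Sum using (_⊎_; inj₁; inj₂; [_,_]′)
open import Data.Vec as Vec using (Vec; []; _∷_; _∷ʳ_; zipWith; lookup)
import Data.Vec.Properties as Vec
open import Relation.Binary.Definitions using (DecidableEquality)
open import Relation.Binary.PropositionalEquality as ≡
  using (_≡_; _≢_; refl; sym; trans; cong; cong₂; subst; subst₂; module ≡-Reasoning)
import Relation.Binary.Reasoning.Setoid as SetoidReasoning
open import Relation.Nullary using (Dec; yes; no; ¬_; contradiction)
open import Relation.Nullary.Decidable using (dec⇒maybe; ¬?; ¬¬-excluded-middle)

-- The fields are given only by enumerations and an embedding, so every structural fact about L over
-- K comes from counting. No Frobenius map appears: the conjugate of an irrational α is the other
-- root of the quadratic that α satisfies over K. What is used of it is its sum and product with α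
-- and, since characteristic 2 is allowed, a separate argument that it differs from α. The splitting
-- field E in the separability hypothesis is arbitrary: it is not known to contain L, and its
-- equality is not decidable. Separability of a given quartic is therefore used only negatively: a
-- double zero, detected with dual numbers, contradicts it, and case distinctions in E are made
-- under a double negation. This excludes a cofactor of g proportional to g, and dependent ℓ₁, ℓ₂.
-- Two quadratics are compared through a common irrational zero: as 1 and β are independent over K,
-- such a zero determines a quadratic up to its leading coefficient. The upper end of the exponent
-- range is delicate: for odd q, (q + 1)/2 is its own negative modulo q + 1, so i + j = q + 1 can
-- occur, but only with i = j.

-- A ring solver with integer coefficients

module IntegerCoefficients {c ℓ} (R : CommutativeRing c ℓ) where
  open CommutativeRing R renaming (refl to ≈-refl; sym to ≈-sym; trans to ≈-trans)
  open RingProperties ring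
  open AbelianGroupProperties +-abelianGroup using (⁻¹-∙-comm; ε⁻¹≈ε; ⁻¹-involutive)
  open Mult semiring renaming (_×_ to infixl 8 _·_)
  open SetoidReasoning setoid

  ⟦_⟧ℤ : ℤ → Carrier
  ⟦ + n ⟧ℤ      = n · 1#
  ⟦ -[1+ n ] ⟧ℤ = - (suc n · 1#)

  ⊖-homo : ∀ m n → ⟦ m ⊖ n ⟧ℤ ≈ m · 1# - n · 1#
  ⊖-homo m zero = ≈-sym (≈-trans (+-congˡ ε⁻¹≈ε) (+-identityʳ _))
  ⊖-homo zero (suc n) = ≈-sym (+-identityˡ _)
  ⊖-homo (suc m) (suc n) = begin
    ⟦ suc m ⊖ suc n ⟧ℤ                  ≡⟨ ≡.cong ⟦_⟧ℤ (ℤ.[1+m]⊖[1+n]≡m⊖n m n) ⟩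
    ⟦ m ⊖ n ⟧ℤ                          ≈⟨ ⊖-homo m n ⟩
    m · 1# - n · 1#                     ≈⟨ +-congʳ (+-identityʳ _) ⟨
    m · 1# + 0# - n · 1#                ≈⟨ +-congʳ (+-congˡ (-‿inverseʳ 1#)) ⟨
    m · 1# + (1# - 1#) - n · 1#         ≈⟨ +-congʳ (+-assoc _ _ _) ⟨
    m · 1# + 1# - 1# - n · 1#           ≈⟨ +-assoc _ _ _ ⟩
    m · 1# + 1# + (- 1# - n · 1#)
      ≈⟨ +-cong (≈-trans (+-comm _ _) (≈-sym (1+× m 1#))) (≈-trans (⁻¹-∙-comm _ _) (-‿cong (≈-sym (1+× n 1#)))) ⟩
    suc m · 1# - suc n · 1#             ∎

  ⟦⟧-+-homo : ∀ i j → ⟦ i ℤ.+ j ⟧ℤ ≈ ⟦ i ⟧ℤ + ⟦ j ⟧ℤ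
  ⟦⟧-+-homo (+ m) (+ n) = ×-homo-+ 1# m n
  ⟦⟧-+-homo (+ m) -[1+ n ] = ⊖-homo m (suc n)
  ⟦⟧-+-homo -[1+ m ] (+ n) = ≈-trans (⊖-homo n (suc m)) (+-comm _ _)
  ⟦⟧-+-homo -[1+ m ] -[1+ n ] = begin
    - (suc (suc (m ℕ.+ n)) · 1#)      ≡⟨ ≡.cong (λ k → - (k · 1#)) (≡.cong suc (ℕ.+-suc m n)) ⟨
    - ((suc m ℕ.+ suc n) · 1#)        ≈⟨ -‿cong (×-homo-+ 1# (suc m) (suc n)) ⟩
    - (suc m · 1# + suc n · 1#)       ≈⟨ ⁻¹-∙-comm _ _ ⟨
    - (suc m · 1#) - suc n · 1#       ∎

  ◃-pos : ∀ n → ⟦ Sign.+ ◃ n ⟧ℤ ≈ n · 1#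
  ◃-pos zero = ≈-refl
  ◃-pos (suc n) = ≈-refl

  ◃-neg : ∀ n → ⟦ Sign.- ◃ n ⟧ℤ ≈ - (n · 1#)
  ◃-neg zero = ≈-sym ε⁻¹≈ε
  ◃-neg (suc n) = ≈-refl

  ⟦⟧-*-homo : ∀ i j → ⟦ i ℤ.* j ⟧ℤ ≈ ⟦ i ⟧ℤ * ⟦ j ⟧ℤ
  ⟦⟧-*-homo (+ m) (+ n) = ≈-trans (◃-pos (m ℕ.* n)) (×1-homo-* m n)
  ⟦⟧-*-homo (+ m) -[1+ n ] = begin
    ⟦ Sign.- ◃ m ℕ.* suc n ⟧ℤ   ≈⟨ ◃-neg (m ℕ.* suc n) ⟩
    - ((m ℕ.* suc n) · 1#)      ≈⟨ -‿cong (×1-homo-* m (suc n)) ⟩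
    - (m · 1# * suc n · 1#)     ≈⟨ -‿distribʳ-* _ _ ⟩
    m · 1# * - (suc n · 1#)     ∎
  ⟦⟧-*-homo -[1+ m ] (+ n) = begin
    ⟦ Sign.- ◃ suc m ℕ.* n ⟧ℤ   ≈⟨ ◃-neg (suc m ℕ.* n) ⟩
    - ((suc m ℕ.* n) · 1#)      ≈⟨ -‿cong (×1-homo-* (suc m) n) ⟩
    - (suc m · 1# * n · 1#)     ≈⟨ -‿distribˡ-* _ _ ⟩
    - (suc m · 1#) * n · 1#     ∎
  ⟦⟧-*-homo -[1+ m ] -[1+ n ] = begin
    (suc m ℕ.* suc n) · 1#              ≈⟨ ×1-homo-* (suc m) (suc n) ⟩
    suc m · 1# * suc n · 1#             ≈⟨ ⁻¹-involutive _ ⟨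
    - - (suc m · 1# * suc n · 1#)       ≈⟨ -‿cong (-‿distribˡ-* _ _) ⟩
    - (- (suc m · 1#) * suc n · 1#)     ≈⟨ -‿distribʳ-* _ _ ⟩
    - (suc m · 1#) * - (suc n · 1#)     ∎

  ⟦⟧-neg-homo : ∀ i → ⟦ ℤ.- i ⟧ℤ ≈ - ⟦ i ⟧ℤ
  ⟦⟧-neg-homo (+ zero) = ≈-sym ε⁻¹≈ε
  ⟦⟧-neg-homo (+ suc n) = ≈-refl
  ⟦⟧-neg-homo -[1+ n ] = ≈-sym (⁻¹-involutive _)

  ℤ-homomorphism : ℤ.+-*-rawRing -Raw-AlmostCommutative⟶ fromCommutativeRing R
  ℤ-homomorphism = record
    { ⟦_⟧ = ⟦_⟧ℤ ; +-homo = ⟦⟧-+-homo ; *-homo = ⟦⟧-*-homo ; -‿homo = ⟦⟧-neg-homo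
    ; 0-homo = ≈-refl ; 1-homo = ≈-refl }

  -- Integer coefficients have decidable equality although the carrier of a field need not. Only
  -- identities valid in every commutative ring are proved this way, so relations such as 2 = 0 are
  -- fed in by hand where they are used.
  module Solver = RingSolver ℤ.+-*-rawRing (fromCommutativeRing R) ℤ-homomorphism
    (λ i j → Maybe.map (λ eq → reflexive (≡.cong ⟦_⟧ℤ eq)) (dec⇒maybe (i ℤ.≟ j)))

  open Solver public using (solve; _:=_; _:+_; _:*_; :-_; _:-_; con)

-- Elementary field arithmetic

module FieldTheory (F : Field) where
  open Field F public
  open ≡-Reasoning

  commutativeRing : CommutativeRing 0ℓ 0ℓ
  commutativeRing = record { isCommutativeRing = isCommutativeRing }

  open CommutativeRing commutativeRing public
    using (+-identityˡ; +-identityʳ; *-identityˡ; *-identityʳ; zeroˡ; zeroʳ; *-comm; *-assoc; -‿inverseʳ)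
  open IntegerCoefficients commutativeRing public using (solve; _:=_; _:+_; _:*_; :-_; _:-_; con)
  open Poly F public using (_^F_)

  x-y≡0⇒x≡y : ∀ {x y} → x ⊕ (⊝ y) ≡ 0# → x ≡ y
  x-y≡0⇒x≡y {x} {y} eq = begin
    x                ≡⟨ solve 2 (λ x y → x := (x :- y) :+ y) refl x y ⟩
    (x ⊕ (⊝ y)) ⊕ y  ≡⟨ cong (_⊕ y) eq ⟩
    0# ⊕ y           ≡⟨ +-identityˡ y ⟩
    y                ∎

  x≡y⇒x-y≡0 : ∀ {x y} → x ≡ y → x ⊕ (⊝ y) ≡ 0#
  x≡y⇒x-y≡0 {x} refl = -‿inverseʳ x

  x⊕y≡0⇒x≡-y : ∀ {x y} → x ⊕ y ≡ 0# → x ≡ ⊝ y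
  x⊕y≡0⇒x≡-y {x} {y} eq = x-y≡0⇒x≡y (trans (solve 2 (λ x y → x :- (:- y) := x :+ y) refl x y) eq)

  x⊗y≡0⇒y≡0 : ∀ {x y} → x ≢ 0# → x ⊗ y ≡ 0# → y ≡ 0#
  x⊗y≡0⇒y≡0 {x} {y} x≢0 xy≡0 with x⁻¹ , xx⁻¹≡1 ← inverse x x≢0 = begin
    y                ≡⟨ *-identityˡ y ⟨
    1# ⊗ y           ≡⟨ cong (_⊗ y) xx⁻¹≡1 ⟨
    (x ⊗ x⁻¹) ⊗ y    ≡⟨ solve 3 (λ x z y → (x :* z) :* y := z :* (x :* y)) refl x x⁻¹ y ⟩
    x⁻¹ ⊗ (x ⊗ y)    ≡⟨ cong (x⁻¹ ⊗_) xy≡0 ⟩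
    x⁻¹ ⊗ 0#         ≡⟨ zeroʳ x⁻¹ ⟩
    0#               ∎

  x⊗y≢0 : ∀ {x y} → x ≢ 0# → y ≢ 0# → x ⊗ y ≢ 0#
  x⊗y≢0 x≢0 y≢0 xy≡0 = y≢0 (x⊗y≡0⇒y≡0 x≢0 xy≡0)

  x⊗y≢0⇒x≢0 : ∀ {x y} → x ⊗ y ≢ 0# → x ≢ 0#
  x⊗y≢0⇒x≢0 {y = y} xy≢0 refl = xy≢0 (zeroˡ y)

  x⊗y≢0⇒y≢0 : ∀ {x y} → x ⊗ y ≢ 0# → y ≢ 0#
  x⊗y≢0⇒y≢0 {x = x} xy≢0 refl = xy≢0 (zeroʳ x)

  ⊝x≢0 : ∀ {x} → x ≢ 0# → ⊝ x ≢ 0#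
  ⊝x≢0 {x} x≢0 -x≡0 = x≢0 (sym (x-y≡0⇒x≡y (trans (+-identityˡ _) -x≡0)))

  ⊗-cancelˡ : ∀ {x y z} → x ≢ 0# → x ⊗ y ≡ x ⊗ z → y ≡ z
  ⊗-cancelˡ {x} {y} {z} x≢0 eq = x-y≡0⇒x≡y (x⊗y≡0⇒y≡0 x≢0 (trans
    (solve 3 (λ x y z → x :* (y :- z) := x :* y :- x :* z) refl x y z) (x≡y⇒x-y≡0 eq)))

  1≢0 : 1# ≢ 0#
  1≢0 eq = 0≢1 (sym eq)

  inverse≢0 : ∀ {x y} → x ⊗ y ≡ 1# → y ≢ 0#
  inverse≢0 {x} eq refl = 0≢1 (trans (sym (zeroʳ x)) eq)

  ^-+ : ∀ x m n → x ^F (m ℕ.+ n) ≡ (x ^F m) ⊗ (x ^F n)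
  ^-+ x zero n = sym (*-identityˡ _)
  ^-+ x (suc m) n = trans (cong (x ⊗_) (^-+ x m n)) (sym (*-assoc x _ _))

  ^≢0 : ∀ {x} → x ≢ 0# → ∀ n → x ^F n ≢ 0#
  ^≢0 x≢0 zero = 1≢0
  ^≢0 x≢0 (suc n) = x⊗y≢0 x≢0 (^≢0 x≢0 n)

-- Finite sets

module _ {A : Set} where

  -- Pigeonhole principle: the head of `xs` is cut out of `ys` at a place where it occurs, and the
  -- tail still embeds in what remains because it does not contain the head.
  Unique-⊆⇒length≤ : ∀ {xs ys : List A} → Unique xs → (∀ {x} → x ∈ xs → x ∈ ys) → length xs ℕ.≤ length ys
  Unique-⊆⇒length≤ {[]} _ _ = ℕ.z≤n
  Unique-⊆⇒length≤ {x ∷ xs} {ys} (x∉xs ∷ xs!) xs⊆ys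
    with as , bs , refl ← ∈-∃++ (xs⊆ys (here refl)) = begin
      suc (length xs)             ≤⟨ ℕ.s≤s (Unique-⊆⇒length≤ xs! xs⊆as++bs) ⟩
      suc (length (as ++ bs))     ≡⟨ cong suc (List.length-++ as) ⟩
      suc (length as ℕ.+ length bs) ≡⟨ ℕ.+-suc (length as) (length bs) ⟨
      length as ℕ.+ length (x ∷ bs) ≡⟨ List.length-++ as ⟨
      length (as ++ x ∷ bs)       ∎
    where
    open ℕ.≤-Reasoning
    xs⊆as++bs : ∀ {y} → y ∈ xs → y ∈ as ++ bs
    xs⊆as++bs y∈xs with ∈-++⁻ as (xs⊆ys (there y∈xs))
    ... | inj₁ y∈as = ∈-++⁺ˡ y∈as
    ... | inj₂ (here refl) = ⊥-elim (All.lookup x∉xs y∈xs refl)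
    ... | inj₂ (there y∈bs) = ∈-++⁺ʳ as y∈bs

  -- A missed element could be put in front of `xs`, giving a repetition-free list inside `ys` that
  -- is too long. All counting arguments below end here.
  Unique-⊆-length≥⇒⊇ : DecidableEquality A → ∀ {xs ys : List A} → Unique xs →
    (∀ {x} → x ∈ xs → x ∈ ys) → length ys ℕ.≤ length xs → ∀ {y} → y ∈ ys → y ∈ xs
  Unique-⊆-length≥⇒⊇ _≟_ {xs} {ys} xs! xs⊆ys ∣ys∣≤∣xs∣ {y} y∈ys with DecMembership._∈?_ _≟_ y xs
  ... | yes y∈xs = y∈xs
  ... | no y∉xs = contradiction (Unique-⊆⇒length≤ (¬Any⇒All¬ xs y∉xs ∷ xs!) y∷xs⊆ys) (ℕ.≤⇒≯ ∣ys∣≤∣xs∣)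
    where
    y∷xs⊆ys : ∀ {x} → x ∈ y ∷ xs → x ∈ ys
    y∷xs⊆ys (here refl) = y∈ys
    y∷xs⊆ys (there x∈xs) = xs⊆ys x∈xs

  -- In a list without repetitions two elements are equal exactly when they sit at the same
  -- position; this is the source of decidable equality in a finite field.
  Unique-≟ : ∀ {xs : List A} → Unique xs → ∀ {x y} → x ∈ xs → y ∈ xs → Dec (x ≡ y)
  Unique-≟ _ (here refl) (here refl) = yes refl
  Unique-≟ (x∉xs ∷ _) (here refl) (there y∈xs) = no (All.lookup x∉xs y∈xs)
  Unique-≟ (y∉xs ∷ _) (there x∈xs) (here refl) = no (All.lookup y∉xs x∈xs ∘ sym)
  Unique-≟ (_ ∷ xs!) (there x∈xs) (there y∈xs) = Unique-≟ xs! x∈xs y∈xs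

least-positive : ∀ {P : ℕ → Set} → (∀ n → Dec (P n)) → ∀ n → P (suc n) →
  ∃ λ d → P (suc d) × (∀ {m} → m ℕ.< d → ¬ P (suc m))
least-positive P? zero p = 0 , p , λ ()
least-positive {P} P? (suc n) p with P? 1
... | yes p₁ = 0 , p₁ , λ ()
... | no ¬p₁ with d , pd , min ← least-positive {P ∘ suc} (P? ∘ suc) n p =
  suc d , pd , λ { {zero} _ → ¬p₁ ; {suc m} (ℕ.s≤s m<d) → min m<d }

length-cartesianProductWith : ∀ {A B C : Set} (f : A → B → C) xs ys →
  length (List.cartesianProductWith f xs ys) ≡ length xs ℕ.* length ys
length-cartesianProductWith f [] ys = refl
length-cartesianProductWith f (x ∷ xs) ys = trans (List.length-++ (List.map (f x) ys))
  (cong₂ ℕ._+_ (List.length-map (f x) ys) (length-cartesianProductWith f xs ys))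

-- Finite fields and quadratic extensions

module FiniteField (F : Field) {n : ℕ} (size : HasSize F n) where
  open FieldTheory F

  elements : List Carrier
  elements = proj₁ size

  elements! : Unique elements
  elements! = proj₁ (proj₂ size)

  ∈-elements : ∀ x → x ∈ elements
  ∈-elements = proj₁ (proj₂ (proj₂ size))

  length-elements : length elements ≡ n
  length-elements = proj₂ (proj₂ (proj₂ size))

  infix 4 _≟_
  abstract
    _≟_ : DecidableEquality Carrier
    x ≟ y = Unique-≟ elements! (∈-elements x) (∈-elements y)

  abstract
    ∃? : ∀ {P : Carrier → Set} → (∀ x → Dec (P x)) → Dec (∃ P)
    ∃? P? with Any.any? P? elements
    ... | yes p = yes (Any.satisfied p)
    ... | no ¬p = no λ { (x , px) → ¬p (lose (∈-elements x) px) }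

  abstract
    x⊗y≡0⇒x≡0⊎y≡0 : ∀ {x y} → x ⊗ y ≡ 0# → x ≡ 0# ⊎ y ≡ 0#
    x⊗y≡0⇒x≡0⊎y≡0 {x} {y} xy≡0 with x ≟ 0#
    ... | yes x≡0 = inj₁ x≡0
    ... | no x≢0 = inj₂ (x⊗y≡0⇒y≡0 x≢0 xy≡0)

  x⊗x≡0⇒x≡0 : ∀ {x} → x ⊗ x ≡ 0# → x ≡ 0#
  x⊗x≡0⇒x≡0 xx≡0 = [ (λ x≡0 → x≡0) , (λ x≡0 → x≡0) ]′ (x⊗y≡0⇒x≡0⊎y≡0 xx≡0)

  -- The difference between (x - y)² and x² - y² is a multiple of 2, and a field has no nilpotent
  -- elements.
  char2-square-injective : 1# ⊕ 1# ≡ 0# → ∀ {x y} → x ⊗ x ≡ y ⊗ y → x ≡ y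
  char2-square-injective 2≡0 {x} {y} x²≡y² = x-y≡0⇒x≡y (x⊗x≡0⇒x≡0 (begin
    (x ⊕ (⊝ y)) ⊗ (x ⊕ (⊝ y))
      ≡⟨ solve 2 (λ x y → (x :- y) :* (x :- y) := (x :* x :- y :* y) :- (con (+ 1) :+ con (+ 1)) :* (y :* (x :- y))) refl x y ⟩
    ((x ⊗ x) ⊕ (⊝ (y ⊗ y))) ⊕ (⊝ ((1# ⊕ 1#) ⊗ (y ⊗ (x ⊕ (⊝ y)))))
      ≡⟨ cong₂ (λ u v → u ⊕ (⊝ v)) (x≡y⇒x-y≡0 x²≡y²) (trans (cong (_⊗ (y ⊗ (x ⊕ (⊝ y)))) 2≡0) (zeroˡ _)) ⟩
    0# ⊕ (⊝ 0#)
      ≡⟨ -‿inverseʳ 0# ⟩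
    0# ∎))
    where open ≡-Reasoning

  abstract
    injective⇒surjective : ∀ (f : Carrier → Carrier) → (∀ {x y} → f x ≡ f y → x ≡ y) → ∀ y → ∃ λ x → f x ≡ y
    injective⇒surjective f f-injective y
      with x , _ , y≡fx ← ∈-map⁻ f (Unique-⊆-length≥⇒⊇ _≟_ (Unique.map⁺ f-injective elements!)
        (λ {x} _ → ∈-elements x) (ℕ.≤-reflexive (sym (List.length-map f elements))) (∈-elements y)) = x , sym y≡fx

  units : List Carrier
  units = List.filter (λ x → ¬? (x ≟ 0#)) elements

  units! : Unique units
  units! = Unique.filter⁺ (λ x → ¬? (x ≟ 0#)) elements!

  ∈-units⁺ : ∀ {x} → x ≢ 0# → x ∈ units
  ∈-units⁺ {x} x≢0 = ∈-filter⁺ (λ x → ¬? (x ≟ 0#)) (∈-elements x) x≢0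

  ∈-units⁻ : ∀ {x} → x ∈ units → x ≢ 0#
  ∈-units⁻ x∈units = proj₂ (∈-filter⁻ (λ x → ¬? (x ≟ 0#)) {xs = elements} x∈units)

  length-units : suc (length units) ≡ n
  length-units = trans (ℕ.≤-antisym
    (Unique-⊆⇒length≤ (¬Any⇒All¬ units (λ 0∈units → ∈-units⁻ 0∈units refl) ∷ units!) (λ {x} _ → ∈-elements x))
    (Unique-⊆⇒length≤ elements! (λ {x} _ → 0∷units x))) length-elements
    where
    0∷units : ∀ x → x ∈ 0# ∷ units
    0∷units x with x ≟ 0#
    ... | yes refl = here refl
    ... | no x≢0 = there (∈-units⁺ x≢0)

  abstract
    -- An arbitrary total order, by position in the enumeration. It serves only to break the
    -- symmetry between the two roots of a quadratic, and is Boolean so that its value can be a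
    -- component of a counted triple.
    _≤ᵇ_ : Carrier → Carrier → Bool
    x ≤ᵇ y = toℕ (Any.index (∈-elements x)) ℕ.≤ᵇ toℕ (Any.index (∈-elements y))

    ≤ᵇ-refl : ∀ x → x ≤ᵇ x ≡ true
    ≤ᵇ-refl x with x ≤ᵇ x in eq
    ... | true = refl
    ... | false = ⊥-elim (subst T eq (ℕ.≤⇒≤ᵇ (ℕ.≤-refl {toℕ (Any.index (∈-elements x))})))

    -- By totality the two comparisons cannot both fail, so if they agree then both hold, and
    -- antisymmetry applies.
    ≤ᵇ-sym⇒≡ : ∀ {x y} → x ≤ᵇ y ≡ y ≤ᵇ x → x ≡ y
    ≤ᵇ-sym⇒≡ {x} {y} eq = begin
      x                                                ≡⟨ lookup-index (∈-elements x) ⟩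
      List.lookup elements (Any.index (∈-elements x))  ≡⟨ cong (List.lookup elements) (Fin.toℕ-injective same) ⟩
      List.lookup elements (Any.index (∈-elements y))  ≡⟨ lookup-index (∈-elements y) ⟨
      y                                                ∎
      where
      open ≡-Reasoning
      same : toℕ (Any.index (∈-elements x)) ≡ toℕ (Any.index (∈-elements y))
      same with ℕ.≤-total (toℕ (Any.index (∈-elements x))) (toℕ (Any.index (∈-elements y)))
      ... | inj₁ i≤j = ℕ.≤-antisym i≤j (ℕ.≤ᵇ⇒≤ _ _ (subst T eq (ℕ.≤⇒≤ᵇ i≤j)))
      ... | inj₂ j≤i = ℕ.≤-antisym (ℕ.≤ᵇ⇒≤ _ _ (subst T (sym eq) (ℕ.≤⇒≤ᵇ j≤i))) j≤i

module EmbeddingTheory {K E : Field} (emb : Embedding K E) where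
  open Embedding emb public
  private module K = FieldTheory K
  open FieldTheory E

  ι-0 : ι K.0# ≡ 0#
  ι-0 = begin
    ι K.0#                                ≡⟨ solve 1 (λ z → z := (z :+ z) :- z) refl (ι K.0#) ⟩
    (ι K.0# ⊕ ι K.0#) ⊕ (⊝ ι K.0#)        ≡⟨ cong (_⊕ (⊝ ι K.0#)) (ι-⊕ K.0# K.0#) ⟨
    ι (K.0# K.⊕ K.0#) ⊕ (⊝ ι K.0#)        ≡⟨ cong (λ z → ι z ⊕ (⊝ ι K.0#)) (K.+-identityˡ K.0#) ⟩
    ι K.0# ⊕ (⊝ ι K.0#)                   ≡⟨ -‿inverseʳ _ ⟩
    0#                                    ∎
    where open ≡-Reasoning

  ι-⊝ : ∀ a → ι (K.⊝ a) ≡ ⊝ ι a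
  ι-⊝ a = x⊕y≡0⇒x≡-y (trans (sym (ι-⊕ (K.⊝ a) a)) (trans
    (cong ι (K.solve 1 (λ a → K.:- a K.:+ a K.:= K.con (+ 0)) refl a)) ι-0))

  ι≢0 : ∀ {a} → a ≢ K.0# → ι a ≢ 0#
  ι≢0 {a} a≢0 ιa≡0 with a⁻¹ , aa⁻¹≡1 ← K.inverse a a≢0 =
    1≢0 (trans (sym ι-1) (trans (cong ι (sym aa⁻¹≡1)) (trans (ι-⊗ a a⁻¹)
      (trans (cong (_⊗ ι a⁻¹) ιa≡0) (zeroˡ _)))))

-- Coordinates, conjugates and roots of quadratics in L

module QuadraticExtension {q : ℕ} {K L : Field} (K-size : HasSize K q) (L-size : HasSize L (q ℕ.* q))
                          (emb : Embedding K L) where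
  private
    module K where
      open FieldTheory K public
      open FiniteField K K-size public
  open FieldTheory L
  open FiniteField L L-size
  open EmbeddingTheory emb
  open ≡-Reasoning

  ι≡0⇒≡0 : ∀ {a} → ι a ≡ 0# → a ≡ K.0#
  ι≡0⇒≡0 {a} ιa≡0 with a K.≟ K.0#
  ... | yes a≡0 = a≡0
  ... | no a≢0 = contradiction ιa≡0 (ι≢0 a≢0)

  ι-injective : ∀ {a b} → ι a ≡ ι b → a ≡ b
  ι-injective {a} {b} eq = K.x-y≡0⇒x≡y (ι≡0⇒≡0 (trans (ι-⊕ a (K.⊝ b))
    (trans (cong (ι a ⊕_) (ι-⊝ b)) (x≡y⇒x-y≡0 eq))))

  Rational : Carrier → Set
  Rational x = ∃ λ a → ι a ≡ x

  rational? : ∀ x → Dec (Rational x)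
  rational? x = K.∃? (λ a → ι a ≟ x)

  rational-cancelˡ : ∀ {x y} → x ≢ 0# → Rational x → Rational (x ⊗ y) → Rational y
  rational-cancelˡ {x} {y} x≢0 (a , refl) (b , ιb≡xy)
    with a⁻¹ , aa⁻¹≡1 ← K.inverse a (λ { refl → x≢0 ι-0 }) = a⁻¹ K.⊗ b , (begin
      ι (a⁻¹ K.⊗ b)        ≡⟨ ι-⊗ a⁻¹ b ⟩
      ι a⁻¹ ⊗ ι b          ≡⟨ cong (ι a⁻¹ ⊗_) ιb≡xy ⟩
      ι a⁻¹ ⊗ (ι a ⊗ y)    ≡⟨ solve 3 (λ x y z → x :* (y :* z) := (y :* x) :* z) refl (ι a⁻¹) (ι a) y ⟩
      (ι a ⊗ ι a⁻¹) ⊗ y    ≡⟨ cong (_⊗ y) (trans (sym (ι-⊗ a a⁻¹)) (trans (cong ι aa⁻¹≡1) ι-1)) ⟩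
      1# ⊗ y               ≡⟨ *-identityˡ y ⟩
      y                    ∎)

  rational-⊗ : ∀ {x y} → Rational x → Rational y → Rational (x ⊗ y)
  rational-⊗ (a , refl) (b , refl) = a K.⊗ b , ι-⊗ a b

  abstract
    independent : ∀ {α} → ¬ Rational α → ∀ {a b} → ι a ⊕ (α ⊗ ι b) ≡ 0# → a ≡ K.0# × b ≡ K.0#
    independent {α} α∉K {a} {b} eq with b K.≟ K.0#
    ... | yes refl = ι≡0⇒≡0 (begin
        ι a                 ≡⟨ +-identityʳ _ ⟨
        ι a ⊕ 0#            ≡⟨ cong (ι a ⊕_) (trans (cong (α ⊗_) ι-0) (zeroʳ α)) ⟨
        ι a ⊕ (α ⊗ ι K.0#)  ≡⟨ eq ⟩
        0#                  ∎) , refl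
    ... | no b≢0 = contradiction (rational-cancelˡ (ι≢0 b≢0) (b , refl) (K.⊝ a , (begin
        ι (K.⊝ a)     ≡⟨ ι-⊝ a ⟩
        ⊝ ι a         ≡⟨ x⊕y≡0⇒x≡-y (trans (solve 3 (λ x y z → x :* y :+ z := z :+ y :* x) refl (ι b) α (ι a)) eq) ⟨
        ι b ⊗ α       ∎))) α∉K

    independent-≡ : ∀ {α} → ¬ Rational α → ∀ {a b a′ b′} →
      ι a ⊕ (α ⊗ ι b) ≡ ι a′ ⊕ (α ⊗ ι b′) → a ≡ a′ × b ≡ b′
    independent-≡ {α} α∉K {a} {b} {a′} {b′} eq = K.x-y≡0⇒x≡y (proj₁ both) , K.x-y≡0⇒x≡y (proj₂ both)
      where
      ι-minus : ∀ a b → ι (a K.⊕ (K.⊝ b)) ≡ ι a ⊕ (⊝ ι b)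
      ι-minus a b = trans (ι-⊕ a _) (cong (ι a ⊕_) (ι-⊝ b))
      both : a K.⊕ (K.⊝ a′) ≡ K.0# × b K.⊕ (K.⊝ b′) ≡ K.0#
      both = independent α∉K (begin
        ι (a K.⊕ (K.⊝ a′)) ⊕ (α ⊗ ι (b K.⊕ (K.⊝ b′)))   ≡⟨ cong₂ (λ x y → x ⊕ (α ⊗ y)) (ι-minus a a′) (ι-minus b b′) ⟩
        (ι a ⊕ (⊝ ι a′)) ⊕ (α ⊗ (ι b ⊕ (⊝ ι b′)))
          ≡⟨ solve 5 (λ a a′ b b′ α → (a :- a′) :+ α :* (b :- b′) := (a :+ α :* b) :- (a′ :+ α :* b′)) refl (ι a) (ι a′) (ι b) (ι b′) α ⟩
        (ι a ⊕ (α ⊗ ι b)) ⊕ (⊝ (ι a′ ⊕ (α ⊗ ι b′)))     ≡⟨ x≡y⇒x-y≡0 eq ⟩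
        0#                                              ∎)

    -- The q² combinations of 1 and α are distinct by independence, hence exhaust the q² elements of
    -- L.
    spanning : ∀ {α} → ¬ Rational α → ∀ x → ∃ λ a → ∃ λ b → x ≡ ι a ⊕ (α ⊗ ι b)
    spanning {α} α∉K x = let a , b , _ , _ , x≡ = ∈-cartesianProductWith⁻ comb K.elements K.elements
                               (Unique-⊆-length≥⇒⊇ _≟_ (Unique.cartesianProductWith⁺ comb (independent-≡ α∉K) K.elements! K.elements!)
                                 (λ {y} _ → ∈-elements y) (ℕ.≤-reflexive size-eq) (∈-elements x))
                           in a , b , x≡
      where
      comb : K.Carrier → K.Carrier → Carrier
      comb a b = ι a ⊕ (α ⊗ ι b)
      size-eq : length elements ≡ length (List.cartesianProductWith comb K.elements K.elements)
      size-eq = trans length-elements (sym (trans (length-cartesianProductWith comb K.elements K.elements)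
        (cong₂ ℕ._*_ K.length-elements K.length-elements)))

  -- The other root of a monic quadratic over K with root α. For rational α that quadratic is not
  -- determined, and `rational⇒≡` fixes it to be the one with double root α; the count of marked
  -- quadratics depends on this choice.
  record Conjugate (α : Carrier) : Set where
    field
      conj         : Carrier
      trace norm   : K.Carrier
      α+conj≡trace : α ⊕ conj ≡ ι trace
      α*conj≡norm  : α ⊗ conj ≡ ι norm
      rational⇒≡   : Rational α → conj ≡ α

  rational-conjugate : ∀ a → Conjugate (ι a)
  rational-conjugate a = record
    { conj = ι a ; trace = a K.⊕ a ; norm = a K.⊗ a
    ; α+conj≡trace = sym (ι-⊕ a a) ; α*conj≡norm = sym (ι-⊗ a a) ; rational⇒≡ = λ _ → refl }

  -- Expanding α² = a + bα in the basis 1, α shows that α is a root of z² - bz - a, whence trace b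
  -- and norm -a.
  irrational-conjugate : ∀ {α} → ¬ Rational α → Conjugate α
  irrational-conjugate {α} α∉K with a , b , α²≡ ← spanning α∉K (α ⊗ α) = record
    { conj = ι b ⊕ (⊝ α) ; trace = b ; norm = K.⊝ a
    ; α+conj≡trace = solve 2 (λ α b → α :+ (b :- α) := b) refl α (ι b)
    ; α*conj≡norm = begin
        α ⊗ (ι b ⊕ (⊝ α))                        ≡⟨ solve 2 (λ α b → α :* (b :- α) := α :* b :- α :* α) refl α (ι b) ⟩
        (α ⊗ ι b) ⊕ (⊝ (α ⊗ α))                  ≡⟨ cong (λ z → (α ⊗ ι b) ⊕ (⊝ z)) α²≡ ⟩
        (α ⊗ ι b) ⊕ (⊝ (ι a ⊕ (α ⊗ ι b)))        ≡⟨ solve 2 (λ a y → y :- (a :+ y) := :- a) refl (ι a) (α ⊗ ι b) ⟩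
        ⊝ ι a                                    ≡⟨ ι-⊝ a ⟨
        ι (K.⊝ a)                                ∎
    ; rational⇒≡ = λ α∈K → contradiction α∈K α∉K }

  abstract
    conjugate : ∀ α → Conjugate α
    conjugate α with rational? α
    ... | yes (a , refl) = rational-conjugate a
    ... | no α∉K = irrational-conjugate α∉K

  module _ {α : Carrier} (c : Conjugate α) where
    open Conjugate c

    -- Finite fields are perfect: in characteristic 2 the norm of α would have a square root in K.
    conj≡⇒rational : conj ≡ α → Rational α
    conj≡⇒rational conj≡α with (K.1# K.⊕ K.1#) K.≟ K.0#
    ... | no 2≢0 = rational-cancelˡ (ι≢0 2≢0) (_ , refl) (trace , (begin
        ι trace                    ≡⟨ α+conj≡trace ⟨
        α ⊕ conj                   ≡⟨ cong (α ⊕_) conj≡α ⟩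
        α ⊕ α                      ≡⟨ solve 1 (λ α → α :+ α := (con (+ 1) :+ con (+ 1)) :* α) refl α ⟩
        (1# ⊕ 1#) ⊗ α              ≡⟨ cong (_⊗ α) (trans (ι-⊕ K.1# K.1#) (cong₂ _⊕_ ι-1 ι-1)) ⟨
        ι (K.1# K.⊕ K.1#) ⊗ α      ∎))
    ... | yes 2≡0 with r , r²≡norm ← K.injective⇒surjective (λ x → x K.⊗ x) (K.char2-square-injective 2≡0) norm =
      r , char2-square-injective (trans (sym (trans (ι-⊕ K.1# K.1#) (cong₂ _⊕_ ι-1 ι-1))) (trans (cong ι 2≡0) ι-0)) (begin
        ι r ⊗ ι r       ≡⟨ ι-⊗ r r ⟨
        ι (r K.⊗ r)     ≡⟨ cong ι r²≡norm ⟩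
        ι norm          ≡⟨ α*conj≡norm ⟨
        α ⊗ conj        ≡⟨ cong (α ⊗_) conj≡α ⟩
        α ⊗ α           ∎)

  abstract
    -- The hypotheses say that (z - γ)(z - δ) and (z - α)(z - β) are the same polynomial, so the
    -- first vanishes at z = α.
    vieta : ∀ {α β γ δ} → α ⊕ β ≡ γ ⊕ δ → α ⊗ β ≡ γ ⊗ δ → (α ≡ γ × β ≡ δ) ⊎ (α ≡ δ × β ≡ γ)
    vieta {α} {β} {γ} {δ} s p = [ (λ z → inj₁ (case₁ (x-y≡0⇒x≡y z))) , (λ z → inj₂ (case₂ (x-y≡0⇒x≡y z))) ]′ (x⊗y≡0⇒x≡0⊎y≡0 (begin
        (α ⊕ (⊝ γ)) ⊗ (α ⊕ (⊝ δ))
          ≡⟨ solve 4 (λ α β γ δ → (α :- γ) :* (α :- δ) := α :* ((α :+ β) :- (γ :+ δ)) :- (α :* β :- γ :* δ)) refl α β γ δ ⟩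
        (α ⊗ ((α ⊕ β) ⊕ (⊝ (γ ⊕ δ)))) ⊕ (⊝ ((α ⊗ β) ⊕ (⊝ (γ ⊗ δ)))) ≡⟨ cong₂ (λ x y → (α ⊗ x) ⊕ (⊝ y)) (x≡y⇒x-y≡0 s) (x≡y⇒x-y≡0 p) ⟩
        (α ⊗ 0#) ⊕ (⊝ 0#)           ≡⟨ solve 1 (λ α → α :* con (+ 0) :- con (+ 0) := con (+ 0)) refl α ⟩
        0#                          ∎))
      where
      cancel : ∀ {x y z w} → x ⊕ y ≡ z ⊕ w → x ≡ z → y ≡ w
      cancel {x} {y} {_} {w} eq refl = trans (solve 2 (λ x y → y := (x :+ y) :- x) refl x y)
        (trans (cong (_⊕ (⊝ x)) eq) (solve 2 (λ x w → (x :+ w) :- x := w) refl x w))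
      case₁ : α ≡ γ → α ≡ γ × β ≡ δ
      case₁ α≡γ = α≡γ , cancel s α≡γ
      case₂ : α ≡ δ → α ≡ δ × β ≡ γ
      case₂ α≡δ = α≡δ , cancel (trans s (solve 2 (λ x y → x :+ y := y :+ x) refl γ δ)) α≡δ

  -- Each monic quadratic over K comes with two marks.  Ordered pairs of roots in K (marked by
  -- whether the first is strictly smaller) and elements of L (marked by whether they
  -- precede their conjugate weakly) inject into the 2q² marked quadratics, so this
  -- injection is onto and every quadratic has a root in L.
  module _ where
    private
      Marked : Set
      Marked = Bool × K.Carrier × K.Carrier

      -- The mark says that a strictly precedes b. Thus (a, b) and (b, a) differ in their marks when
      -- a ≠ b, while (a, a) gets `false` and leaves `true` free for the element `ι a` of L.
      fromPair : K.Carrier → K.Carrier → Marked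
      fromPair a b = not (ι b ≤ᵇ ι a) , a K.⊕ b , a K.⊗ b

      fromElement : Carrier → Marked
      fromElement α = α ≤ᵇ conj , trace , norm
        where open Conjugate (conjugate α)

      marked-injective : ∀ {x y : Marked} → x ≡ y →
        proj₁ x ≡ proj₁ y × proj₁ (proj₂ x) ≡ proj₁ (proj₂ y) × proj₂ (proj₂ x) ≡ proj₂ (proj₂ y)
      marked-injective refl = refl , refl , refl

      fromPair-injective : ∀ {a b c d} → fromPair a c ≡ fromPair b d → a ≡ b × c ≡ d
      fromPair-injective {a} {b} {c} {d} eq with m , s , p ← marked-injective eq
        with vieta (trans (sym (ι-⊕ a c)) (trans (cong ι s) (ι-⊕ b d))) (trans (sym (ι-⊗ a c)) (trans (cong ι p) (ι-⊗ b d)))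
      ... | inj₁ (ιa≡ιb , ιc≡ιd) = ι-injective ιa≡ιb , ι-injective ιc≡ιd
      ... | inj₂ (ιa≡ιd , ιc≡ιb) with refl ← ι-injective ιa≡ιd | refl ← ι-injective ιc≡ιb
        -- A pair and its swap carry the same mark only if their entries coincide.
        with refl ← ι-injective (≤ᵇ-sym⇒≡ (not-injective m)) = refl , refl

      fromElement-injective : ∀ {α β} → fromElement α ≡ fromElement β → α ≡ β
      fromElement-injective {α} {β} eq with m , s , p ← marked-injective eq
        with vieta (trans (α+conj≡trace (conjugate α)) (trans (cong ι s) (sym (α+conj≡trace (conjugate β)))))
                   (trans (α*conj≡norm (conjugate α)) (trans (cong ι p) (sym (α*conj≡norm (conjugate β)))))
        where open Conjugate
      ... | inj₁ (α≡β , _) = α≡β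
      ... | inj₂ (α≡β̄ , ᾱ≡β) = trans α≡β̄ (≤ᵇ-sym⇒≡ (trans (cong₂ _≤ᵇ_ (sym α≡β̄) (sym ᾱ≡β)) m) )

      -- Handles a clash between the two kinds of objects: a pair with the trace and norm of α has α
      -- among its entries, so α is rational, equals its conjugate, and both entries are α. The
      -- strict mark is then `false` and the weak one `true`.
      strict≢weak : ∀ {x y z w} → x ≡ y → w ≡ z → not (x ≤ᵇ y) ≢ z ≤ᵇ w
      strict≢weak {x} {z = z} refl refl rewrite ≤ᵇ-refl x | ≤ᵇ-refl z = λ ()

      fromPair≢fromElement : ∀ {a b α} → fromPair a b ≢ fromElement α
      fromPair≢fromElement {a} {b} {α} eq with m , s , p ← marked-injective eq
        with vieta (trans (sym (ι-⊕ a b)) (trans (cong ι s) (sym α+conj≡trace))) (trans (sym (ι-⊗ a b)) (trans (cong ι p) (sym α*conj≡norm)))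
        where open Conjugate (conjugate α)
      ... | inj₁ (ιa≡α , ιb≡ᾱ) = strict≢weak (trans ιb≡ᾱ (trans (rational⇒≡ (a , ιa≡α)) (sym ιa≡α))) (rational⇒≡ (a , ιa≡α)) m
        where open Conjugate (conjugate α)
      ... | inj₂ (ιa≡ᾱ , ιb≡α) = strict≢weak (trans ιb≡α (trans (sym (rational⇒≡ (b , ιb≡α))) (sym ιa≡ᾱ))) (rational⇒≡ (b , ιb≡α)) m
        where open Conjugate (conjugate α)

      pairs fromL images allMarked : List Marked
      pairs = List.cartesianProductWith fromPair K.elements K.elements
      fromL = List.map fromElement elements
      images = pairs ++ fromL
      allMarked = List.cartesianProduct (true ∷ false ∷ []) (List.cartesianProduct K.elements K.elements)

      images! : Unique images
      images! = Unique.++⁺ (Unique.cartesianProductWith⁺ fromPair fromPair-injective K.elements! K.elements!)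
        (Unique.map⁺ fromElement-injective elements!)
        λ { (x∈pairs , x∈fromL) → disjoint (∈-cartesianProductWith⁻ fromPair K.elements K.elements x∈pairs) (∈-map⁻ fromElement x∈fromL) }
        where
        disjoint : ∀ {x} → (∃ λ a → ∃ λ b → a ∈ K.elements × b ∈ K.elements × x ≡ fromPair a b) →
          (∃ λ α → α ∈ elements × x ≡ fromElement α) → ⊥
        disjoint (a , b , _ , _ , refl) (α , _ , eq) = fromPair≢fromElement {a} {b} {α} eq

      ∈-allMarked : ∀ x → x ∈ allMarked
      ∈-allMarked (m , a , b) = ∈-cartesianProduct⁺ (∈-marks m) (∈-cartesianProduct⁺ (K.∈-elements a) (K.∈-elements b))
        where
        ∈-marks : ∀ m → m ∈ true ∷ false ∷ []
        ∈-marks true = here refl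
        ∈-marks false = there (here refl)

      length-allMarked : length allMarked ≡ length images
      length-allMarked = begin
        length allMarked
          ≡⟨ length-cartesianProductWith _,_ (true ∷ false ∷ []) (List.cartesianProduct K.elements K.elements) ⟩
        2 ℕ.* length (List.cartesianProduct K.elements K.elements)
          ≡⟨ cong (2 ℕ.*_) (length-cartesianProductWith _,_ K.elements K.elements) ⟩
        2 ℕ.* (length K.elements ℕ.* length K.elements)   ≡⟨ cong (length K.elements ℕ.* length K.elements ℕ.+_) (ℕ.+-identityʳ _) ⟩
        length K.elements ℕ.* length K.elements ℕ.+ length K.elements ℕ.* length K.elements
          ≡⟨ cong₂ ℕ._+_ (sym (length-cartesianProductWith fromPair K.elements K.elements))
               (trans (cong₂ ℕ._*_ K.length-elements K.length-elements) (sym (trans (List.length-map fromElement elements) length-elements))) ⟩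
        length pairs ℕ.+ length fromL                 ≡⟨ List.length-++ pairs ⟨
        length images                                 ∎

    private abstract
      images-onto : ∀ x → (∃ λ a → ∃ λ b → a ∈ K.elements × b ∈ K.elements × x ≡ fromPair a b) ⊎
        (∃ λ α → α ∈ elements × x ≡ fromElement α)
      images-onto x = Sum.map (∈-cartesianProductWith⁻ fromPair K.elements K.elements) (∈-map⁻ fromElement)
        (∈-++⁻ pairs (Unique-⊆-length≥⇒⊇ (≡-dec _≟ᵇ_ (≡-dec K._≟_ K._≟_)) images! (λ {x} _ → ∈-allMarked x)
          (ℕ.≤-reflexive length-allMarked) (∈-allMarked x)))

    monicQuadratic-root : ∀ t n → (∃ λ a → (a K.⊗ a) K.⊕ n ≡ t K.⊗ a) ⊎ (∃ λ α → (α ⊗ α) ⊕ ι n ≡ ι t ⊗ α)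
    -- Either mark would do: every marked quadratic is an image, and a preimage exhibits a root.
    monicQuadratic-root t n with images-onto (true , t , n)
    ... | inj₁ (a , b , _ , _ , eq) with _ , refl , refl ← marked-injective eq =
      inj₁ (a , K.solve 2 (λ a b → a K.:* a K.:+ a K.:* b K.:= (a K.:+ b) K.:* a) refl a b)
    ... | inj₂ (α , _ , eq) with _ , refl , refl ← marked-injective eq =
      inj₂ (α , (begin
        (α ⊗ α) ⊕ ι norm          ≡⟨ cong ((α ⊗ α) ⊕_) α*conj≡norm ⟨
        (α ⊗ α) ⊕ (α ⊗ conj)      ≡⟨ solve 2 (λ α β → α :* α :+ α :* β := (α :+ β) :* α) refl α conj ⟩
        (α ⊕ conj) ⊗ α            ≡⟨ cong (_⊗ α) α+conj≡trace ⟩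
        ι trace ⊗ α               ∎))
      where open Conjugate (conjugate α)

-- The factorization q² - 1 = (q + 1)(q - 1) for q = k + 2, written without subtraction.
square-pred : ∀ k → (2 ℕ.+ k) ℕ.* (2 ℕ.+ k) ≡ suc ((3 ℕ.+ k) ℕ.* suc k)
square-pred = solve 1 (λ k → (con 2 :+ k) :* (con 2 :+ k) := con 1 :+ (con 3 :+ k) :* (con 1 :+ k)) refl
  where open +-*-Solver

∣-∸⇒≡ : ∀ {k m n} → m ℕ.≤ n → n ℕ.< k → k ∣ n ℕ.∸ m → m ≡ n
∣-∸⇒≡ {k} {m} {n} m≤n n<k k∣n∸m with n ℕ.∸ m in eq
... | zero = ℕ.≤-antisym m≤n (ℕ.m∸n≡0⇒m≤n eq)
... | suc r = contradiction k∣n∸m (>⇒∤ (ℕ.≤-<-trans (ℕ.≤-reflexive (sym eq)) (ℕ.≤-<-trans (ℕ.m∸n≤m n m) n<k)))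

-- Powers of the generator modulo K^×

module PrimitiveElement {q : ℕ} {K L : Field} (K-size : HasSize K q) (L-size : HasSize L (q ℕ.* q))
                        (emb : Embedding K L) (ζ : Field.Carrier L) (gen : Generator L ζ) where
  private
    module K where
      open FieldTheory K public
      open FiniteField K K-size public
  open FieldTheory L
  open FiniteField L L-size
  open EmbeddingTheory emb
  open QuadraticExtension K-size L-size emb
  open ≡-Reasoning

  ζ≢0 : ζ ≢ 0#
  ζ≢0 = proj₁ gen

  log : ∀ {x} → x ≢ 0# → ∃ λ i → ζ ^F i ≡ x
  log {x} = proj₂ gen x

  private
    abstract
      least : ∃ λ e → Rational (ζ ^F suc e) × (∀ {m} → m ℕ.< e → ¬ Rational (ζ ^F suc m))
      -- A positive rational power exists because the inverse of ζ is itself a power ζⁱ, so that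
      -- ζ^(i + 1) = 1.
      least with ζ⁻¹ , ζζ⁻¹≡1 ← inverse ζ ζ≢0 with i , ζ^i≡ζ⁻¹ ← log (inverse≢0 ζζ⁻¹≡1) =
        least-positive (λ n → rational? (ζ ^F n)) i (K.1# , trans ι-1 (sym (trans (cong (ζ ⊗_) ζ^i≡ζ⁻¹) ζζ⁻¹≡1)))

    -- The order of ζ in the quotient of L^× by K^×; the count in `d≡1+q` identifies it.
    d : ℕ
    d = suc (proj₁ least)

    ζ^[k*d]-rational : ∀ k → Rational (ζ ^F (k ℕ.* d))
    ζ^[k*d]-rational zero = K.1# , ι-1
    ζ^[k*d]-rational (suc k) = subst Rational (sym (^-+ ζ d (k ℕ.* d)))
      (rational-⊗ (proj₁ (proj₂ least)) (ζ^[k*d]-rational k))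

    split : ∀ n → ζ ^F n ≡ (ζ ^F (n / d ℕ.* d)) ⊗ (ζ ^F (n % d))
    split n = trans (cong (ζ ^F_) (trans (m≡m%n+[m/n]*n n d) (ℕ.+-comm (n % d) _))) (^-+ ζ (n / d ℕ.* d) (n % d))

    rational⇒d∣ : ∀ n → Rational (ζ ^F n) → d ∣ n
    rational⇒d∣ n ζ^n∈K = m%n≡0⇒n∣m n d (remainder≡0 (n % d) (m%n<n n d)
      (rational-cancelˡ (^≢0 ζ≢0 (n / d ℕ.* d)) (ζ^[k*d]-rational (n / d)) (subst Rational (split n) ζ^n∈K)))
      where
      remainder≡0 : ∀ r → r ℕ.< d → Rational (ζ ^F r) → r ≡ 0
      remainder≡0 zero _ _ = refl
      remainder≡0 (suc r) (ℕ.s≤s r<e) ζ^r∈K = contradiction ζ^r∈K (proj₂ (proj₂ least) r<e)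

    -- Coset representatives ζ^r of K^× in L^×. The assumption x ≠ 0 stands after the witnesses,
    -- with dummy values at 0, so that r and a depend on x alone and `code` is a function on all of
    -- L.
    decompose : ∀ x → ∃ λ r → ∃ λ a → x ≢ 0# → r ℕ.< d × a ≢ K.0# × x ≡ (ζ ^F r) ⊗ ι a
    decompose x with x ≟ 0#
    ... | yes x≡0 = 0 , K.0# , λ x≢0 → contradiction x≡0 x≢0
    ... | no x≢0 with n , ζ^n≡x ← log x≢0 with a , ιa≡ ← ζ^[k*d]-rational (n / d) =
      n % d , a , λ _ → m%n<n n d , (λ { refl → ^≢0 ζ≢0 (n / d ℕ.* d) (trans (sym ιa≡) ι-0) }) , (begin
        x                                        ≡⟨ ζ^n≡x ⟨
        ζ ^F n                                   ≡⟨ split n ⟩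
        (ζ ^F (n / d ℕ.* d)) ⊗ (ζ ^F (n % d))    ≡⟨ *-comm _ _ ⟩
        (ζ ^F (n % d)) ⊗ (ζ ^F (n / d ℕ.* d))    ≡⟨ cong ((ζ ^F (n % d)) ⊗_) ιa≡ ⟨
        (ζ ^F (n % d)) ⊗ ι a                     ∎)

    quotient-rational : ∀ {m n} → m ℕ.≤ n → ∀ {a b} → a ≢ K.0# → (ζ ^F m) ⊗ ι b ≡ (ζ ^F n) ⊗ ι a → d ∣ n ℕ.∸ m
    quotient-rational {m} {n} m≤n {a} {b} a≢0 eq = rational⇒d∣ (n ℕ.∸ m)
      (rational-cancelˡ (ι≢0 a≢0) (a , refl) (b , ⊗-cancelˡ (^≢0 ζ≢0 m) (begin
        (ζ ^F m) ⊗ ι b                           ≡⟨ eq ⟩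
        (ζ ^F n) ⊗ ι a                           ≡⟨ cong (λ k → (ζ ^F k) ⊗ ι a) (ℕ.m+[n∸m]≡n m≤n) ⟨
        (ζ ^F (m ℕ.+ (n ℕ.∸ m))) ⊗ ι a           ≡⟨ cong (_⊗ ι a) (^-+ ζ m (n ℕ.∸ m)) ⟩
        ((ζ ^F m) ⊗ (ζ ^F (n ℕ.∸ m))) ⊗ ι a      ≡⟨ solve 3 (λ x y z → (x :* y) :* z := x :* (z :* y)) refl _ _ _ ⟩
        (ζ ^F m) ⊗ (ι a ⊗ (ζ ^F (n ℕ.∸ m)))      ∎)))

    exponents-unique : ∀ {m n a b} → m ℕ.< d → n ℕ.< d → a ≢ K.0# → b ≢ K.0# →
      (ζ ^F m) ⊗ ι b ≡ (ζ ^F n) ⊗ ι a → m ≡ n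
    exponents-unique {m} {n} m<d n<d a≢0 b≢0 eq with ℕ.≤-total m n
    ... | inj₁ m≤n = ∣-∸⇒≡ m≤n n<d (quotient-rational m≤n a≢0 eq)
    ... | inj₂ n≤m = sym (∣-∸⇒≡ n≤m m<d (quotient-rational n≤m b≢0 (sym eq)))

    combine : ℕ → K.Carrier → Carrier
    combine r a = (ζ ^F r) ⊗ ι a

    code : Carrier → ℕ × K.Carrier
    code x = proj₁ (decompose x) , proj₁ (proj₂ (decompose x))

    code-combine : ∀ {r a} → r ℕ.< d → a ≢ K.0# → (r , a) ≡ code (combine r a)
    code-combine {r} {a} r<d a≢0 with r′<d , a′≢0 , eq ← proj₂ (proj₂ (decompose (combine r a))) (x⊗y≢0 (^≢0 ζ≢0 r) (ι≢0 a≢0)) =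
      cong₂ _,_ r≡r′ (ι-injective (⊗-cancelˡ (^≢0 ζ≢0 r) (trans eq (cong (λ k → combine k (proj₂ (code (combine r a)))) (sym r≡r′)))))
      where
      r≡r′ : r ≡ proj₁ (decompose (combine r a))
      r≡r′ = exponents-unique r<d r′<d a′≢0 a≢0 eq

    abstract
      -- The products ζ^r · a cover the units, which bounds their number from above; each pair (r,
      -- a) is the code of its product, which bounds it from below.
      length-units≡ : length units ≡ d ℕ.* length K.units
      length-units≡ = ℕ.≤-antisym
        (ℕ.≤-trans (Unique-⊆⇒length≤ units! units⊆)
          (ℕ.≤-reflexive (trans (length-cartesianProductWith combine (List.upTo d) K.units) ∣upTo∣*)))
        (ℕ.≤-trans (ℕ.≤-reflexive (sym (trans (length-cartesianProductWith _,_ (List.upTo d) K.units) ∣upTo∣*)))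
          (ℕ.≤-trans (Unique-⊆⇒length≤ (Unique.cartesianProduct⁺ (Unique.upTo⁺ d) K.units!) ⊆codes)
            (ℕ.≤-reflexive (List.length-map code units))))
        where
        ∣upTo∣* : length (List.upTo d) ℕ.* length K.units ≡ d ℕ.* length K.units
        ∣upTo∣* = cong (ℕ._* length K.units) (List.length-upTo d)
        units⊆ : ∀ {x} → x ∈ units → x ∈ List.cartesianProductWith combine (List.upTo d) K.units
        units⊆ {x} x∈units with r<d , a≢0 , eq ← proj₂ (proj₂ (decompose x)) (∈-units⁻ x∈units) =
          subst (_∈ _) (sym eq) (∈-cartesianProductWith⁺ combine (∈-upTo⁺ r<d) (K.∈-units⁺ a≢0))
        ⊆codes : ∀ {p} → p ∈ List.cartesianProduct (List.upTo d) K.units → p ∈ List.map code units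
        ⊆codes {r , a} p∈ with r∈ , a∈ ← ∈-cartesianProduct⁻ (List.upTo d) K.units p∈ =
          subst (_∈ _) (sym (code-combine (∈-upTo⁻ r∈) (K.∈-units⁻ a∈)))
            (∈-map⁺ code (∈-units⁺ (x⊗y≢0 (^≢0 ζ≢0 r) (ι≢0 (K.∈-units⁻ a∈)))))

    -- Counting gives d(q - 1) = q² - 1, and q - 1 can be cancelled because 1 is a unit of K.
    d≡1+q : d ≡ suc q
    d≡1+q = solve-count (length K.units) K.length-units (positive (K.∈-units⁺ K.1≢0))
      (trans (sym length-units) (cong suc length-units≡))
      where
      positive : ∀ {x xs} → x ∈ xs → ∃ λ k → length xs ≡ suc k
      positive {xs = _ ∷ xs} _ = length xs , refl
      solve-count : ∀ u → suc u ≡ q → (∃ λ k → u ≡ suc k) → q ℕ.* q ≡ suc (d ℕ.* u) → d ≡ suc q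
      solve-count (suc k) refl (k , refl) eq = ℕ.*-cancelʳ-≡ d _ (suc k) (ℕ.suc-injective (trans (sym eq)
        (square-pred k)))

  rational⇒1+q∣ : ∀ n → Rational (ζ ^F n) → suc q ∣ n
  rational⇒1+q∣ n = subst (_∣ n) d≡1+q ∘ rational⇒d∣ n

  1+q∣⇒rational : ∀ {n} → suc q ∣ n → Rational (ζ ^F n)
  1+q∣⇒rational (divides k refl) = subst (λ d → Rational (ζ ^F (k ℕ.* d))) d≡1+q (ζ^[k*d]-rational k)

  small-power-irrational : ∀ {i} → 0 ℕ.< i → i ℕ.≤ ℕ.⌊ suc q /2⌋ → ¬ Rational (ζ ^F i)
  small-power-irrational {suc i} _ i≤h ζ^i∈K = >⇒∤ (ℕ.≤-<-trans i≤h (ℕ.⌊n/2⌋<n q)) (rational⇒1+q∣ (suc i) ζ^i∈K)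

  ratio-rational⇒≡ : ∀ {i j a b} → i ℕ.≤ ℕ.⌊ suc q /2⌋ → j ℕ.≤ ℕ.⌊ suc q /2⌋ → a ≢ K.0# → b ≢ K.0# →
    (ζ ^F i) ⊗ ι b ≡ (ζ ^F j) ⊗ ι a → i ≡ j
  ratio-rational⇒≡ {i} {j} i≤h j≤h = exponents-unique (bound i≤h) (bound j≤h)
    where
    bound : ∀ {k} → k ℕ.≤ ℕ.⌊ suc q /2⌋ → k ℕ.< d
    bound {k} k≤h = subst (k ℕ.<_) (sym d≡1+q) (ℕ.≤-<-trans k≤h (ℕ.⌊n/2⌋<n q))

  -- With h = ⌊(q + 1)/2⌋, the divisor q + 1 of the positive number i + j is at least 2h, while i
  -- and j are at most h; hence both equal h.
  product-rational⇒≡ : ∀ {i j} → 0 ℕ.< i → i ℕ.≤ ℕ.⌊ suc q /2⌋ → j ℕ.≤ ℕ.⌊ suc q /2⌋ →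
    Rational ((ζ ^F i) ⊗ (ζ ^F j)) → i ≡ j
  product-rational⇒≡ {suc i} {j} _ i≤h j≤h ij∈K = trans (extremal (suc i) j i≤h j≤h 2h≤i+j)
      (sym (extremal j (suc i) j≤h i≤h (ℕ.≤-trans 2h≤i+j (ℕ.≤-reflexive (ℕ.+-comm (suc i) j)))))
    where
    h : ℕ
    h = ℕ.⌊ suc q /2⌋
    2h≤i+j : h ℕ.+ h ℕ.≤ suc i ℕ.+ j
    2h≤i+j = ℕ.≤-trans (ℕ.+-monoʳ-≤ h (ℕ.⌊n/2⌋≤⌈n/2⌉ (suc q))) (ℕ.≤-trans (ℕ.≤-reflexive (ℕ.⌊n/2⌋+⌈n/2⌉≡n (suc q)))
      (∣⇒≤ (rational⇒1+q∣ (suc i ℕ.+ j) (subst Rational (sym (^-+ ζ (suc i) j)) ij∈K))))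
    extremal : ∀ m n → m ℕ.≤ h → n ℕ.≤ h → h ℕ.+ h ℕ.≤ m ℕ.+ n → m ≡ h
    extremal m n m≤h n≤h 2h≤m+n with ℕ.m≤n⇒m<n∨m≡n m≤h
    ... | inj₁ m<h = contradiction (ℕ.+-mono-<-≤ m<h n≤h) (ℕ.≤⇒≯ 2h≤m+n)
    ... | inj₂ m≡h = m≡h

  abstract
    -- Write γ = ζⁿ and r = n mod q + 1. If r is in the range, i = r works; otherwise i = q + 1 - r
    -- makes n + i a multiple of q + 1. Irrationality of γ gives r ≠ 0.
    representative : ∀ {γ} → ¬ Rational γ → ∃ λ i → 0 ℕ.< i × i ℕ.≤ ℕ.⌊ suc q /2⌋ ×
      ((∃ λ a → γ ≡ ι a ⊗ (ζ ^F i)) ⊎ (∃ λ a → γ ⊗ (ζ ^F i) ≡ ι a))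
    representative {γ} γ∉K with n , refl ← log {γ} (λ { refl → γ∉K (K.0# , ι-0) }) with n % suc q ℕ.≤? ℕ.⌊ suc q /2⌋
    ... | yes r≤h = n % suc q , positive , r≤h , inj₁ (proj₁ multiple , (begin
        ζ ^F n                                             ≡⟨ cong (ζ ^F_) (trans (m≡m%n+[m/n]*n n (suc q)) (ℕ.+-comm (n % suc q) _)) ⟩
        ζ ^F (n / suc q ℕ.* suc q ℕ.+ n % suc q)           ≡⟨ ^-+ ζ (n / suc q ℕ.* suc q) (n % suc q) ⟩
        (ζ ^F (n / suc q ℕ.* suc q)) ⊗ (ζ ^F (n % suc q))  ≡⟨ cong (_⊗ (ζ ^F (n % suc q))) (proj₂ multiple) ⟨
        ι (proj₁ multiple) ⊗ (ζ ^F (n % suc q))            ∎))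
      where
      multiple : Rational (ζ ^F (n / suc q ℕ.* suc q))
      multiple = 1+q∣⇒rational (divides (n / suc q) refl)
      positive : 0 ℕ.< n % suc q
      positive = ℕ.n≢0⇒n>0 λ r≡0 → γ∉K (1+q∣⇒rational (m%n≡0⇒n∣m n (suc q) r≡0))
    ... | no r≰h = suc q ℕ.∸ r , ℕ.m<n⇒0<n∸m (m%n<n n (suc q)) , small , inj₂ (proj₁ multiple , (begin
        (ζ ^F n) ⊗ (ζ ^F (suc q ℕ.∸ r))     ≡⟨ ^-+ ζ n (suc q ℕ.∸ r) ⟨
        ζ ^F (n ℕ.+ (suc q ℕ.∸ r))          ≡⟨ proj₂ multiple ⟨
        ι (proj₁ multiple)                  ∎))
      where
      r : ℕ
      r = n % suc q
      n+i : n ℕ.+ (suc q ℕ.∸ r) ≡ suc (n / suc q) ℕ.* suc q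
      n+i = begin
        n ℕ.+ (suc q ℕ.∸ r)                              ≡⟨ cong (ℕ._+ (suc q ℕ.∸ r)) (trans (m≡m%n+[m/n]*n n (suc q)) (ℕ.+-comm r _)) ⟩
        n / suc q ℕ.* suc q ℕ.+ r ℕ.+ (suc q ℕ.∸ r)      ≡⟨ ℕ.+-assoc (n / suc q ℕ.* suc q) r _ ⟩
        n / suc q ℕ.* suc q ℕ.+ (r ℕ.+ (suc q ℕ.∸ r))    ≡⟨ cong (n / suc q ℕ.* suc q ℕ.+_) (ℕ.m+[n∸m]≡n (ℕ.<⇒≤ (m%n<n n (suc q)))) ⟩
        n / suc q ℕ.* suc q ℕ.+ suc q                    ≡⟨ ℕ.+-comm _ (suc q) ⟩
        suc (n / suc q) ℕ.* suc q                        ∎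
      multiple : Rational (ζ ^F (n ℕ.+ (suc q ℕ.∸ r)))
      multiple = 1+q∣⇒rational (divides (suc (n / suc q)) n+i)
      -- Here r is at least ⌊(q + 1)/2⌋ + 1, hence at least ⌈(q + 1)/2⌉, and the floor and the
      -- ceiling add up to q + 1.
      small : suc q ℕ.∸ r ℕ.≤ ℕ.⌊ suc q /2⌋
      small = ℕ.m≤n+o⇒m∸n≤o (suc q) r (ℕ.≤-trans (ℕ.≤-reflexive (trans (sym (ℕ.⌊n/2⌋+⌈n/2⌉≡n (suc q))) (ℕ.+-comm _ ℕ.⌈ suc q /2⌉)))
        (ℕ.+-monoˡ-≤ ℕ.⌊ suc q /2⌋ (ℕ.≤-trans (ℕ.s≤s (ℕ.⌊n/2⌋-mono (ℕ.n≤1+n q))) (ℕ.≰⇒> r≰h))))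

-- Binary forms and separability

-- The target is any commutative ring, so that one theory of evaluation serves both for extension
-- fields and for their dual numbers.
record IsHom (K : Field) (R : CommutativeRing 0ℓ 0ℓ) (ι : Field.Carrier K → CommutativeRing.Carrier R) : Set where
  private
    module K = Field K
    module R = CommutativeRing R
  field
    ⊕-homo : ∀ a b → ι (a K.⊕ b) R.≈ ι a R.+ ι b
    ⊗-homo : ∀ a b → ι (a K.⊗ b) R.≈ ι a R.* ι b
    0-homo : ι K.0# R.≈ R.0#
    1-homo : ι K.1# R.≈ R.1#

module Evaluation {K : Field} {R : CommutativeRing 0ℓ 0ℓ} {ι : Field.Carrier K → CommutativeRing.Carrier R}
                  (isHom : IsHom K R ι) where
  open CommutativeRing R renaming (refl to ≈-refl; sym to ≈-sym; trans to ≈-trans) hiding (zero)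
  open IsHom isHom
  open Exp semiring using (_^_)
  private module K = Field K
  open Poly K hiding (subst)
  open IntegerCoefficients R
  open SetoidReasoning setoid

  -- Horner's rule in x for a binary form, the first entry being the coefficient of y^n.
  ev : ∀ {n} → Vec K.Carrier (suc n) → Carrier → Carrier → Carrier
  ev {zero} (a ∷ []) x y = ι a
  ev {suc n} (a ∷ v) x y = ι a * y ^ suc n + x * ev v x y

  module _ (x y : Carrier) where

    ev-scale : ∀ {n} a (v : Vec K.Carrier (suc n)) → ev (scale a v) x y ≈ ι a * ev v x y
    ev-scale {zero} a (b ∷ []) = ⊗-homo a b
    ev-scale {suc n} a (b ∷ v) = begin
      ι (a K.⊗ b) * y ^ suc n + x * ev (scale a v) x y  ≈⟨ +-cong (*-congʳ (⊗-homo a b)) (*-congˡ (ev-scale a v)) ⟩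
      ι a * ι b * y ^ suc n + x * (ι a * ev v x y)
        ≈⟨ solve 5 (λ a b p x e → a :* b :* p :+ x :* (a :* e) := a :* (b :* p :+ x :* e)) ≈-refl (ι a) (ι b) (y ^ suc n) x (ev v x y) ⟩
      ι a * (ι b * y ^ suc n + x * ev v x y)            ∎

    ev-⊕ : ∀ {n} (u v : Vec K.Carrier (suc n)) → ev (zipWith K._⊕_ u v) x y ≈ ev u x y + ev v x y
    ev-⊕ {zero} (a ∷ []) (b ∷ []) = ⊕-homo a b
    ev-⊕ {suc n} (a ∷ u) (b ∷ v) = begin
      ι (a K.⊕ b) * y ^ suc n + x * ev (zipWith K._⊕_ u v) x y       ≈⟨ +-cong (*-congʳ (⊕-homo a b)) (*-congˡ (ev-⊕ u v)) ⟩
      (ι a + ι b) * y ^ suc n + x * (ev u x y + ev v x y)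
        ≈⟨ solve 6 (λ a b p x e f → (a :+ b) :* p :+ x :* (e :+ f) := (a :* p :+ x :* e) :+ (b :* p :+ x :* f)) ≈-refl (ι a) (ι b) (y ^ suc n) x (ev u x y) (ev v x y) ⟩
      (ι a * y ^ suc n + x * ev u x y) + (ι b * y ^ suc n + x * ev v x y) ∎

    ev-∷ʳ0 : ∀ {n} (v : Vec K.Carrier (suc n)) → ev (v ∷ʳ K.0#) x y ≈ y * ev v x y
    ev-∷ʳ0 {zero} (a ∷ []) = begin
      ι a * (y * 1#) + x * ι K.0#  ≈⟨ +-congˡ (*-congˡ 0-homo) ⟩
      ι a * (y * 1#) + x * 0#      ≈⟨ solve 3 (λ a x y → a :* (y :* con (+ 1)) :+ x :* con (+ 0) := y :* a) ≈-refl (ι a) x y ⟩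
      y * ι a                      ∎
    ev-∷ʳ0 {suc n} (a ∷ v) = begin
      ι a * (y * y ^ suc n) + x * ev (v ∷ʳ K.0#) x y   ≈⟨ +-congˡ (*-congˡ (ev-∷ʳ0 v)) ⟩
      ι a * (y * y ^ suc n) + x * (y * ev v x y)
        ≈⟨ solve 5 (λ a p x y e → a :* (y :* p) :+ x :* (y :* e) := y :* (a :* p :+ x :* e)) ≈-refl (ι a) (y ^ suc n) x y (ev v x y) ⟩
      y * (ι a * y ^ suc n + x * ev v x y)             ∎

    ev-pad : ∀ k {n} (v : Vec K.Carrier (suc n)) → ev (pad k v) x y ≈ y ^ k * ev v x y
    ev-pad zero v = ≈-sym (*-identityˡ _)
    ev-pad (suc k) v = begin
      ev (pad k v ∷ʳ K.0#) x y   ≈⟨ ev-∷ʳ0 (pad k v) ⟩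
      y * ev (pad k v) x y       ≈⟨ *-congˡ (ev-pad k v) ⟩
      y * (y ^ k * ev v x y)     ≈⟨ *-assoc _ _ _ ⟨
      y ^ suc k * ev v x y       ∎

    ev-mul : ∀ {m n} (u : Vec K.Carrier (suc m)) (v : Vec K.Carrier (suc n)) →
      ev (mul u v) x y ≈ ev u x y * ev v x y
    ev-mul {zero} (a ∷ []) v = ev-scale a v
    ev-mul {suc m} {n} (a ∷ u) v = begin
      ev (zipWith K._⊕_ (pad (suc m) (scale a v)) (K.0# ∷ mul u v)) x y
        ≈⟨ ev-⊕ (pad (suc m) (scale a v)) (K.0# ∷ mul u v) ⟩
      ev (pad (suc m) (scale a v)) x y + (ι K.0# * y ^ suc (m ℕ.+ n) + x * ev (mul u v) x y)
        ≈⟨ +-cong (≈-trans (ev-pad (suc m) (scale a v)) (*-congˡ (ev-scale a v))) (+-cong (*-congʳ 0-homo) (*-congˡ (ev-mul u v))) ⟩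
      y ^ suc m * (ι a * ev v x y) + (0# * y ^ suc (m ℕ.+ n) + x * (ev u x y * ev v x y))
        ≈⟨ solve 6 (λ a p p′ x e f → p :* (a :* f) :+ (con (+ 0) :* p′ :+ x :* (e :* f)) := (a :* p :+ x :* e) :* f) ≈-refl (ι a) (y ^ suc m) (y ^ suc (m ℕ.+ n)) x (ev u x y) (ev v x y) ⟩
      (ι a * y ^ suc m + x * ev u x y) * ev v x y ∎

    ev-powL : ∀ n (L : Vec K.Carrier 2) → ev (powL n L) x y ≈ ev L x y ^ n
    ev-powL zero L = 1-homo
    ev-powL (suc n) L = ≈-trans (ev-mul L (powL n L)) (*-congˡ (ev-powL n L))

    ev-subst : ∀ {n} L₁ L₂ (v : Vec K.Carrier (suc n)) →
      ev (Poly.subst K L₁ L₂ v) x y ≈ ev v (ev L₁ x y) (ev L₂ x y)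
    ev-subst {zero} L₁ L₂ (a ∷ []) = ≈-refl
    ev-subst {suc n} L₁ L₂ (a ∷ v) = ≈-trans (ev-⊕ (scale a (powL (suc n) L₂)) (mul L₁ (Poly.subst K L₁ L₂ v)))
      (+-cong (≈-trans (ev-scale a (powL (suc n) L₂)) (*-congˡ (ev-powL (suc n) L₂)))
              (≈-trans (ev-mul L₁ (Poly.subst K L₁ L₂ v)) (*-congˡ (ev-subst L₁ L₂ v))))

-- Values at x + εx′ over the dual numbers detect double zeros.
module DualNumbers (E : Field) where
  open FieldTheory E

  dualNumbers : CommutativeRing 0ℓ 0ℓ
  dualNumbers = record
    { Carrier = Carrier × Carrier
    ; _≈_ = _≡_
    ; _+_ = λ (a , a′) (b , b′) → a ⊕ b , a′ ⊕ b′
    ; _*_ = λ (a , a′) (b , b′) → a ⊗ b , (a ⊗ b′) ⊕ (a′ ⊗ b)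
    ; -_ = λ (a , a′) → ⊝ a , ⊝ a′
    ; 0# = 0# , 0#
    ; 1# = 1# , 0#
    ; isCommutativeRing = record
      { isRing = record
        { +-isAbelianGroup = record
          { isGroup = record
            { isMonoid = record
              { isSemigroup = record
                { isMagma = record { isEquivalence = ≡.isEquivalence ; ∙-cong = cong₂ _ }
                ; assoc = λ (a , a′) (b , b′) (c , c′) → cong₂ _,_
                    (solve 3 (λ a b c → (a :+ b) :+ c := a :+ (b :+ c)) refl a b c)
                    (solve 3 (λ a b c → (a :+ b) :+ c := a :+ (b :+ c)) refl a′ b′ c′) }
              ; identity = (λ (a , a′) → cong₂ _,_ (+-identityˡ a) (+-identityˡ a′))
                         , (λ (a , a′) → cong₂ _,_ (+-identityʳ a) (+-identityʳ a′)) }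
            ; inverse = (λ (a , a′) → cong₂ _,_
                          (solve 1 (λ a → :- a :+ a := con (+ 0)) refl a) (solve 1 (λ a → :- a :+ a := con (+ 0)) refl a′))
                      , (λ (a , a′) → cong₂ _,_ (-‿inverseʳ a) (-‿inverseʳ a′))
            ; ⁻¹-cong = λ { refl → refl } }
          ; comm = λ (a , a′) (b , b′) → cong₂ _,_
              (solve 2 (λ a b → a :+ b := b :+ a) refl a b) (solve 2 (λ a b → a :+ b := b :+ a) refl a′ b′) }
        ; *-cong = cong₂ _
        ; *-assoc = λ (a , a′) (b , b′) (c , c′) → cong₂ _,_ (*-assoc a b c)
            (solve 6 (λ a a′ b b′ c c′ → (a :* b) :* c′ :+ (a :* b′ :+ a′ :* b) :* c
                                      := a :* (b :* c′ :+ b′ :* c) :+ a′ :* (b :* c)) refl a a′ b b′ c c′)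
        ; *-identity = (λ (a , a′) → cong₂ _,_ (*-identityˡ a)
                          (solve 2 (λ a a′ → con (+ 1) :* a′ :+ con (+ 0) :* a := a′) refl a a′))
                     , (λ (a , a′) → cong₂ _,_ (*-identityʳ a)
                          (solve 2 (λ a a′ → a :* con (+ 0) :+ a′ :* con (+ 1) := a′) refl a a′))
        ; distrib = (λ (a , a′) (b , b′) (c , c′) → cong₂ _,_
                      (solve 3 (λ a b c → a :* (b :+ c) := a :* b :+ a :* c) refl a b c)
                      (solve 6 (λ a a′ b b′ c c′ → a :* (b′ :+ c′) :+ a′ :* (b :+ c)
                                                := (a :* b′ :+ a′ :* b) :+ (a :* c′ :+ a′ :* c)) refl a a′ b b′ c c′))
                  , (λ (a , a′) (b , b′) (c , c′) → cong₂ _,_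
                      (solve 3 (λ a b c → (b :+ c) :* a := b :* a :+ c :* a) refl a b c)
                      (solve 6 (λ a a′ b b′ c c′ → (b :+ c) :* a′ :+ (b′ :+ c′) :* a
                                                := (b :* a′ :+ b′ :* a) :+ (c :* a′ :+ c′ :* a)) refl a a′ b b′ c c′))
        }
      ; *-comm = λ (a , a′) (b , b′) → cong₂ _,_ (*-comm a b)
          (solve 4 (λ a a′ b b′ → a :* b′ :+ a′ :* b := b :* a′ :+ b′ :* a) refl a a′ b b′)
      }
    }

embedding-isHom : ∀ {K E} (emb : Embedding K E) → IsHom K (FieldTheory.commutativeRing E) (Embedding.ι emb)
embedding-isHom emb = record { ⊕-homo = ι-⊕ ; ⊗-homo = ι-⊗ ; 0-homo = ι-0 ; 1-homo = ι-1 }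
  where open EmbeddingTheory emb

module _ {K E : Field} (emb : Embedding K E) where
  open EmbeddingTheory emb
  open FieldTheory E

  embedding-dual-isHom : IsHom K (DualNumbers.dualNumbers E) (λ a → ι a , 0#)
  embedding-dual-isHom = record
    { ⊕-homo = λ a b → cong₂ _,_ (ι-⊕ a b) (sym (+-identityˡ 0#))
    ; ⊗-homo = λ a b → cong₂ _,_ (ι-⊗ a b) (solve 2 (λ a b → con (+ 0) := a :* con (+ 0) :+ con (+ 0) :* b) refl (ι a) (ι b))
    ; 0-homo = cong (_, 0#) ι-0
    ; 1-homo = cong (_, 0#) ι-1
    }

-- Makes forms that already have coefficients in E a case of the same evaluation.
idEmbedding : ∀ E → Embedding E E
idEmbedding E = record { ι = λ a → a ; ι-⊕ = λ _ _ → refl ; ι-⊗ = λ _ _ → refl ; ι-1 = refl }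

module DualEvaluation {K E : Field} (emb : Embedding K E) where
  open EmbeddingTheory emb
  open FieldTheory E
  open Evaluation (embedding-isHom emb) public using (ev)
  open Evaluation (embedding-dual-isHom emb) public using () renaming (ev to evᴰ; ev-mul to evᴰ-mul)
  open Evaluation (embedding-isHom (idEmbedding E)) using () renaming (ev to evᴱ)
  open Evaluation (embedding-dual-isHom (idEmbedding E)) using () renaming (ev to evᴱᴰ)
  private
    module D = CommutativeRing (DualNumbers.dualNumbers E)
    open Exp D.semiring using () renaming (_^_ to _^ᴰ_)
    open Exp (CommutativeRing.semiring commutativeRing) using (_^_)

  evᴰ-map : ∀ {n} (v : Vec (Field.Carrier K) (suc n)) x y → evᴱᴰ (Vec.map ι v) x y ≡ evᴰ v x y
  evᴰ-map {zero} (a ∷ []) x y = refl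
  evᴰ-map {suc n} (a ∷ v) x y = cong (λ z → (ι a , 0#) D.* y ^ᴰ suc n D.+ x D.* z) (evᴰ-map v x y)

  ev-map : ∀ {n} (v : Vec (Field.Carrier K) (suc n)) x y → evᴱ (Vec.map ι v) x y ≡ ev v x y
  ev-map {zero} (a ∷ []) x y = refl
  ev-map {suc n} (a ∷ v) x y = cong (λ z → (ι a ⊗ (y ^ suc n)) ⊕ (x ⊗ z)) (ev-map v x y)

  proj₁-^ : ∀ (y : D.Carrier) n → proj₁ (y ^ᴰ n) ≡ proj₁ y ^ n
  proj₁-^ y zero = refl
  proj₁-^ y (suc n) = cong (proj₁ y ⊗_) (proj₁-^ y n)

  proj₁-evᴰ : ∀ {n} (v : Vec (Field.Carrier K) (suc n)) x y → proj₁ (evᴰ v x y) ≡ ev v (proj₁ x) (proj₁ y)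
  proj₁-evᴰ {zero} (a ∷ []) x y = refl
  proj₁-evᴰ {suc n} (a ∷ v) x y = cong₂ (λ p z → (ι a ⊗ p) ⊕ (proj₁ x ⊗ z)) (proj₁-^ y (suc n)) (proj₁-evᴰ v x y)

  -- Both values are multiples of ε, and ε² = 0.
  product-double-root : ∀ {m n} (u : Vec (Field.Carrier K) (suc m)) (v : Vec (Field.Carrier K) (suc n)) {x y} →
    ev u (proj₁ x) (proj₁ y) ≡ 0# → ev v (proj₁ x) (proj₁ y) ≡ 0# → evᴰ (Poly.mul K u v) x y ≡ D.0#
  product-double-root u v {x} {y} u≡0 v≡0 = trans (evᴰ-mul x y u v) (vanish (trans (proj₁-evᴰ u x y) u≡0) (trans (proj₁-evᴰ v x y) v≡0))
    where
    vanish : ∀ {s t : D.Carrier} → proj₁ s ≡ 0# → proj₁ t ≡ 0# → s D.* t ≡ D.0#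
    vanish {_ , s} {_ , t} refl refl = cong₂ _,_ (zeroˡ 0#)
      (solve 2 (λ s t → con (+ 0) :* t :+ s :* con (+ 0) := con (+ 0)) refl s t)

module LinearProducts (E : Field) where
  open FieldTheory E
  open Poly E using (Monic)
  open DualEvaluation (idEmbedding E) public
  open Evaluation (embedding-isHom (idEmbedding E)) using (ev-mul)
  private module D = CommutativeRing (DualNumbers.dualNumbers E)
  open ≡-Reasoning

  -- The forms x + ay and y: one for each point of the projective line.
  data MonicLinear : Vec Carrier 2 → Set where
    x-form : ∀ a → MonicLinear (a ∷ 1# ∷ [])
    y-form : MonicLinear (1# ∷ 0# ∷ [])

  monicLinear : ∀ {l} → Monic l → MonicLinear l
  monicLinear {_ ∷ _ ∷ []} (zero , refl , higher) with refl ← higher (suc zero) (ℕ.s≤s ℕ.z≤n) = y-form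
  monicLinear {a ∷ _ ∷ []} (suc zero , refl , _) = x-form a

  -- A linear form is its own derivative, so its ε-part is its value at the direction (x′, y′).
  evᴰ-linear : ∀ (l : Vec Carrier 2) x x′ y y′ → evᴰ l (x , x′) (y , y′) ≡ (ev l x y , ev l x′ y′)
  evᴰ-linear (a ∷ b ∷ []) x x′ y y′ = cong₂ _,_ refl
    (solve 6 (λ a b x x′ y y′ →
      (a :* (y :* con (+ 0) :+ y′ :* con (+ 1)) :+ con (+ 0) :* (y :* con (+ 1))) :+ (x :* con (+ 0) :+ x′ :* b)
      := a :* (y′ :* con (+ 1)) :+ x′ :* b) refl a b x x′ y y′)

  -- Supplies a direction in which the derivative of l is 1.
  nonvanishing : ∀ {l} → Monic l → ∃ λ x → ∃ λ y → ev l x y ≡ 1#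
  nonvanishing {l} m with monicLinear {l} m
  ... | x-form a = 1# , 0# , solve 1 (λ a → a :* (con (+ 0) :* con (+ 1)) :+ con (+ 1) :* con (+ 1) := con (+ 1)) refl a
  ... | y-form = 0# , 1# , solve 0 (con (+ 1) :* (con (+ 1) :* con (+ 1)) :+ con (+ 0) :* con (+ 0) := con (+ 1)) refl

  zero-point : ∀ {l} → Monic l → ∃ λ x → ∃ λ y → ¬ (x ≡ 0# × y ≡ 0#) × ev l x y ≡ 0#
  zero-point {l} m with monicLinear {l} m
  ... | x-form a = ⊝ a , 1# , (λ (_ , 1≡0) → 1≢0 1≡0) ,
    solve 1 (λ a → a :* (con (+ 1) :* con (+ 1)) :+ (:- a) :* con (+ 1) := con (+ 0)) refl a
  ... | y-form = 1# , 0# , (λ (1≡0 , _) → 1≢0 1≡0) ,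
    solve 0 (con (+ 1) :* (con (+ 0) :* con (+ 1)) :+ con (+ 1) :* con (+ 0) := con (+ 0)) refl

  module _ {x y : Carrier} (xy≢0 : ¬ (x ≡ 0# × y ≡ 0#)) where

    private
      y-root : ev (1# ∷ 0# ∷ []) x y ≡ 0# → y ≡ 0#
      y-root eq = trans (solve 2 (λ x y → y := con (+ 1) :* (y :* con (+ 1)) :+ x :* con (+ 0)) refl x y) eq

      x-root : ∀ {a} → ev (a ∷ 1# ∷ []) x y ≡ 0# → x ≡ ⊝ (a ⊗ y)
      x-root {a} eq = x⊕y≡0⇒x≡-y (trans (solve 3 (λ a x y → x :+ a :* y := a :* (y :* con (+ 1)) :+ x :* con (+ 1)) refl a x y) eq)

      y≢0 : ∀ {a} → ev (a ∷ 1# ∷ []) x y ≡ 0# → y ≢ 0#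
      y≢0 {a} eq y≡0 = xy≢0 (trans (x-root eq) (trans (cong (λ z → ⊝ (a ⊗ z)) y≡0)
        (solve 1 (λ a → :- (a :* con (+ 0)) := con (+ 0)) refl a)) , y≡0)

    common-zero⇒≡ : ∀ {l l′} → Monic l → Monic l′ → ev l x y ≡ 0# → ev l′ x y ≡ 0# → l ≡ l′
    common-zero⇒≡ {l} {l′} m m′ e e′ with monicLinear {l} m | monicLinear {l′} m′
    ... | y-form | y-form = refl
    ... | y-form | x-form b = contradiction (y-root e) (y≢0 e′)
    ... | x-form a | y-form = contradiction (y-root e′) (y≢0 e)
    ... | x-form a | x-form b = cong (_∷ 1# ∷ []) (⊗-cancelˡ (y≢0 e) (begin
        y ⊗ a               ≡⟨ solve 2 (λ a y → y :* a := :- (:- (a :* y))) refl a y ⟩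
        ⊝ (⊝ (a ⊗ y))       ≡⟨ cong ⊝_ (trans (sym (x-root e)) (x-root e′)) ⟩
        ⊝ (⊝ (b ⊗ y))       ≡⟨ solve 2 (λ a y → y :* a := :- (:- (a :* y))) refl b y ⟨
        y ⊗ b               ∎))

    prodLin-nonzero : ∀ {n} (ls : Vec (Vec Carrier 2) n) → (∀ i → ev (lookup ls i) x y ≢ 0#) → ev (prodLin E ls) x y ≢ 0#
    prodLin-nonzero [] _ = 1≢0
    prodLin-nonzero (l ∷ ls) l≢0 eq = x⊗y≢0 (l≢0 zero) (prodLin-nonzero ls (l≢0 ∘ suc)) (trans (sym (ev-mul x y l (prodLin E ls))) eq)

    -- By the product rule the ε-part of l · P is l · P′ + l′ · P. If l vanishes at the point, a
    -- direction with l′ = 1 forces P = 0, although no other factor vanishes there. If l does not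
    -- vanish, P inherits the double zero and induction applies. The goal is ⊥, so excluded middle
    -- under a double negation decides the case.
    distinct⇒no-double-root : ∀ {n} (ls : Vec (Vec Carrier 2) n) → (∀ i → Monic (lookup ls i)) →
      (∀ i j → i ≢ j → lookup ls i ≢ lookup ls j) → ¬ (∀ x′ y′ → evᴰ (prodLin E ls) (x , x′) (y , y′) ≡ D.0#)
    distinct⇒no-double-root [] _ _ vanish = 1≢0 (cong proj₁ (vanish 0# 0#))
    distinct⇒no-double-root (l ∷ ls) monic distinct vanish = ¬¬-excluded-middle λ where
        (yes l≡0) → let x′ , y′ , l′≡1 = nonvanishing {l} (monic zero) in
          prodLin-nonzero ls (λ i e → distinct zero (suc i) (λ ()) (common-zero⇒≡ {l} {lookup ls i} (monic zero) (monic (suc i)) l≡0 e)) (begin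
            P x y                                          ≡⟨ *-identityˡ _ ⟨
            1# ⊗ P x y                                     ≡⟨ cong (_⊗ P x y) l′≡1 ⟨
            ev l x′ y′ ⊗ P x y                             ≡⟨ solve 2 (λ s t → s := con (+ 0) :* t :+ s) refl _ (proj₂ (Pᴰ x′ y′)) ⟩
            (0# ⊗ proj₂ (Pᴰ x′ y′)) ⊕ (ev l x′ y′ ⊗ P x y) ≡⟨ cong (λ z → (z ⊗ proj₂ (Pᴰ x′ y′)) ⊕ (ev l x′ y′ ⊗ P x y)) l≡0 ⟨
            (ev l x y ⊗ proj₂ (Pᴰ x′ y′)) ⊕ (ev l x′ y′ ⊗ P x y) ≡⟨ proj₂ (split x′ y′) ⟩
            0#                                             ∎)
        (no l≢0) → distinct⇒no-double-root ls (monic ∘ suc) (λ i j i≢j → distinct (suc i) (suc j) (i≢j ∘ Fin.suc-injective)) λ x′ y′ →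
          cong₂ _,_ (trans (proj₁-evᴰ (prodLin E ls) _ _) (P≡0 l≢0))
            (x⊗y≡0⇒y≡0 l≢0 (begin
              ev l x y ⊗ proj₂ (Pᴰ x′ y′)                            ≡⟨ solve 2 (λ s t → s := s :+ t :* con (+ 0)) refl _ (ev l x′ y′) ⟩
              (ev l x y ⊗ proj₂ (Pᴰ x′ y′)) ⊕ (ev l x′ y′ ⊗ 0#)
                ≡⟨ cong (λ z → (ev l x y ⊗ proj₂ (Pᴰ x′ y′)) ⊕ (ev l x′ y′ ⊗ z)) (P≡0 l≢0) ⟨
              (ev l x y ⊗ proj₂ (Pᴰ x′ y′)) ⊕ (ev l x′ y′ ⊗ P x y)   ≡⟨ proj₂ (split x′ y′) ⟩
              0#                                                     ∎))
      where
      P : Carrier → Carrier → Carrier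
      P = ev (prodLin E ls)
      Pᴰ : Carrier → Carrier → D.Carrier
      Pᴰ x′ y′ = evᴰ (prodLin E ls) (x , x′) (y , y′)
      split : ∀ x′ y′ → ev l x y ⊗ P x y ≡ 0# × (ev l x y ⊗ proj₂ (Pᴰ x′ y′)) ⊕ (ev l x′ y′ ⊗ P x y) ≡ 0#
      split x′ y′ = trans (cong (ev l x y ⊗_) (sym (proj₁-evᴰ (prodLin E ls) (x , x′) (y , y′)))) (cong proj₁ product)
                  , trans (cong (λ z → (ev l x y ⊗ proj₂ (Pᴰ x′ y′)) ⊕ (ev l x′ y′ ⊗ z)) (sym (proj₁-evᴰ (prodLin E ls) (x , x′) (y , y′)))) (cong proj₂ product)
        where
        product : (ev l x y , ev l x′ y′) D.* Pᴰ x′ y′ ≡ D.0#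
        product = trans (cong (D._* Pᴰ x′ y′) (sym (evᴰ-linear l x x′ y y′)))
          (trans (sym (evᴰ-mul (x , x′) (y , y′) l (prodLin E ls))) (vanish x′ y′))
      P≡0 : ev l x y ≢ 0# → P x y ≡ 0#
      P≡0 l≢0 = x⊗y≡0⇒y≡0 l≢0 (proj₁ (split 0# 0#))

-- The operations of Defs.Poly on bare operations, so that they also apply to the syntax of
-- the ring solver; on a field they agree definitionally with the originals.
module RawForms {A : Set} (_+_ _*_ : A → A → A) (0# 1# : A) where
  scale : ∀ {n} → A → Vec A n → Vec A n
  scale c = Vec.map (c *_)

  pad : ∀ k {n} → Vec A (suc n) → Vec A (suc (k ℕ.+ n))
  pad zero v = v
  pad (suc k) v = pad k v ∷ʳ 0#

  mul : ∀ {m n} → Vec A (suc m) → Vec A (suc n) → Vec A (suc (m ℕ.+ n))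
  mul {zero} (a ∷ []) g = scale a g
  mul {suc m} (a ∷ f) g = zipWith _+_ (pad (suc m) (scale a g)) (0# ∷ mul f g)

  powL : ∀ n → Vec A 2 → Vec A (suc n)
  powL zero L = 1# ∷ []
  powL (suc n) L = mul L (powL n L)

  substitute : ∀ {n} → Vec A 2 → Vec A 2 → Vec A (suc n) → Vec A (suc n)
  substitute {zero} L₁ L₂ (a ∷ []) = a ∷ []
  substitute {suc n} L₁ L₂ (a ∷ f) = zipWith _+_ (scale a (powL (suc n) L₂)) (mul L₁ (substitute L₁ L₂ f))

  xy : Vec A 3
  xy = 0# ∷ 1# ∷ 0# ∷ []

-- Identities for forms of low degree, and irreducible quadratics

module FormIdentities (K : Field) where
  open FieldTheory K
  open Poly K
  open ≡-Reasoning

  private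
    Term : ℕ → Set
    Term = IntegerCoefficients.Solver.Polynomial commutativeRing

    module S {n} = RawForms {Term n} _:+_ _:*_ (con (+ 0)) (con (+ 1))

  vec-ext : ∀ {n} {u v : Vec Carrier n} → (∀ i → lookup u i ≡ lookup v i) → u ≡ v
  vec-ext {u = u} {v} eq = trans (sym (Vec.tabulate∘lookup u)) (trans (Vec.tabulate-cong eq) (Vec.tabulate∘lookup v))

  xy-mul : ∀ a b c → mul xy (a ∷ b ∷ c ∷ []) ≡ 0# ∷ a ∷ b ∷ c ∷ 0# ∷ []
  xy-mul a b c = vec-ext λ where
      0F → solve 3 (lhs 0F (con (+ 0))) refl a b c
      1F → solve 3 (λ a b c → lhs 1F a a b c) refl a b c
      2F → solve 3 (λ a b c → lhs 2F b a b c) refl a b c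
      3F → solve 3 (λ a b c → lhs 3F c a b c) refl a b c
      4F → solve 3 (lhs 4F (con (+ 0))) refl a b c
    where lhs = λ (i : Fin 5) (r a b c : Term 3) → lookup (S.mul S.xy (a ∷ b ∷ c ∷ [])) i := r

  mul-linear : ∀ a b c d → mul (a ∷ b ∷ []) (c ∷ d ∷ []) ≡ a ⊗ c ∷ (a ⊗ d) ⊕ (b ⊗ c) ∷ b ⊗ d ∷ []
  mul-linear a b c d = vec-ext λ where
      0F → solve 4 (λ a b c d → lhs 0F (a :* c) a b c d) refl a b c d
      1F → solve 4 (λ a b c d → lhs 1F (a :* d :+ b :* c) a b c d) refl a b c d
      2F → solve 4 (λ a b c d → lhs 2F (b :* d) a b c d) refl a b c d
    where lhs = λ (i : Fin 3) (r a b c d : Term 4) → lookup (S.mul (a ∷ b ∷ []) (c ∷ d ∷ [])) i := r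

  mul-linear-scale : ∀ k (u v : Vec Carrier 2) → mul u (scale k v) ≡ scale k (mul u v)
  mul-linear-scale k (a ∷ b ∷ []) (c ∷ d ∷ []) = vec-ext λ where
      0F → solve 5 (eqn 0F) refl k a b c d
      1F → solve 5 (eqn 1F) refl k a b c d
      2F → solve 5 (eqn 2F) refl k a b c d
    where
    eqn = λ (i : Fin 3) (k a b c d : Term 5) →
      lookup (S.mul (a ∷ b ∷ []) (S.scale k (c ∷ d ∷ []))) i := lookup (S.scale k (S.mul (a ∷ b ∷ []) (c ∷ d ∷ []))) i

  mul-scale-scale : ∀ k l (u v : Vec Carrier 3) → mul (scale k u) (scale l v) ≡ scale (k ⊗ l) (mul u v)
  mul-scale-scale k l (a ∷ b ∷ c ∷ []) (d ∷ e ∷ f ∷ []) = vec-ext λ where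
      0F → solve 8 (eqn 0F) refl k l a b c d e f
      1F → solve 8 (eqn 1F) refl k l a b c d e f
      2F → solve 8 (eqn 2F) refl k l a b c d e f
      3F → solve 8 (eqn 3F) refl k l a b c d e f
      4F → solve 8 (eqn 4F) refl k l a b c d e f
    where
    eqn = λ (i : Fin 5) (k l a b c d e f : Term 8) →
      lookup (S.mul (S.scale k (a ∷ b ∷ c ∷ [])) (S.scale l (d ∷ e ∷ f ∷ []))) i
        := lookup (S.scale (k :* l) (S.mul (a ∷ b ∷ c ∷ []) (d ∷ e ∷ f ∷ []))) i

  mul-comm₂₂ : ∀ (u v : Vec Carrier 3) → mul u v ≡ mul v u
  mul-comm₂₂ (a ∷ b ∷ c ∷ []) (d ∷ e ∷ f ∷ []) = vec-ext λ where
      0F → solve 6 (eqn 0F) refl a b c d e f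
      1F → solve 6 (eqn 1F) refl a b c d e f
      2F → solve 6 (eqn 2F) refl a b c d e f
      3F → solve 6 (eqn 3F) refl a b c d e f
      4F → solve 6 (eqn 4F) refl a b c d e f
    where
    eqn = λ (i : Fin 5) (a b c d e f : Term 6) →
      lookup (S.mul (a ∷ b ∷ c ∷ []) (d ∷ e ∷ f ∷ [])) i := lookup (S.mul (d ∷ e ∷ f ∷ []) (a ∷ b ∷ c ∷ [])) i

  -- Substitution is multiplicative and turns x, y into L₁, L₂. The transform of a quartic xyg thus
  -- splits into the transform of g and the two new rational factors.
  subst-xyTimes : ∀ L₁ L₂ (g : Vec Carrier 3) →
    Poly.subst K L₁ L₂ (mul xy g) ≡ mul (Poly.subst K L₁ L₂ g) (mul L₁ L₂)
  subst-xyTimes (p ∷ q ∷ []) (r ∷ s ∷ []) (a ∷ b ∷ c ∷ []) = vec-ext λ where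
      0F → solve 7 (eqn 0F) refl p q r s a b c
      1F → solve 7 (eqn 1F) refl p q r s a b c
      2F → solve 7 (eqn 2F) refl p q r s a b c
      3F → solve 7 (eqn 3F) refl p q r s a b c
      4F → solve 7 (eqn 4F) refl p q r s a b c
    where
    eqn = λ (i : Fin 5) (p q r s a b c : Term 7) →
      lookup (S.substitute (p ∷ q ∷ []) (r ∷ s ∷ []) (S.mul S.xy (a ∷ b ∷ c ∷ []))) i
        := lookup (S.mul (S.substitute (p ∷ q ∷ []) (r ∷ s ∷ []) (a ∷ b ∷ c ∷ [])) (S.mul (p ∷ q ∷ []) (r ∷ s ∷ []))) i

  -- The linear factors are x, y, x - αy and x - βy; with β the conjugate of α the result is the
  -- image of `mul xy minimalForm` over L.
  splitQuartic : ∀ α β → scale 1# (prodLin K ((0# ∷ 1# ∷ []) ∷ (1# ∷ 0# ∷ []) ∷ (⊝ α ∷ 1# ∷ []) ∷ (⊝ β ∷ 1# ∷ []) ∷ []))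
    ≡ 0# ∷ α ⊗ β ∷ ⊝ (α ⊕ β) ∷ 1# ∷ 0# ∷ []
  splitQuartic α β = vec-ext λ where
      0F → solve 2 (λ α β → eqn 0F (con (+ 0)) α β) refl α β
      1F → solve 2 (λ α β → eqn 1F (α :* β) α β) refl α β
      2F → solve 2 (λ α β → eqn 2F (:- (α :+ β)) α β) refl α β
      3F → solve 2 (λ α β → eqn 3F (con (+ 1)) α β) refl α β
      4F → solve 2 (λ α β → eqn 4F (con (+ 0)) α β) refl α β
    where
    𝟘 𝟙 : Term 2
    𝟘 = con (+ 0)
    𝟙 = con (+ 1)
    eqn = λ (i : Fin 5) (r α β : Term 2) →
      lookup (S.scale 𝟙 (S.mul (𝟘 ∷ 𝟙 ∷ []) (S.mul (𝟙 ∷ 𝟘 ∷ []) (S.mul (:- α ∷ 𝟙 ∷ []) (S.mul (:- β ∷ 𝟙 ∷ []) (𝟙 ∷ [])))))) i := r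

  scale-scale : ∀ {n} k l (v : Vec Carrier n) → scale k (scale l v) ≡ scale (k ⊗ l) v
  scale-scale k l v = trans (sym (Vec.map-∘ (k ⊗_) (l ⊗_) v)) (Vec.map-cong (λ x → sym (*-assoc k l x)) v)

  scale-1 : ∀ {n} (v : Vec Carrier n) → scale 1# v ≡ v
  scale-1 v = trans (Vec.map-cong *-identityˡ v) (Vec.map-id v)

  form-injective : ∀ {n} {u v : Vec Carrier (suc n)} → form n u ≡ form n v → u ≡ v
  form-injective refl = refl

  -- No root in K of z² + bz + a. The equation is arranged as in `monicQuadratic-root`, with -b as
  -- trace and a as norm.
  Rootless : Carrier → Carrier → Set
  Rootless a b = ∀ r → (r ⊗ r) ⊕ a ≢ (⊝ b) ⊗ r

  rootless⇒irreducible : ∀ {a b} → Rootless a b → Irreducible (2 , a ∷ b ∷ 1# ∷ [])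
  rootless⇒irreducible {a} {b} rootless = ℕ.s≤s ℕ.z≤n , no-factors
    where
    linear : ∀ u₀ u₁ v₀ v₁ → mul (u₀ ∷ u₁ ∷ []) (v₀ ∷ v₁ ∷ []) ≢ a ∷ b ∷ 1# ∷ []
    -- Since u₁v₁ = 1, this is the zero -u₀/u₁ of the first factor.
    linear u₀ u₁ v₀ v₁ eq = rootless (⊝ (u₀ ⊗ v₁)) (begin
        ((⊝ (u₀ ⊗ v₁)) ⊗ (⊝ (u₀ ⊗ v₁))) ⊕ a
          ≡⟨ cong (((⊝ (u₀ ⊗ v₁)) ⊗ (⊝ (u₀ ⊗ v₁))) ⊕_) (trans (sym (*-identityˡ a)) (cong₂ _⊗_ (sym u₁v₁≡1) a≡)) ⟩
        ((⊝ (u₀ ⊗ v₁)) ⊗ (⊝ (u₀ ⊗ v₁))) ⊕ ((u₁ ⊗ v₁) ⊗ (u₀ ⊗ v₀))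
          ≡⟨ solve 4 (λ u₀ u₁ v₀ v₁ → (:- (u₀ :* v₁)) :* (:- (u₀ :* v₁)) :+ (u₁ :* v₁) :* (u₀ :* v₀)
               := (:- (u₀ :* v₁ :+ u₁ :* v₀)) :* (:- (u₀ :* v₁))) refl u₀ u₁ v₀ v₁ ⟩
        (⊝ ((u₀ ⊗ v₁) ⊕ (u₁ ⊗ v₀))) ⊗ (⊝ (u₀ ⊗ v₁))
          ≡⟨ cong (λ z → (⊝ z) ⊗ (⊝ (u₀ ⊗ v₁))) b≡ ⟨
        (⊝ b) ⊗ (⊝ (u₀ ⊗ v₁)) ∎)
      where
      coefficients : u₀ ⊗ v₀ ∷ (u₀ ⊗ v₁) ⊕ (u₁ ⊗ v₀) ∷ u₁ ⊗ v₁ ∷ [] ≡ a ∷ b ∷ 1# ∷ []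
      coefficients = trans (sym (mul-linear u₀ u₁ v₀ v₁)) eq
      a≡ : a ≡ u₀ ⊗ v₀
      a≡ = sym (cong (λ v → lookup v 0F) coefficients)
      b≡ : b ≡ (u₀ ⊗ v₁) ⊕ (u₁ ⊗ v₀)
      b≡ = sym (cong (λ v → lookup v 1F) coefficients)
      u₁v₁≡1 : u₁ ⊗ v₁ ≡ 1#
      u₁v₁≡1 = cong (λ v → lookup v 2F) coefficients
    no-factors : ∀ m k (g : Vec Carrier (suc m)) (h : Vec Carrier (suc k)) →
      1 ℕ.≤ m → 1 ℕ.≤ k → form (m ℕ.+ k) (mul g h) ≢ form 2 (a ∷ b ∷ 1# ∷ [])
    no-factors 1 1 (u₀ ∷ u₁ ∷ []) (v₀ ∷ v₁ ∷ []) _ _ eq = linear u₀ u₁ v₀ v₁ (form-injective eq)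
    no-factors 1 (suc (suc k)) g h _ _ eq = contradiction (cong proj₁ eq) λ ()
    no-factors (suc (suc m)) (suc k) g h _ _ eq =
      contradiction (trans (sym (ℕ.+-suc m k)) (ℕ.suc-injective (ℕ.suc-injective (cong proj₁ eq)))) λ ()

  -- If c were 0 then y would be a factor; in particular the leading 1 cannot sit at a lower power
  -- of x.
  irreducible⇒leading≡1 : ∀ {a b c} → Monic (a ∷ b ∷ c ∷ []) → Irreducible (2 , a ∷ b ∷ c ∷ []) → c ≡ 1#
  irreducible⇒leading≡1 {a} {b} {c} monic (_ , irr) = leading monic
    where
    y-factor : c ≢ 0#
    y-factor refl = irr 1 1 (1# ∷ 0# ∷ []) (a ∷ b ∷ []) (ℕ.s≤s ℕ.z≤n) (ℕ.s≤s ℕ.z≤n) (cong (form 2)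
      (trans (mul-linear 1# 0# a b) (cong₂ _∷_ (*-identityˡ a) (cong₂ _∷_
        (solve 2 (λ a b → con (+ 1) :* b :+ con (+ 0) :* a := b) refl a b) (cong (_∷ []) (zeroˡ b))))))
    leading : Monic (a ∷ b ∷ c ∷ []) → c ≡ 1#
    leading (0F , _ , higher) = contradiction (higher 2F (ℕ.s≤s ℕ.z≤n)) y-factor
    leading (1F , _ , higher) = contradiction (higher 2F (ℕ.s≤s (ℕ.s≤s ℕ.z≤n))) y-factor
    leading (2F , c≡1 , _) = c≡1

  irreducible⇒rootless : ∀ {g} → Monic g → Irreducible (2 , g) → ∃ λ a → ∃ λ b → g ≡ a ∷ b ∷ 1# ∷ [] × Rootless a b
  irreducible⇒rootless {a ∷ b ∷ c ∷ []} monic irreducible@(_ , irr) with refl ← irreducible⇒leading≡1 monic irreducible = a , b , refl , λ r root →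
      -- A root r of x² + bx + a splits it as (x - r)(x + b + r), because -r(b + r) = a.
      irr 1 1 (⊝ r ∷ 1# ∷ []) (b ⊕ r ∷ 1# ∷ []) (ℕ.s≤s ℕ.z≤n) (ℕ.s≤s ℕ.z≤n) (cong (form 2) (begin
        mul (⊝ r ∷ 1# ∷ []) (b ⊕ r ∷ 1# ∷ [])
          ≡⟨ mul-linear (⊝ r) 1# (b ⊕ r) 1# ⟩
        (⊝ r) ⊗ (b ⊕ r) ∷ ((⊝ r) ⊗ 1#) ⊕ (1# ⊗ (b ⊕ r)) ∷ 1# ⊗ 1# ∷ []
          ≡⟨ cong₂ _∷_ (trans (solve 2 (λ b r → (:- r) :* (b :+ r) := (:- b) :* r :- r :* r) refl b r)
               (trans (cong (_⊕ (⊝ (r ⊗ r))) (sym root)) (solve 2 (λ a s → (s :+ a) :- s := a) refl a (r ⊗ r))))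
             (cong₂ _∷_ (solve 2 (λ b r → (:- r) :* con (+ 1) :+ con (+ 1) :* (b :+ r) := b) refl b r)
               (cong (_∷ []) (*-identityˡ 1#))) ⟩
        a ∷ b ∷ 1# ∷ [] ∎))

  monic₃ : ∀ a b → Monic (a ∷ b ∷ 1# ∷ [])
  monic₃ a b = 2F , refl , λ { 0F () ; 1F (ℕ.s≤s ()) ; 2F (ℕ.s≤s (ℕ.s≤s ())) }

module _ {K E : Field} (emb : Embedding K E) where
  private module K = FieldTheory K
  open EmbeddingTheory emb
  open FieldTheory E
  open Poly E using (scale)
  open Poly K using (Monic)
  open DualEvaluation emb
  open LinearProducts E using (distinct⇒no-double-root; zero-point) renaming (ev to evᴱ)
  open Evaluation (embedding-isHom (idEmbedding E)) using () renaming (ev-mul to evᴱ-mul; ev-scale to evᴱ-scale)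
  open Evaluation (embedding-dual-isHom (idEmbedding E)) using () renaming (ev to evᴱᴰ; ev-scale to evᴱᴰ-scale)
  private module D = CommutativeRing (DualNumbers.dualNumbers E)

  module _ {n} (v : Vec K.Carrier (suc n)) (monic : Monic v) (c : Carrier) (ls : Vec (Vec Carrier 2) n)
           (ls-monic : ∀ i → Poly.Monic E (lookup ls i)) (v≡ : Vec.map ι v ≡ scale c (prodLin E ls)) where

    leading-constant≢0 : c ≢ 0#
    leading-constant≢0 c≡0 = let i , vᵢ≡1 , _ = monic in 1≢0 (begin
      1#                                          ≡⟨ ι-1 ⟨
      ι K.1#                                      ≡⟨ cong ι vᵢ≡1 ⟨
      ι (lookup v i)                              ≡⟨ Vec.lookup-map i ι v ⟨
      lookup (Vec.map ι v) i                      ≡⟨ cong (λ w → lookup w i) v≡ ⟩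
      lookup (scale c (prodLin E ls)) i           ≡⟨ Vec.lookup-map i (c ⊗_) (prodLin E ls) ⟩
      c ⊗ lookup (prodLin E ls) i                 ≡⟨ cong (_⊗ lookup (prodLin E ls) i) c≡0 ⟩
      0# ⊗ lookup (prodLin E ls) i                ≡⟨ zeroˡ _ ⟩
      0#                                          ∎)
      where open ≡-Reasoning

    separable⇒no-double-root : (∀ i j → i ≢ j → lookup ls i ≢ lookup ls j) →
      ∀ {x y} → ¬ (x ≡ 0# × y ≡ 0#) → ¬ (∀ x′ y′ → evᴰ v (x , x′) (y , y′) ≡ D.0#)
    separable⇒no-double-root distinct {x} {y} xy≢0 vanish = distinct⇒no-double-root xy≢0 ls ls-monic distinct λ x′ y′ →
      cancel (begin
        (c , 0#) D.* evᴱᴰ (prodLin E ls) (x , x′) (y , y′)  ≡⟨ evᴱᴰ-scale (x , x′) (y , y′) c (prodLin E ls) ⟨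
        evᴱᴰ (scale c (prodLin E ls)) (x , x′) (y , y′)     ≡⟨ cong (λ w → evᴱᴰ w (x , x′) (y , y′)) v≡ ⟨
        evᴱᴰ (Vec.map ι v) (x , x′) (y , y′)                ≡⟨ evᴰ-map v (x , x′) (y , y′) ⟩
        evᴰ v (x , x′) (y , y′)                             ≡⟨ vanish x′ y′ ⟩
        D.0#                                                ∎)
      where
      open ≡-Reasoning
      cancel : ∀ {s : D.Carrier} → (c , 0#) D.* s ≡ D.0# → s ≡ D.0#
      cancel {s , s′} eq = cong₂ _,_ (x⊗y≡0⇒y≡0 leading-constant≢0 (cong proj₁ eq))
        (x⊗y≡0⇒y≡0 leading-constant≢0 (trans (solve 3 (λ c s s′ → c :* s′ := c :* s′ :+ con (+ 0) :* s) refl c s s′) (cong proj₂ eq)))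

  -- An irrational root in L is of no help inside E, so the zero has to come from the splitting over
  -- E.
  splits⇒root : ∀ {n} (v : Vec K.Carrier (suc (suc n))) c (l : Vec Carrier 2) (ls : Vec (Vec Carrier 2) n) →
    Poly.Monic E l → Vec.map ι v ≡ scale c (prodLin E (l ∷ ls)) → ∃ λ x → ∃ λ y → ¬ (x ≡ 0# × y ≡ 0#) × ev v x y ≡ 0#
  splits⇒root v c l ls l-monic v≡ with x , y , xy≢0 , l≡0 ← zero-point {l} l-monic = x , y , xy≢0 , (begin
    ev v x y                                   ≡⟨ ev-map v x y ⟨
    evᴱ (Vec.map ι v) x y                      ≡⟨ cong (λ w → evᴱ w x y) v≡ ⟩
    evᴱ (scale c (prodLin E (l ∷ ls))) x y     ≡⟨ evᴱ-scale x y c (prodLin E (l ∷ ls)) ⟩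
    c ⊗ evᴱ (prodLin E (l ∷ ls)) x y           ≡⟨ cong (c ⊗_) (evᴱ-mul x y l (prodLin E ls)) ⟩
    c ⊗ (evᴱ l x y ⊗ evᴱ (prodLin E ls) x y)   ≡⟨ cong (λ z → c ⊗ (z ⊗ evᴱ (prodLin E ls) x y)) l≡0 ⟩
    c ⊗ (0# ⊗ evᴱ (prodLin E ls) x y)          ≡⟨ solve 2 (λ c p → c :* (con (+ 0) :* p) := con (+ 0)) refl c _ ⟩
    0#                                         ∎)
    where open ≡-Reasoning

module _ {K : Field} where
  open FieldTheory K
  open Poly K
  open Over K using (Separable)
  open FormIdentities K

  -- If h = kg, a zero of the quartic in E is a zero of kg², and k ≠ 0 because the quartic is monic.
  -- It is therefore a common zero of g and h, that is, a double zero of the product.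
  separable⇒not-square : ∀ g {h : Vec Carrier 3} → Monic (mul g h) → Separable (4 , mul g h) → ∀ k → h ≢ scale k g
  separable⇒not-square g {h} monic (E , emb , c , l ∷ ls , ls-monic , distinct , v≡) k refl
    with x , y , xy≢0 , v≡0 ← splits⇒root emb (mul g h) c l ls (ls-monic 0F) v≡ =
    ¬¬-excluded-middle λ where
      (yes g≡0) → separable⇒no-double-root emb (mul g h) monic c (l ∷ ls) ls-monic v≡ distinct xy≢0 λ x′ y′ →
        product-double-root g (scale k g) g≡0 (trans (ev-scale x y k g) (trans (cong (ι k E.⊗_) g≡0) (E.zeroʳ _)))
      (no g≢0) → contradiction (trans (sym (trans (ev-mul x y g (scale k g)) (cong (ev g x y E.⊗_) (ev-scale x y k g)))) v≡0)
        (E.x⊗y≢0 g≢0 (E.x⊗y≢0 (ι≢0 k≢0) g≢0))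
    where
    module E = FieldTheory E
    open EmbeddingTheory emb
    open DualEvaluation emb using (product-double-root)
    open Evaluation (embedding-isHom emb)
    k≢0 : k ≢ 0#
    k≢0 k≡0 = let i , vᵢ≡1 , _ = monic in 1≢0 (begin
      1#                                               ≡⟨ vᵢ≡1 ⟨
      lookup (mul g (scale k g)) i                     ≡⟨ cong (λ w → lookup (mul w (scale k g)) i) (scale-1 g) ⟨
      lookup (mul (scale 1# g) (scale k g)) i          ≡⟨ cong (λ w → lookup w i) (mul-scale-scale 1# k g g) ⟩
      lookup (scale (1# ⊗ k) (mul g g)) i              ≡⟨ Vec.lookup-map i ((1# ⊗ k) ⊗_) (mul g g) ⟩
      (1# ⊗ k) ⊗ lookup (mul g g) i                    ≡⟨ cong (λ z → (1# ⊗ z) ⊗ lookup (mul g g) i) k≡0 ⟩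
      (1# ⊗ 0#) ⊗ lookup (mul g g) i                   ≡⟨ solve 1 (λ z → (con (+ 1) :* con (+ 0)) :* z := con (+ 0)) refl _ ⟩
      0#                                               ∎)
      where open ≡-Reasoning

  -- The point (-p : q) is the zero of the first linear form, and the second takes the value rq - ps
  -- there. If this is 0, then h, and with it gh, has a double zero.
  separable⇒independent : ∀ (g : Vec Carrier 3) {h : Vec Carrier 3} → Monic (mul g h) → Separable (4 , mul g h) → ∀ {p q r s} →
    h ≡ mul (p ∷ q ∷ []) (r ∷ s ∷ []) → ¬ (p ≡ 0# × q ≡ 0#) → (r ⊗ q) ⊕ (⊝ (p ⊗ s)) ≢ 0#
  separable⇒independent g {h} monic (E , emb , c , ls , ls-monic , distinct , v≡) {p} {q} {r} {s} refl pq≢0 det≡0 =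
    separable⇒no-double-root emb (mul g h) monic c ls ls-monic v≡ distinct {ι (⊝ p)} {ι q} point≢0 λ x′ y′ → begin
      evᴰ (mul g h) (ι (⊝ p) , x′) (ι q , y′)    ≡⟨ evᴰ-mul _ _ g h ⟩
      evᴰ g (ι (⊝ p) , x′) (ι q , y′) D.* evᴰ h (ι (⊝ p) , x′) (ι q , y′)
        ≡⟨ cong (evᴰ g (ι (⊝ p) , x′) (ι q , y′) D.*_) (product-double-root (p ∷ q ∷ []) (r ∷ s ∷ [])
             (at-point p q (solve 2 (λ p q → p :* q :+ (:- p) :* q := con (+ 0)) refl p q))
             (at-point r s (trans (solve 4 (λ p q r s → r :* q :+ (:- p) :* s := r :* q :- p :* s) refl p q r s) det≡0))) ⟩
      evᴰ g (ι (⊝ p) , x′) (ι q , y′) D.* D.0#   ≡⟨ D.zeroʳ _ ⟩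
      D.0#                                       ∎
    where
    open ≡-Reasoning
    module E = FieldTheory E
    module D = CommutativeRing (DualNumbers.dualNumbers E)
    open EmbeddingTheory emb
    open DualEvaluation emb
    point≢0 : ¬ (ι (⊝ p) ≡ E.0# × ι q ≡ E.0#)
    point≢0 (ι-p≡0 , ιq≡0) = ¬¬-excluded-middle {A = p ≡ 0#} λ where
        (yes p≡0) → ι≢0 (λ q≡0 → pq≢0 (p≡0 , q≡0)) ιq≡0
        (no p≢0) → ι≢0 (⊝x≢0 p≢0) ι-p≡0
    at-point : ∀ a b → (a ⊗ q) ⊕ ((⊝ p) ⊗ b) ≡ 0# → ev (a ∷ b ∷ []) (ι (⊝ p)) (ι q) ≡ E.0#
    at-point a b eq = begin
      (ι a E.⊗ (ι q E.⊗ E.1#)) E.⊕ (ι (⊝ p) E.⊗ ι b)   ≡⟨ cong (λ z → (ι a E.⊗ z) E.⊕ (ι (⊝ p) E.⊗ ι b)) (E.*-identityʳ (ι q)) ⟩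
      (ι a E.⊗ ι q) E.⊕ (ι (⊝ p) E.⊗ ι b)              ≡⟨ cong₂ E._⊕_ (sym (ι-⊗ a q)) (sym (ι-⊗ (⊝ p) b)) ⟩
      ι (a ⊗ q) E.⊕ ι ((⊝ p) ⊗ b)                      ≡⟨ ι-⊕ _ _ ⟨
      ι ((a ⊗ q) ⊕ ((⊝ p) ⊗ b))                        ≡⟨ cong ι eq ⟩
      ι 0#                                             ≡⟨ ι-0 ⟩
      E.0#                                             ∎

-- The classification

module MinimalForms {q : ℕ} {K L : Field} (K-size : HasSize K q) (L-size : HasSize L (q ℕ.* q))
                    (emb : Embedding K L) where
  private
    module K where
      open FieldTheory K public
      open FiniteField K K-size public
  open FieldTheory L
  open FiniteField L L-size
  open EmbeddingTheory emb
  open QuadraticExtension K-size L-size emb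
  open Poly K using (Monic; Irreducible; ExactlyOneIrrQuadFactor; mul; scale; xy)
  open Over K using (eval; HomMinPoly; Quartic211; Separable)
  open FormIdentities K
  open Evaluation (embedding-isHom emb) public using (ev; ev-mul; ev-scale; ev-subst)
  open Exp (CommutativeRing.semiring commutativeRing) using (_^_)
  open ≡-Reasoning

  eval≡ev : ∀ {n} α (v : Vec K.Carrier (suc n)) → eval L emb α v ≡ ev v α 1#
  eval≡ev {zero} α (a ∷ []) = refl
  eval≡ev {suc n} α (a ∷ v) = cong₂ (λ s t → s ⊕ (α ⊗ t))
    (sym (trans (cong (ι a ⊗_) (1^ (suc n))) (*-identityʳ (ι a)))) (eval≡ev α v)
    where
    1^ : ∀ n → 1# ^ n ≡ 1#
    1^ zero = refl
    1^ (suc n) = trans (*-identityˡ _) (1^ n)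

  ev-xy : ∀ x y → ev xy x y ≡ x ⊗ y
  ev-xy x y = trans (cong₂ (λ z o → (z ⊗ (y ⊗ (y ⊗ 1#))) ⊕ (x ⊗ ((o ⊗ (y ⊗ 1#)) ⊕ (x ⊗ z)))) ι-0 ι-1)
    (solve 2 (λ x y → con (+ 0) :* (y :* (y :* con (+ 1))) :+ x :* (con (+ 1) :* (y :* con (+ 1)) :+ x :* con (+ 0)) := x :* y) refl x y)

  ev-linear : ∀ a b x y → ev (a ∷ b ∷ []) x y ≡ (ι a ⊗ y) ⊕ (x ⊗ ι b)
  ev-linear a b x y = cong (λ z → (ι a ⊗ z) ⊕ (x ⊗ ι b)) (*-identityʳ y)

  -- Subtracting c times the monic relation eliminates β² and leaves a relation between 1 and β over
  -- K, whose coefficients must vanish. Equalities of quadratic forms below are obtained from this.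
  proportional : ∀ {β} → ¬ Rational β → ∀ {a b c a′ b′} → eval L emb β (a ∷ b ∷ c ∷ []) ≡ 0# →
    eval L emb β (a′ ∷ b′ ∷ K.1# ∷ []) ≡ 0# → a ∷ b ∷ c ∷ [] ≡ scale c (a′ ∷ b′ ∷ K.1# ∷ [])
  proportional {β} β∉K {a} {b} {c} {a′} {b′} e e′ =
    cong₂ _∷_ (proj₁ same) (cong₂ _∷_ (proj₂ same) (cong (_∷ []) (sym (K.*-identityʳ c))))
    where
    same : a ≡ c K.⊗ a′ × b ≡ c K.⊗ b′
    same = independent-≡ β∉K (begin
      ι a ⊕ (β ⊗ ι b)
        ≡⟨ solve 4 (λ a b c β → a :+ β :* b := (a :+ β :* (b :+ β :* c)) :- c :* (β :* β)) refl (ι a) (ι b) (ι c) β ⟩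
      (ι a ⊕ (β ⊗ (ι b ⊕ (β ⊗ ι c)))) ⊕ (⊝ (ι c ⊗ (β ⊗ β)))
        ≡⟨ cong (_⊕ (⊝ (ι c ⊗ (β ⊗ β)))) (trans e (sym (trans (cong (ι c ⊗_) e″) (zeroʳ (ι c))))) ⟩
      (ι c ⊗ (ι a′ ⊕ (β ⊗ (ι b′ ⊕ (β ⊗ 1#))))) ⊕ (⊝ (ι c ⊗ (β ⊗ β)))
        ≡⟨ solve 4 (λ a b c β → c :* (a :+ β :* (b :+ β :* con (+ 1))) :- c :* (β :* β) := c :* a :+ β :* (c :* b)) refl (ι a′) (ι b′) (ι c) β ⟩
      (ι c ⊗ ι a′) ⊕ (β ⊗ (ι c ⊗ ι b′))
        ≡⟨ cong₂ (λ x y → x ⊕ (β ⊗ y)) (ι-⊗ c a′) (ι-⊗ c b′) ⟨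
      ι (c K.⊗ a′) ⊕ (β ⊗ ι (c K.⊗ b′)) ∎)
      where
      e″ : ι a′ ⊕ (β ⊗ (ι b′ ⊕ (β ⊗ 1#))) ≡ 0#
      e″ = trans (cong (λ o → ι a′ ⊕ (β ⊗ (ι b′ ⊕ (β ⊗ o)))) (sym ι-1)) e′

  abstract
    -- The quadratic has a root in K or in L; a root in L that came from K would be a root in K.
    rootless⇒irrational-root : ∀ {a b} → Rootless a b → ∃ λ β → ¬ Rational β × eval L emb β (a ∷ b ∷ K.1# ∷ []) ≡ 0#
    rootless⇒irrational-root {a} {b} rootless with monicQuadratic-root (K.⊝ b) a
    ... | inj₁ (r , root) = contradiction root (rootless r)
    ... | inj₂ (β , root) = β , irrational , (begin
        ι a ⊕ (β ⊗ (ι b ⊕ (β ⊗ ι K.1#)))         ≡⟨ cong (λ o → ι a ⊕ (β ⊗ (ι b ⊕ (β ⊗ o)))) ι-1 ⟩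
        ι a ⊕ (β ⊗ (ι b ⊕ (β ⊗ 1#)))
          ≡⟨ solve 3 (λ a b β → a :+ β :* (b :+ β :* con (+ 1)) := (β :* β :+ a) :- (:- b) :* β) refl (ι a) (ι b) β ⟩
        ((β ⊗ β) ⊕ ι a) ⊕ (⊝ ((⊝ ι b) ⊗ β))      ≡⟨ x≡y⇒x-y≡0 (trans root (cong (_⊗ β) (ι-⊝ b))) ⟩
        0#                                       ∎)
      where
      irrational : ¬ Rational β
      irrational (r , refl) = rootless r (ι-injective (begin
        ι ((r K.⊗ r) K.⊕ a)      ≡⟨ trans (ι-⊕ _ a) (cong (_⊕ ι a) (ι-⊗ r r)) ⟩
        (ι r ⊗ ι r) ⊕ ι a        ≡⟨ root ⟩
        ι (K.⊝ b) ⊗ ι r          ≡⟨ ι-⊗ (K.⊝ b) r ⟨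
        ι ((K.⊝ b) K.⊗ r)        ∎))

  module MinimalForm {α : Carrier} (α∉K : ¬ Rational α) where
    open Conjugate (conjugate α) public

    minimalForm : Vec K.Carrier 3
    minimalForm = norm ∷ K.⊝ trace ∷ K.1# ∷ []

    α≢0 : α ≢ 0#
    α≢0 refl = α∉K (K.0# , ι-0)

    conj≢α : conj ≢ α
    conj≢α conj≡α = α∉K (conj≡⇒rational (conjugate α) conj≡α)

    conj∉K : ¬ Rational conj
    conj∉K (b , ιb≡conj) = α∉K (trace K.⊕ (K.⊝ b) , (begin
      ι (trace K.⊕ (K.⊝ b))       ≡⟨ trans (ι-⊕ trace _) (cong (ι trace ⊕_) (ι-⊝ b)) ⟩
      ι trace ⊕ (⊝ ι b)           ≡⟨ cong₂ (λ t c → t ⊕ (⊝ c)) (sym α+conj≡trace) ιb≡conj ⟩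
      (α ⊕ conj) ⊕ (⊝ conj)       ≡⟨ solve 2 (λ a c → (a :+ c) :- c := a) refl α conj ⟩
      α                           ∎))

    norm≢0 : norm ≢ K.0#
    norm≢0 norm≡0 = x⊗y≢0 α≢0 (λ conj≡0 → conj∉K (K.0# , trans ι-0 (sym conj≡0)))
      (trans α*conj≡norm (trans (cong ι norm≡0) ι-0))

    ev-minimalForm : ∀ x y → ev minimalForm x y ≡ (x ⊕ (⊝ (α ⊗ y))) ⊗ (x ⊕ (⊝ (conj ⊗ y)))
    ev-minimalForm x y = begin
      (ι norm ⊗ (y ⊗ (y ⊗ 1#))) ⊕ (x ⊗ ((ι (K.⊝ trace) ⊗ (y ⊗ 1#)) ⊕ (x ⊗ ι K.1#)))
        ≡⟨ cong₂ (λ n t → (n ⊗ (y ⊗ (y ⊗ 1#))) ⊕ (x ⊗ ((t ⊗ (y ⊗ 1#)) ⊕ (x ⊗ ι K.1#)))) (sym α*conj≡norm)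
             (trans (ι-⊝ trace) (cong ⊝_ (sym α+conj≡trace))) ⟩
      ((α ⊗ conj) ⊗ (y ⊗ (y ⊗ 1#))) ⊕ (x ⊗ (((⊝ (α ⊕ conj)) ⊗ (y ⊗ 1#)) ⊕ (x ⊗ ι K.1#)))
        ≡⟨ cong (λ o → ((α ⊗ conj) ⊗ (y ⊗ (y ⊗ 1#))) ⊕ (x ⊗ (((⊝ (α ⊕ conj)) ⊗ (y ⊗ 1#)) ⊕ (x ⊗ o)))) ι-1 ⟩
      ((α ⊗ conj) ⊗ (y ⊗ (y ⊗ 1#))) ⊕ (x ⊗ (((⊝ (α ⊕ conj)) ⊗ (y ⊗ 1#)) ⊕ (x ⊗ 1#)))
        ≡⟨ solve 4 (λ a c x y → (a :* c) :* (y :* (y :* con (+ 1))) :+ x :* ((:- (a :+ c)) :* (y :* con (+ 1)) :+ x :* con (+ 1))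
             := (x :- a :* y) :* (x :- c :* y)) refl α conj x y ⟩
      (x ⊕ (⊝ (α ⊗ y))) ⊗ (x ⊕ (⊝ (conj ⊗ y))) ∎

    eval-minimalForm : eval L emb α minimalForm ≡ 0#
    eval-minimalForm = trans (eval≡ev α minimalForm) (trans (ev-minimalForm α 1#)
      (solve 2 (λ a c → (a :- a :* con (+ 1)) :* (a :- c :* con (+ 1)) := con (+ 0)) refl α conj))

    homMinPoly : HomMinPoly L emb α (2 , minimalForm)
    homMinPoly = refl , eval-minimalForm , λ where
      0 _ (a ∷ []) eq 0F → ι≡0⇒≡0 eq
      1 _ (a ∷ b ∷ []) eq 0F → proj₁ (independent α∉K eq)
      1 _ (a ∷ b ∷ []) eq 1F → proj₂ (independent α∉K eq)
      (suc (suc _)) (ℕ.s≤s (ℕ.s≤s ())) _ _ _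

    abstract
      -- Degrees 0 and 1 would make 1, α dependent; degree 2 is settled by `proportional`; in a
      -- higher degree the minimality clause would apply to `minimalForm` itself.
      homMinPoly-unique : ∀ {g} → HomMinPoly L emb α g → g ≡ (2 , minimalForm)
      homMinPoly-unique {0 , a ∷ []} (refl , eq , _) = contradiction (ι≡0⇒≡0 eq) K.1≢0
      homMinPoly-unique {1 , a ∷ b ∷ []} (refl , eq , _) = contradiction (proj₂ (independent α∉K eq)) K.1≢0
      homMinPoly-unique {2 , a ∷ b ∷ c ∷ []} (refl , eq , _) = cong (2 ,_)
        (trans (proportional α∉K eq eval-minimalForm) (scale-1 minimalForm))
      homMinPoly-unique {suc (suc (suc m)) , _} (_ , _ , minimal) =
        contradiction (minimal 2 (ℕ.s≤s (ℕ.s≤s (ℕ.s≤s ℕ.z≤n))) minimalForm eval-minimalForm 2F) K.1≢0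

    -- Over L the quadratic is (r - α)(r - conj), and neither α nor its conjugate is rational.
    rootless : Rootless norm (K.⊝ trace)
    rootless r root = x⊗y≢0 (λ eq → α∉K (r , x-y≡0⇒x≡y eq)) (λ eq → conj∉K (r , x-y≡0⇒x≡y eq)) (begin
      (ι r ⊕ (⊝ α)) ⊗ (ι r ⊕ (⊝ conj))
        ≡⟨ solve 3 (λ r a c → (r :- a) :* (r :- c) := (r :* r :+ a :* c) :- (a :+ c) :* r) refl (ι r) α conj ⟩
      ((ι r ⊗ ι r) ⊕ (α ⊗ conj)) ⊕ (⊝ ((α ⊕ conj) ⊗ ι r))
        ≡⟨ cong₂ (λ n t → ((ι r ⊗ ι r) ⊕ n) ⊕ (⊝ (t ⊗ ι r))) α*conj≡norm α+conj≡trace ⟩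
      ((ι r ⊗ ι r) ⊕ ι norm) ⊕ (⊝ (ι trace ⊗ ι r))
        ≡⟨ cong₂ (λ s t → s ⊕ (⊝ t)) (trans (cong (_⊕ ι norm) (sym (ι-⊗ r r))) (sym (ι-⊕ _ norm))) (sym (ι-⊗ trace r)) ⟩
      ι ((r K.⊗ r) K.⊕ norm) ⊕ (⊝ ι (trace K.⊗ r))
        ≡⟨ x≡y⇒x-y≡0 (cong ι (trans root (K.solve 2 (λ t r → (K.:- (K.:- t)) K.:* r K.:= t K.:* r) refl trace r))) ⟩
      0# ∎)

    xy*minimalForm : mul xy minimalForm ≡ K.0# ∷ norm ∷ K.⊝ trace ∷ K.1# ∷ K.0# ∷ []
    xy*minimalForm = xy-mul norm (K.⊝ trace) K.1#

    monic : Monic (mul xy minimalForm)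
    monic = subst Monic (sym xy*minimalForm) (3F , refl , λ where
      4F _ → refl
      0F ()
      1F (ℕ.s≤s ())
      2F (ℕ.s≤s (ℕ.s≤s ()))
      3F (ℕ.s≤s (ℕ.s≤s (ℕ.s≤s ()))))

    -- Another irreducible quadratic factor has an irrational zero β in L. The product xy does not
    -- vanish at (β : 1), so `minimalForm` does, and the two monic quadratics share β.
    exactlyOneFactor : ExactlyOneIrrQuadFactor (4 , mul xy minimalForm)
    exactlyOneFactor = minimalForm ,
      (monic₃ norm (K.⊝ trace) , rootless⇒irreducible rootless ,
        2 , xy , cong (4 ,_) (mul-comm₂₂ minimalForm xy)) ,
      λ g′ (g′-monic , g′-irr , k , h , eq) → unique g′ g′-monic g′-irr k h eq
      where
      unique : ∀ g′ → Monic g′ → Irreducible (2 , g′) → ∀ k (h : Vec K.Carrier (suc k)) →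
        (2 ℕ.+ k , mul g′ h) ≡ (4 , mul xy minimalForm) → g′ ≡ minimalForm
      unique g′ g′-monic g′-irr k h eq with a , b , refl , g′-rootless ← irreducible⇒rootless g′-monic g′-irr
        with refl ← ℕ.suc-injective (ℕ.suc-injective (cong proj₁ eq))
        with β , β∉K , g′β≡0 ← rootless⇒irrational-root g′-rootless =
        trans (proportional β∉K g′β≡0 (trans (eval≡ev β minimalForm) minimalForm-β≡0)) (scale-1 minimalForm)
        where
        product≡0 : (β ⊗ 1#) ⊗ ev minimalForm β 1# ≡ 0#
        product≡0 = begin
          (β ⊗ 1#) ⊗ ev minimalForm β 1#        ≡⟨ cong (_⊗ ev minimalForm β 1#) (ev-xy β 1#) ⟨
          ev xy β 1# ⊗ ev minimalForm β 1#      ≡⟨ ev-mul β 1# xy minimalForm ⟨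
          ev (mul xy minimalForm) β 1#          ≡⟨ cong (λ w → ev w β 1#) (form-injective eq) ⟨
          ev (mul (a ∷ b ∷ K.1# ∷ []) h) β 1#   ≡⟨ ev-mul β 1# (a ∷ b ∷ K.1# ∷ []) h ⟩
          ev (a ∷ b ∷ K.1# ∷ []) β 1# ⊗ ev h β 1#   ≡⟨ cong (_⊗ ev h β 1#) (trans (sym (eval≡ev β (a ∷ b ∷ K.1# ∷ []))) g′β≡0) ⟩
          0# ⊗ ev h β 1#                        ≡⟨ zeroˡ _ ⟩
          0#                                    ∎
        minimalForm-β≡0 : ev minimalForm β 1# ≡ 0#
        minimalForm-β≡0 = x⊗y≡0⇒y≡0 (λ β1≡0 → β∉K (K.0# , trans ι-0 (sym (trans (sym (*-identityʳ β)) β1≡0)))) product≡0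

    -- L itself is the splitting field. The factors differ because α and its conjugate are nonzero
    -- and, by perfectness of K, distinct.
    separable : Separable (4 , mul xy minimalForm)
    separable = L , emb , 1# , ls , (λ { 0F → x-monic _ ; 1F → y-monic ; 2F → x-monic _ ; 3F → x-monic _ }) , distinct , (begin
        Vec.map ι (mul xy minimalForm)
          ≡⟨ cong (Vec.map ι) xy*minimalForm ⟩
        ι K.0# ∷ ι norm ∷ ι (K.⊝ trace) ∷ ι K.1# ∷ ι K.0# ∷ []
          ≡⟨ cong₂ (λ z o → z ∷ ι norm ∷ ι (K.⊝ trace) ∷ o ∷ z ∷ []) ι-0 ι-1 ⟩
        0# ∷ ι norm ∷ ι (K.⊝ trace) ∷ 1# ∷ 0# ∷ []
          ≡⟨ cong₂ (λ n t → 0# ∷ n ∷ t ∷ 1# ∷ 0# ∷ []) (sym α*conj≡norm) (trans (ι-⊝ trace) (cong ⊝_ (sym α+conj≡trace))) ⟩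
        0# ∷ α ⊗ conj ∷ ⊝ (α ⊕ conj) ∷ 1# ∷ 0# ∷ []
          ≡⟨ FormIdentities.splitQuartic L α conj ⟨
        Poly.scale L 1# (prodLin L ls) ∎)
      where
      ls : Vec (Vec Carrier 2) 4
      ls = (0# ∷ 1# ∷ []) ∷ (1# ∷ 0# ∷ []) ∷ (⊝ α ∷ 1# ∷ []) ∷ (⊝ conj ∷ 1# ∷ []) ∷ []
      x-monic : ∀ a → Poly.Monic L (a ∷ 1# ∷ [])
      x-monic a = 1F , refl , λ { 0F () ; 1F (ℕ.s≤s ()) }
      y-monic : Poly.Monic L (1# ∷ 0# ∷ [])
      y-monic = 0F , refl , λ { 0F () ; 1F _ → refl }
      conj≢0 : conj ≢ 0#
      conj≢0 conj≡0 = conj∉K (K.0# , trans ι-0 (sym conj≡0))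
      distinct₀ : ∀ {a b c d : Carrier} → a ≢ c → Vec._∷_ a (b ∷ []) ≢ c ∷ d ∷ []
      distinct₀ a≢c eq = a≢c (cong (λ v → lookup v 0F) eq)
      distinct₁ : ∀ {a b c d : Carrier} → b ≢ d → Vec._∷_ a (b ∷ []) ≢ c ∷ d ∷ []
      distinct₁ b≢d eq = b≢d (cong (λ v → lookup v 1F) eq)
      ⊝-injective : ∀ {a b} → ⊝ a ≡ ⊝ b → a ≡ b
      ⊝-injective {a} {b} eq = trans (solve 1 (λ a → a := :- (:- a)) refl a) (trans (cong ⊝_ eq) (solve 1 (λ a → :- (:- a) := a) refl b))
      distinct : ∀ i j → i ≢ j → lookup ls i ≢ lookup ls j
      distinct 0F 0F i≢j = contradiction refl i≢j
      distinct 0F 1F _ = distinct₁ 1≢0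
      distinct 0F 2F _ = distinct₀ (⊝x≢0 α≢0 ∘ sym)
      distinct 0F 3F _ = distinct₀ (⊝x≢0 conj≢0 ∘ sym)
      distinct 1F 0F _ = distinct₁ 0≢1
      distinct 1F 1F i≢j = contradiction refl i≢j
      distinct 1F 2F _ = distinct₁ 0≢1
      distinct 1F 3F _ = distinct₁ 0≢1
      distinct 2F 0F _ = distinct₀ (⊝x≢0 α≢0)
      distinct 2F 1F _ = distinct₁ 1≢0
      distinct 2F 2F i≢j = contradiction refl i≢j
      distinct 2F 3F _ = distinct₀ (conj≢α ∘ sym ∘ ⊝-injective)
      distinct 3F 0F _ = distinct₀ (⊝x≢0 conj≢0)
      distinct 3F 1F _ = distinct₁ 1≢0
      distinct 3F 2F _ = distinct₀ (conj≢α ∘ ⊝-injective)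
      distinct 3F 3F i≢j = contradiction refl i≢j

    quartic211 : Quartic211 (4 , mul xy minimalForm)
    quartic211 = lift (refl , monic , exactlyOneFactor) , separable

-- Orbits of the quartics under projective substitutions

module Classification {q : ℕ} {K L : Field} (K-size : HasSize K q) (L-size : HasSize L (q ℕ.* q))
                      (emb : Embedding K L) (ζ : Field.Carrier L) (gen : Generator L ζ) where
  private
    module K where
      open FieldTheory K public
      open FiniteField K K-size public
  open FieldTheory L
  open FiniteField L L-size
  open EmbeddingTheory emb
  open QuadraticExtension K-size L-size emb
  open MinimalForms K-size L-size emb
  open PrimitiveElement K-size L-size emb ζ gen
  open Poly K using (HForm; Monic; Divides; Irreducible; mul; scale; xy; InOrbit)
  open Over K using (eval; Quartic211; Separable; R211)
  open FormIdentities K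
  open ≡-Reasoning

  -- The determinant of the Möbius map β ↦ (p + qβ)/(r + sβ) given by the linear forms qx + py and
  -- sx + ry.
  det : K.Carrier → K.Carrier → K.Carrier → K.Carrier → K.Carrier
  det p q r s = (r K.⊗ q) K.⊕ (K.⊝ (p K.⊗ s))

  reps⊆quartics : ∀ f → R211 L emb q ζ f → Quartic211 f
  reps⊆quartics f (lift (i , 0<i , i≤h , g , minPoly , refl)) with refl ← MinimalForm.homMinPoly-unique (small-power-irrational 0<i i≤h) minPoly =
    MinimalForm.quartic211 (small-power-irrational 0<i i≤h)

  vanishing-at-rational-pair : ∀ {α} → ¬ Rational α → ∀ {a b} → ι a ⊕ (⊝ (α ⊗ ι b)) ≡ 0# → a ≡ K.0# × b ≡ K.0#
  vanishing-at-rational-pair {α} α∉K {a} {b} eq with refl , -b≡0 ← independent α∉K {a} {K.⊝ b} (trans (cong (λ z → ι a ⊕ (α ⊗ z)) (ι-⊝ b))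
      (trans (solve 3 (λ a α b → a :+ α :* (:- b) := a :- α :* b) refl (ι a) α (ι b)) eq)) =
    refl , trans (K.solve 1 (λ b → b K.:= K.:- (K.:- b)) refl b) (trans (cong K.⊝_ -b≡0) (K.solve 0 (K.:- (K.con (+ 0)) K.:= K.con (+ 0)) refl))

  module _ {p q r s} (det≢0 : det p q r s ≢ K.0#) where

    private
      q≢0∨s≢0 : ¬ (q ≡ K.0# × s ≡ K.0#)
      q≢0∨s≢0 (refl , refl) = det≢0 (K.solve 2 (λ p r → r K.:* K.con (+ 0) K.:- p K.:* K.con (+ 0) K.:= K.con (+ 0)) refl p r)

    denominator≢0 : ∀ {β} → ¬ Rational β → ι r ⊕ (β ⊗ ι s) ≢ 0#
    denominator≢0 β∉K eq with r≡0 , s≡0 ← independent β∉K eq = det≢0 (trans (cong₂ (λ r s → det p q r s) r≡0 s≡0)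
      (K.solve 2 (λ p q → K.con (+ 0) K.:* q K.:- p K.:* K.con (+ 0) K.:= K.con (+ 0)) refl p q))

    -- A rational quotient a would give (p, q) = a · (r, s) by independence of 1 and β, and so a
    -- vanishing determinant.
    möbius-irrational : ∀ {β} → ¬ Rational β → ∃ λ γ → ¬ Rational γ × ι p ⊕ (β ⊗ ι q) ≡ γ ⊗ (ι r ⊕ (β ⊗ ι s))
    möbius-irrational {β} β∉K = let y⁻¹ , yy⁻¹≡1 = inverse (ι r ⊕ (β ⊗ ι s)) (denominator≢0 β∉K) in quotient y⁻¹ yy⁻¹≡1
      where
      x y : Carrier
      x = ι p ⊕ (β ⊗ ι q)
      y = ι r ⊕ (β ⊗ ι s)
      quotient : ∀ y⁻¹ → y ⊗ y⁻¹ ≡ 1# → ∃ λ γ → ¬ Rational γ × x ≡ γ ⊗ y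
      quotient y⁻¹ yy⁻¹≡1 = x ⊗ y⁻¹ , irrational , x≡
        where
        x≡ : x ≡ (x ⊗ y⁻¹) ⊗ y
        x≡ = begin
          x                ≡⟨ *-identityʳ x ⟨
          x ⊗ 1#           ≡⟨ cong (x ⊗_) yy⁻¹≡1 ⟨
          x ⊗ (y ⊗ y⁻¹)    ≡⟨ solve 3 (λ x y z → x :* (y :* z) := (x :* z) :* y) refl x y y⁻¹ ⟩
          (x ⊗ y⁻¹) ⊗ y    ∎
        irrational : ¬ Rational (x ⊗ y⁻¹)
        irrational (a , ιa≡) with p≡ar , q≡as ← independent-≡ β∉K {p} {q} {a K.⊗ r} {a K.⊗ s} (begin
            x                                     ≡⟨ x≡ ⟩
            (x ⊗ y⁻¹) ⊗ y                         ≡⟨ cong (_⊗ y) ιa≡ ⟨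
            ι a ⊗ y
              ≡⟨ solve 4 (λ a r β s → a :* (r :+ β :* s) := a :* r :+ β :* (a :* s)) refl (ι a) (ι r) β (ι s) ⟩
            (ι a ⊗ ι r) ⊕ (β ⊗ (ι a ⊗ ι s))       ≡⟨ cong₂ (λ u v → u ⊕ (β ⊗ v)) (ι-⊗ a r) (ι-⊗ a s) ⟨
            ι (a K.⊗ r) ⊕ (β ⊗ ι (a K.⊗ s))       ∎) =
          det≢0 (trans (cong₂ (λ p q → det p q r s) p≡ar q≡as)
            (K.solve 3 (λ a r s → r K.:* (a K.:* s) K.:- (a K.:* r) K.:* s K.:= K.con (+ 0)) refl a r s))

    module _ {α} (α∉K : ¬ Rational α) where
      open MinimalForm α∉K

      -- The coefficient of x² is the value at (1 : 0), which substitution carries to (q : s). There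
      -- the form is (q - αs)(q - conj · s), which vanishes only for q = s = 0.
      top-coefficient≢0 : lookup (Poly.subst K (p ∷ q ∷ []) (r ∷ s ∷ []) minimalForm) 2F ≢ K.0#
      top-coefficient≢0 top≡0 = x⊗y≢0 (factor≢0 α∉K) (factor≢0 conj∉K) (begin
        (ι q ⊕ (⊝ (α ⊗ ι s))) ⊗ (ι q ⊕ (⊝ (conj ⊗ ι s)))   ≡⟨ ev-minimalForm (ι q) (ι s) ⟨
        ev minimalForm (ι q) (ι s)                         ≡⟨ cong₂ (ev minimalForm) (at-∞ p q) (at-∞ r s) ⟨
        ev minimalForm (ev (p ∷ q ∷ []) 1# 0#) (ev (r ∷ s ∷ []) 1# 0#)   ≡⟨ ev-subst 1# 0# (p ∷ q ∷ []) (r ∷ s ∷ []) minimalForm ⟨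
        ev (Poly.subst K (p ∷ q ∷ []) (r ∷ s ∷ []) minimalForm) 1# 0#
          ≡⟨ quadratic-at-∞ (Poly.subst K (p ∷ q ∷ []) (r ∷ s ∷ []) minimalForm) ⟩
        ι (lookup (Poly.subst K (p ∷ q ∷ []) (r ∷ s ∷ []) minimalForm) 2F)  ≡⟨ trans (cong ι top≡0) ι-0 ⟩
        0#                                                 ∎)
        where
        at-∞ : ∀ a b → ev (a ∷ b ∷ []) 1# 0# ≡ ι b
        at-∞ a b = trans (ev-linear a b 1# 0#) (solve 2 (λ a b → a :* con (+ 0) :+ con (+ 1) :* b := b) refl (ι a) (ι b))
        quadratic-at-∞ : ∀ v → ev v 1# 0# ≡ ι (lookup v 2F)
        quadratic-at-∞ (a ∷ b ∷ c ∷ []) = solve 3 (λ a b c → a :* (con (+ 0) :* (con (+ 0) :* con (+ 1))) :+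
          con (+ 1) :* (b :* (con (+ 0) :* con (+ 1)) :+ con (+ 1) :* c) := c) refl (ι a) (ι b) (ι c)
        factor≢0 : ∀ {θ} → ¬ Rational θ → ι q ⊕ (⊝ (θ ⊗ ι s)) ≢ 0#
        factor≢0 θ∉K eq = q≢0∨s≢0 (vanishing-at-rational-pair θ∉K eq)

      transported-root : ∀ {β} → (ι p ⊕ (β ⊗ ι q) ≡ α ⊗ (ι r ⊕ (β ⊗ ι s))) ⊎ (ι p ⊕ (β ⊗ ι q) ≡ conj ⊗ (ι r ⊕ (β ⊗ ι s))) →
        ev (Poly.subst K (p ∷ q ∷ []) (r ∷ s ∷ []) minimalForm) β 1# ≡ 0#
      transported-root {β} root = begin
        ev (Poly.subst K (p ∷ q ∷ []) (r ∷ s ∷ []) minimalForm) β 1#       ≡⟨ ev-subst β 1# (p ∷ q ∷ []) (r ∷ s ∷ []) minimalForm ⟩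
        ev minimalForm (ev (p ∷ q ∷ []) β 1#) (ev (r ∷ s ∷ []) β 1#)       ≡⟨ cong₂ (ev minimalForm) (at-β p q) (at-β r s) ⟩
        ev minimalForm x y                                                 ≡⟨ ev-minimalForm x y ⟩
        (x ⊕ (⊝ (α ⊗ y))) ⊗ (x ⊕ (⊝ (conj ⊗ y)))                           ≡⟨ vanish root ⟩
        0#                                                                 ∎
        where
        x y : Carrier
        x = ι p ⊕ (β ⊗ ι q)
        y = ι r ⊕ (β ⊗ ι s)
        at-β : ∀ a b → ev (a ∷ b ∷ []) β 1# ≡ ι a ⊕ (β ⊗ ι b)
        at-β a b = trans (ev-linear a b β 1#) (cong (_⊕ (β ⊗ ι b)) (*-identityʳ (ι a)))
        vanish : x ≡ α ⊗ y ⊎ x ≡ conj ⊗ y → (x ⊕ (⊝ (α ⊗ y))) ⊗ (x ⊕ (⊝ (conj ⊗ y))) ≡ 0#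
        vanish (inj₁ eq) = trans (cong (_⊗ (x ⊕ (⊝ (conj ⊗ y)))) (x≡y⇒x-y≡0 eq)) (zeroˡ _)
        vanish (inj₂ eq) = trans (cong ((x ⊕ (⊝ (α ⊗ y))) ⊗_) (x≡y⇒x-y≡0 eq)) (zeroʳ _)

      -- If the Möbius map takes β to α or to its conjugate, the transform of `minimalForm` vanishes
      -- at β and is therefore a multiple of the quadratic with root β; the factor xy becomes the
      -- product of the two linear forms.
      inOrbit : ∀ {a b β} → ¬ Rational β → eval L emb β (a ∷ b ∷ K.1# ∷ []) ≡ 0# →
        (ι p ⊕ (β ⊗ ι q) ≡ α ⊗ (ι r ⊕ (β ⊗ ι s))) ⊎ (ι p ⊕ (β ⊗ ι q) ≡ conj ⊗ (ι r ⊕ (β ⊗ ι s))) →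
        ∀ {v : Vec K.Carrier 5} {k} → Monic v → scale k v ≡ mul (a ∷ b ∷ K.1# ∷ []) (mul (p ∷ q ∷ []) (r ∷ s ∷ [])) → k ≢ K.0# →
        InOrbit (4 , mul xy minimalForm) (4 , v)
      inOrbit {a} {b} {β} β∉K g≡0 root {v} {k} v-monic v≡ k≢0 = let t , λkt≡1 = K.inverse (top K.⊗ k) (K.x⊗y≢0 top-coefficient≢0 k≢0) in
        -- The action substitutes dx - by and -cx + ay; these entries turn the two forms into qx +
        -- py and sx + ry. The scalar t inverts the leading coefficient times k.
        r , K.⊝ p , K.⊝ s , q , (λ eq → det≢0 (trans (K.solve 4 (λ p q r s → r K.:* q K.:- p K.:* s K.:= r K.:* q K.:- (K.:- p) K.:* (K.:- s)) refl p q r s) eq)) ,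
        v-monic , t , cong (4 ,_) (begin
          scale t (Poly.subst K (K.⊝ (K.⊝ p) ∷ q ∷ []) (r ∷ K.⊝ (K.⊝ s) ∷ []) (mul xy minimalForm))
            ≡⟨ cong₂ (λ p s → scale t (Poly.subst K (p ∷ q ∷ []) (r ∷ s ∷ []) (mul xy minimalForm))) (⊝⊝ p) (⊝⊝ s) ⟩
          scale t (Poly.subst K (p ∷ q ∷ []) (r ∷ s ∷ []) (mul xy minimalForm))
            ≡⟨ cong (scale t) (subst-xyTimes (p ∷ q ∷ []) (r ∷ s ∷ []) minimalForm) ⟩
          scale t (mul transformed linear)
            ≡⟨ cong₂ (λ u w → scale t (mul u w)) (proportional′ transformed (trans (eval≡ev β transformed) (transported-root root))) (sym (scale-1 linear)) ⟩
          scale t (mul (scale top g) (scale K.1# linear))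
            ≡⟨ cong (scale t) (mul-scale-scale top K.1# g linear) ⟩
          scale t (scale (top K.⊗ K.1#) (mul g linear))
            ≡⟨ cong (λ w → scale t (scale (top K.⊗ K.1#) w)) v≡ ⟨
          scale t (scale (top K.⊗ K.1#) (scale k v))
            ≡⟨ trans (cong (scale t) (scale-scale _ k v)) (scale-scale t _ v) ⟩
          scale (t K.⊗ ((top K.⊗ K.1#) K.⊗ k)) v
            ≡⟨ cong (λ z → scale z v) (trans (K.solve 3 (λ t l k → t K.:* ((l K.:* K.con (+ 1)) K.:* k) K.:= (l K.:* k) K.:* t) refl t top k) λkt≡1) ⟩
          scale K.1# v
            ≡⟨ scale-1 v ⟩
          v ∎)
        where
        g linear transformed : Vec K.Carrier 3
        g = a ∷ b ∷ K.1# ∷ []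
        linear = mul (p ∷ q ∷ []) (r ∷ s ∷ [])
        transformed = Poly.subst K (p ∷ q ∷ []) (r ∷ s ∷ []) minimalForm
        top : K.Carrier
        top = lookup transformed 2F
        ⊝⊝ : ∀ x → K.⊝ (K.⊝ x) ≡ x
        ⊝⊝ = K.solve 1 (λ x → K.:- (K.:- x) K.:= x) refl
        proportional′ : ∀ u → eval L emb β u ≡ 0# → u ≡ scale (lookup u 2F) g
        proportional′ (_ ∷ _ ∷ _ ∷ []) eq = proportional β∉K eq g≡0

  -- When γ · ζⁱ = a, multiplying by the conjugate and dividing by the norm gives γ = (a/norm) ·
  -- conj.
  representative-multiple : ∀ {γ} → ¬ Rational γ → ∃ λ i → ∃ λ (0<i : 0 ℕ.< i) → ∃ λ (i≤h : i ℕ.≤ ℕ.⌊ suc q /2⌋) →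
    ∃ λ a → a ≢ K.0# × (γ ≡ ι a ⊗ (ζ ^F i) ⊎ γ ≡ ι a ⊗ MinimalForm.conj (small-power-irrational 0<i i≤h))
  representative-multiple {γ} γ∉K with representative γ∉K
  ... | i , 0<i , i≤h , inj₁ (a , γ≡) = i , 0<i , i≤h , a ,
    (λ { refl → γ∉K (K.0# , trans ι-0 (sym (trans γ≡ (trans (cong (_⊗ (ζ ^F i)) ι-0) (zeroˡ _))))) }) , inj₁ γ≡
  ... | i , 0<i , i≤h , inj₂ (a , γα≡) = let n⁻¹ , nn⁻¹≡1 = K.inverse norm norm≢0 in
    i , 0<i , i≤h , a K.⊗ n⁻¹ ,
    K.x⊗y≢0 (λ { refl → x⊗y≢0 γ≢0 α≢0 (trans γα≡ ι-0) }) (K.inverse≢0 nn⁻¹≡1) , inj₂ (begin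
      γ                                     ≡⟨ *-identityʳ γ ⟨
      γ ⊗ 1#                                ≡⟨ cong (γ ⊗_) (trans (sym ι-1) (trans (cong ι (sym nn⁻¹≡1)) (ι-⊗ norm n⁻¹))) ⟩
      γ ⊗ (ι norm ⊗ ι n⁻¹)                  ≡⟨ cong (λ z → γ ⊗ (z ⊗ ι n⁻¹)) α*conj≡norm ⟨
      γ ⊗ (((ζ ^F i) ⊗ conj) ⊗ ι n⁻¹)
        ≡⟨ solve 4 (λ g a c n → g :* ((a :* c) :* n) := ((g :* a) :* n) :* c) refl γ (ζ ^F i) conj (ι n⁻¹) ⟩
      ((γ ⊗ (ζ ^F i)) ⊗ ι n⁻¹) ⊗ conj       ≡⟨ cong (λ z → (z ⊗ ι n⁻¹) ⊗ conj) γα≡ ⟩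
      (ι a ⊗ ι n⁻¹) ⊗ conj                  ≡⟨ cong (_⊗ conj) (ι-⊗ a n⁻¹) ⟨
      ι (a K.⊗ n⁻¹) ⊗ conj                  ∎)
    where
    open MinimalForm (small-power-irrational 0<i i≤h)
    γ≢0 : γ ≢ 0#
    γ≢0 refl = γ∉K (K.0# , ι-0)

  -- Replacing (r, s) by (kr, ks) divides the quotient γ by k, leaving ζⁱ or its conjugate. The
  -- product of the factors becomes k · v, and the normalizing scalar of the action absorbs k.
  orbit-representative : ∀ {a b p q′ r s} → Rootless a b → det p q′ r s ≢ K.0# →
    let v = mul (a ∷ b ∷ K.1# ∷ []) (mul (p ∷ q′ ∷ []) (r ∷ s ∷ [])) in
    Monic v → Σ HForm λ f → R211 L emb q ζ f × InOrbit f (4 , v)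
  orbit-representative {a} {b} {p} {q′} {r} {s} rootless det≢0 monic =
    let β , β∉K , g≡0 = rootless⇒irrational-root rootless
        γ , γ∉K , x≡γy = möbius-irrational det≢0 β∉K
        i , 0<i , i≤h , k , k≢0 , γ≡ = representative-multiple γ∉K
        module M = MinimalForm (small-power-irrational 0<i i≤h)
    in (4 , mul xy M.minimalForm) , lift (i , 0<i , i≤h , (2 , M.minimalForm) , M.homMinPoly , refl) ,
       inOrbit {p} {q′} {k K.⊗ r} {k K.⊗ s} (scaled-det≢0 k≢0) (small-power-irrational 0<i i≤h) β∉K g≡0
         (Sum.map (absorb x≡γy) (absorb x≡γy) γ≡) monic (scaled-product k) k≢0
    where
    g : Vec K.Carrier 3
    g = a ∷ b ∷ K.1# ∷ []
    scaled-det≢0 : ∀ {k} → k ≢ K.0# → det p q′ (k K.⊗ r) (k K.⊗ s) ≢ K.0#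
    scaled-det≢0 {k} k≢0 eq = K.x⊗y≢0 k≢0 det≢0 (trans (K.solve 5 (λ k p q r s → k K.:* (r K.:* q K.:- p K.:* s)
      K.:= (k K.:* r) K.:* q K.:- p K.:* (k K.:* s)) refl k p q′ r s) eq)
    absorb : ∀ {β γ k θ} → ι p ⊕ (β ⊗ ι q′) ≡ γ ⊗ (ι r ⊕ (β ⊗ ι s)) → γ ≡ ι k ⊗ θ →
      ι p ⊕ (β ⊗ ι q′) ≡ θ ⊗ (ι (k K.⊗ r) ⊕ (β ⊗ ι (k K.⊗ s)))
    absorb {β} {γ} {k} {θ} x≡ γ≡ = begin
      ι p ⊕ (β ⊗ ι q′)                                  ≡⟨ x≡ ⟩
      γ ⊗ (ι r ⊕ (β ⊗ ι s))                             ≡⟨ cong (_⊗ (ι r ⊕ (β ⊗ ι s))) γ≡ ⟩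
      (ι k ⊗ θ) ⊗ (ι r ⊕ (β ⊗ ι s))
        ≡⟨ solve 5 (λ k θ r β s → (k :* θ) :* (r :+ β :* s) := θ :* (k :* r :+ β :* (k :* s))) refl (ι k) θ (ι r) β (ι s) ⟩
      θ ⊗ ((ι k ⊗ ι r) ⊕ (β ⊗ (ι k ⊗ ι s)))             ≡⟨ cong₂ (λ u w → θ ⊗ (u ⊕ (β ⊗ w))) (ι-⊗ k r) (ι-⊗ k s) ⟨
      θ ⊗ (ι (k K.⊗ r) ⊕ (β ⊗ ι (k K.⊗ s)))             ∎
    scaled-product : ∀ k → scale k (mul g (mul (p ∷ q′ ∷ []) (r ∷ s ∷ []))) ≡ mul g (mul (p ∷ q′ ∷ []) (scale k (r ∷ s ∷ [])))
    scaled-product k = begin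
      scale k (mul g (mul (p ∷ q′ ∷ []) (r ∷ s ∷ [])))
        ≡⟨ cong (λ z → scale z (mul g (mul (p ∷ q′ ∷ []) (r ∷ s ∷ [])))) (K.*-identityˡ k) ⟨
      scale (K.1# K.⊗ k) (mul g (mul (p ∷ q′ ∷ []) (r ∷ s ∷ [])))
        ≡⟨ mul-scale-scale K.1# k g (mul (p ∷ q′ ∷ []) (r ∷ s ∷ [])) ⟨
      mul (scale K.1# g) (scale k (mul (p ∷ q′ ∷ []) (r ∷ s ∷ [])))
        ≡⟨ cong₂ mul (scale-1 g) (sym (mul-linear-scale k (p ∷ q′ ∷ []) (r ∷ s ∷ []))) ⟩
      mul g (mul (p ∷ q′ ∷ []) (scale k (r ∷ s ∷ []))) ∎

  -- Otherwise h would be a second irreducible quadratic factor, hence proportional to g,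
  -- and the quartic would be a square.
  cofactor-splits : ∀ g h → Monic (mul g h) → Separable (4 , mul g h) →
    (∀ g′ → Monic g′ × Irreducible (2 , g′) × Divides g′ (4 , mul g h) → g′ ≡ g) →
    ∃ λ p → ∃ λ q → ∃ λ r → ∃ λ s → h ≡ mul (p ∷ q ∷ []) (r ∷ s ∷ []) × ¬ (p ≡ K.0# × q ≡ K.0#)
  cofactor-splits g (h₀ ∷ h₁ ∷ h₂ ∷ []) monic separable unique with h₂ K.≟ K.0#
  -- Without an x² term, y divides h: this is the zero at infinity, which a search through K does
  -- not see.
  ... | yes refl = K.1# , K.0# , h₀ , h₁ , sym (trans (mul-linear K.1# K.0# h₀ h₁) (cong₂ _∷_ (K.*-identityˡ h₀)
      (cong₂ _∷_ (K.solve 2 (λ a b → K.con (+ 1) K.:* b K.:+ K.con (+ 0) K.:* a K.:= b) refl h₀ h₁) (cong (_∷ []) (K.zeroˡ h₁))))) ,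
    λ (1≡0 , _) → K.1≢0 1≡0
  ... | no h₂≢0 with K.∃? (λ x → h₀ K.⊕ (x K.⊗ (h₁ K.⊕ (x K.⊗ h₂))) K.≟ K.0#)
  ... | yes (x , root) = K.⊝ x , K.1# , h₁ K.⊕ (h₂ K.⊗ x) , h₂ ,
    sym (trans (mul-linear (K.⊝ x) K.1# (h₁ K.⊕ (h₂ K.⊗ x)) h₂) (cong₂ _∷_
      (trans (K.solve 4 (λ a b c x → (K.:- x) K.:* (b K.:+ c K.:* x) K.:= a K.:- (a K.:+ x K.:* (b K.:+ x K.:* c))) refl h₀ h₁ h₂ x)
        (trans (cong (λ z → h₀ K.⊕ (K.⊝ z)) root) (K.solve 1 (λ a → a K.:- K.con (+ 0) K.:= a) refl h₀)))
      (cong₂ _∷_ (K.solve 3 (λ b c x → (K.:- x) K.:* c K.:+ K.con (+ 1) K.:* (b K.:+ c K.:* x) K.:= b) refl h₁ h₂ x)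
        (cong (_∷ []) (K.*-identityˡ h₂))))) ,
    λ (_ , 1≡0) → K.1≢0 1≡0
  ... | no no-root = ⊥-elim (let u , h₂u≡1 = K.inverse h₂ h₂≢0 in second-factor u h₂u≡1)
    where
    h : Vec K.Carrier 3
    h = h₀ ∷ h₁ ∷ h₂ ∷ []
    second-factor : ∀ u → h₂ K.⊗ u ≡ K.1# → ⊥
    second-factor u h₂u≡1 = separable⇒not-square g monic separable h₂ (begin
        h                                  ≡⟨ scale-1 h ⟨
        scale K.1# h                       ≡⟨ cong (λ z → scale z h) h₂u≡1 ⟨
        scale (h₂ K.⊗ u) h                 ≡⟨ scale-scale h₂ u h ⟨
        scale h₂ (scale u h)
          ≡⟨ cong (scale h₂) (trans u*h≡ (unique _ (monic₃ _ _ , rootless⇒irreducible rootless , factor))) ⟩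
        scale h₂ g                         ∎)
      where
      uh₂≡1 : u K.⊗ h₂ ≡ K.1#
      uh₂≡1 = trans (K.*-comm u h₂) h₂u≡1
      u*h≡ : scale u h ≡ u K.⊗ h₀ ∷ u K.⊗ h₁ ∷ K.1# ∷ []
      u*h≡ = cong (λ z → u K.⊗ h₀ ∷ u K.⊗ h₁ ∷ z ∷ []) uh₂≡1
      rootless : Rootless (u K.⊗ h₀) (u K.⊗ h₁)
      rootless x root = no-root (x , K.x⊗y≡0⇒y≡0 (K.inverse≢0 h₂u≡1) (begin
        u K.⊗ (h₀ K.⊕ (x K.⊗ (h₁ K.⊕ (x K.⊗ h₂))))
          ≡⟨ K.solve 5 (λ u a b c x → u K.:* (a K.:+ x K.:* (b K.:+ x K.:* c)) K.:= ((u K.:* c) K.:* (x K.:* x) K.:+ u K.:* a) K.:- (K.:- (u K.:* b)) K.:* x) refl u h₀ h₁ h₂ x ⟩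
        (((u K.⊗ h₂) K.⊗ (x K.⊗ x)) K.⊕ (u K.⊗ h₀)) K.⊕ (K.⊝ ((K.⊝ (u K.⊗ h₁)) K.⊗ x))
          ≡⟨ cong (λ z → (z K.⊕ (u K.⊗ h₀)) K.⊕ (K.⊝ ((K.⊝ (u K.⊗ h₁)) K.⊗ x))) (trans (cong (K._⊗ (x K.⊗ x)) uh₂≡1) (K.*-identityˡ _)) ⟩
        ((x K.⊗ x) K.⊕ (u K.⊗ h₀)) K.⊕ (K.⊝ ((K.⊝ (u K.⊗ h₁)) K.⊗ x))
          ≡⟨ K.x≡y⇒x-y≡0 root ⟩
        K.0# ∎))
      factor : Divides (u K.⊗ h₀ ∷ u K.⊗ h₁ ∷ K.1# ∷ []) (4 , mul g h)
      factor = 2 , scale h₂ g , cong (4 ,_) (begin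
        mul (u K.⊗ h₀ ∷ u K.⊗ h₁ ∷ K.1# ∷ []) (scale h₂ g)   ≡⟨ cong (λ w → mul w (scale h₂ g)) u*h≡ ⟨
        mul (scale u h) (scale h₂ g)                         ≡⟨ mul-scale-scale u h₂ h g ⟩
        scale (u K.⊗ h₂) (mul h g)                           ≡⟨ cong (λ z → scale z (mul h g)) uh₂≡1 ⟩
        scale K.1# (mul h g)                                 ≡⟨ scale-1 (mul h g) ⟩
        mul h g                                              ≡⟨ mul-comm₂₂ h g ⟩
        mul g h                                              ∎)

  every-orbit-represented : ∀ f → Quartic211 f → Σ HForm λ r → R211 L emb q ζ r × InOrbit r f
  every-orbit-represented (4 , v) (lift (refl , monic , g , (g-monic , g-irr , k , h , eq) , unique) , separable)
    with refl ← ℕ.suc-injective (ℕ.suc-injective (cong proj₁ eq)) with refl ← form-injective eq =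
    let p , q′ , r , s , h≡ , pq≢0 = cofactor-splits g h monic separable unique
        a , b , g≡ , rootless = irreducible⇒rootless g-monic g-irr
    in subst (λ w → Σ HForm λ r → R211 L emb q ζ r × InOrbit r (4 , w)) (sym (cong₂ mul g≡ h≡))
         (orbit-representative rootless (separable⇒independent g monic separable h≡ pq≢0) (subst Monic (cong₂ mul g≡ h≡) monic))

  module _ {α α′} (α∉K : ¬ Rational α) (α′∉K : ¬ Rational α′) where
    private
      module M = MinimalForm α∉K
      module M′ = MinimalForm α′∉K

    module _ {p q r s k} (same : scale k (Poly.subst K (p ∷ q ∷ []) (r ∷ s ∷ []) (mul xy M.minimalForm)) ≡ mul xy M′.minimalForm) where

      -- The quartic of α′ at (x, y) is k times the quartic of α at the image (X, Y). Here k ≠ 0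
      -- since the former has an entry 1, so one of the four linear factors of the latter vanishes
      -- at (X, Y).
      zero-transport : ∀ x y → (x ⊗ y) ⊗ ((x ⊕ (⊝ (α′ ⊗ y))) ⊗ (x ⊕ (⊝ (M′.conj ⊗ y)))) ≡ 0# →
        let X = (ι p ⊗ y) ⊕ (x ⊗ ι q) ; Y = (ι r ⊗ y) ⊕ (x ⊗ ι s) in
        X ≡ 0# ⊎ Y ≡ 0# ⊎ X ⊕ (⊝ (α ⊗ Y)) ≡ 0# ⊎ X ⊕ (⊝ (M.conj ⊗ Y)) ≡ 0#
      zero-transport x y vanish = [ (λ XY≡0 → Sum.map₂ inj₁ (x⊗y≡0⇒x≡0⊎y≡0 XY≡0)) , (λ e → inj₂ (inj₂ (x⊗y≡0⇒x≡0⊎y≡0 e))) ]′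
          (x⊗y≡0⇒x≡0⊎y≡0 (x⊗y≡0⇒y≡0 (ι≢0 k≢0) (begin
            ι k ⊗ ((X ⊗ Y) ⊗ ((X ⊕ (⊝ (α ⊗ Y))) ⊗ (X ⊕ (⊝ (M.conj ⊗ Y)))))
              ≡⟨ cong (ι k ⊗_) (quartic-value M.minimalForm (M.ev-minimalForm X Y)) ⟨
            ι k ⊗ ev (mul xy M.minimalForm) X Y
              ≡⟨ cong₂ (λ X Y → ι k ⊗ ev (mul xy M.minimalForm) X Y) (ev-linear p q x y) (ev-linear r s x y) ⟨
            ι k ⊗ ev (mul xy M.minimalForm) (ev (p ∷ q ∷ []) x y) (ev (r ∷ s ∷ []) x y)
              ≡⟨ cong (ι k ⊗_) (ev-subst x y (p ∷ q ∷ []) (r ∷ s ∷ []) (mul xy M.minimalForm)) ⟨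
            ι k ⊗ ev (Poly.subst K (p ∷ q ∷ []) (r ∷ s ∷ []) (mul xy M.minimalForm)) x y
              ≡⟨ ev-scale x y k (Poly.subst K (p ∷ q ∷ []) (r ∷ s ∷ []) (mul xy M.minimalForm)) ⟨
            ev (scale k (Poly.subst K (p ∷ q ∷ []) (r ∷ s ∷ []) (mul xy M.minimalForm))) x y
              ≡⟨ cong (λ w → ev w x y) same ⟩
            ev (mul xy M′.minimalForm) x y
              ≡⟨ quartic-value M′.minimalForm (M′.ev-minimalForm x y) ⟩
            (x ⊗ y) ⊗ ((x ⊕ (⊝ (α′ ⊗ y))) ⊗ (x ⊕ (⊝ (M′.conj ⊗ y))))
              ≡⟨ vanish ⟩
            0# ∎)))
        where
        X Y : Carrier
        X = (ι p ⊗ y) ⊕ (x ⊗ ι q)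
        Y = (ι r ⊗ y) ⊕ (x ⊗ ι s)
        quartic-value : ∀ (g : Vec K.Carrier 3) {x y z} → ev g x y ≡ z → ev (mul xy g) x y ≡ (x ⊗ y) ⊗ z
        quartic-value g {x} {y} eq = trans (ev-mul x y xy g) (cong₂ _⊗_ (ev-xy x y) eq)
        k≢0 : k ≢ K.0#
        k≢0 k≡0 = K.1≢0 (begin
          K.1#                                             ≡⟨ cong (λ v → lookup v 3F) M′.xy*minimalForm ⟨
          lookup (mul xy M′.minimalForm) 3F                ≡⟨ cong (λ v → lookup v 3F) same ⟨
          lookup (scale k w) 3F                            ≡⟨ Vec.lookup-map 3F (k K.⊗_) w ⟩
          k K.⊗ lookup w 3F                                ≡⟨ trans (cong (K._⊗ lookup w 3F) k≡0) (K.zeroˡ _) ⟩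
          K.0#                                             ∎)
          where
          w : Vec K.Carrier 5
          w = Poly.subst K (p ∷ q ∷ []) (r ∷ s ∷ []) (mul xy M.minimalForm)

      -- An image with coordinates in K can satisfy X = αY or X = conj · Y only if both coordinates
      -- are 0, so one coordinate vanishes in every case.
      rational-zero : ∀ {u w X Y} → X ≡ ι u → Y ≡ ι w →
        X ≡ 0# ⊎ Y ≡ 0# ⊎ X ⊕ (⊝ (α ⊗ Y)) ≡ 0# ⊎ X ⊕ (⊝ (M.conj ⊗ Y)) ≡ 0# → u ≡ K.0# ⊎ w ≡ K.0#
      rational-zero refl refl (inj₁ X≡0) = inj₁ (ι≡0⇒≡0 X≡0)
      rational-zero refl refl (inj₂ (inj₁ Y≡0)) = inj₂ (ι≡0⇒≡0 Y≡0)
      rational-zero refl refl (inj₂ (inj₂ (inj₁ eq))) = inj₁ (proj₁ (vanishing-at-rational-pair α∉K eq))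
      rational-zero refl refl (inj₂ (inj₂ (inj₂ eq))) = inj₁ (proj₁ (vanishing-at-rational-pair M.conj∉K eq))

      image-of-∞ : q ≡ K.0# ⊎ s ≡ K.0#
      image-of-∞ = rational-zero (at-∞ p q) (at-∞ r s) (zero-transport 1# 0#
          (trans (cong (_⊗ ((1# ⊕ (⊝ (α′ ⊗ 0#))) ⊗ (1# ⊕ (⊝ (M′.conj ⊗ 0#))))) (zeroʳ 1#)) (zeroˡ _)))
        where
        at-∞ : ∀ a b → (ι a ⊗ 0#) ⊕ (1# ⊗ ι b) ≡ ι b
        at-∞ a b = solve 2 (λ a b → a :* con (+ 0) :+ con (+ 1) :* b := b) refl (ι a) (ι b)

      image-of-0 : p ≡ K.0# ⊎ r ≡ K.0#
      image-of-0 = rational-zero (at-0 p q) (at-0 r s) (zero-transport 0# 1#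
          (trans (cong (_⊗ ((0# ⊕ (⊝ (α′ ⊗ 1#))) ⊗ (0# ⊕ (⊝ (M′.conj ⊗ 1#))))) (zeroˡ 1#)) (zeroˡ _)))
        where
        at-0 : ∀ a b → (ι a ⊗ 1#) ⊕ (0# ⊗ ι b) ≡ ι a
        at-0 a b = solve 2 (λ a b → a :* con (+ 1) :+ con (+ 0) :* b := a) refl (ι a) (ι b)

      image-of-α′ : let X = ι p ⊕ (α′ ⊗ ι q) ; Y = ι r ⊕ (α′ ⊗ ι s) in
        X ≡ 0# ⊎ Y ≡ 0# ⊎ X ≡ α ⊗ Y ⊎ X ≡ M.conj ⊗ Y
      image-of-α′ = Sum.map (trans (sym (at-α′ p q))) (Sum.map (trans (sym (at-α′ r s))) (Sum.map difference difference))
          (zero-transport α′ 1# (solve 2 (λ a c → (a :* con (+ 1)) :* ((a :- a :* con (+ 1)) :* (a :- c :* con (+ 1))) := con (+ 0)) refl α′ M′.conj))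
        where
        at-α′ : ∀ a b → (ι a ⊗ 1#) ⊕ (α′ ⊗ ι b) ≡ ι a ⊕ (α′ ⊗ ι b)
        at-α′ a b = cong (_⊕ (α′ ⊗ ι b)) (*-identityʳ (ι a))
        difference : ∀ {θ} → ((ι p ⊗ 1#) ⊕ (α′ ⊗ ι q)) ⊕ (⊝ (θ ⊗ ((ι r ⊗ 1#) ⊕ (α′ ⊗ ι s)))) ≡ 0# →
          ι p ⊕ (α′ ⊗ ι q) ≡ θ ⊗ (ι r ⊕ (α′ ⊗ ι s))
        difference {θ} eq = trans (sym (at-α′ p q)) (trans (x-y≡0⇒x≡y eq) (cong (θ ⊗_) (at-α′ r s)))

  module _ {i j} (0<i : 0 ℕ.< i) (i≤h : i ℕ.≤ ℕ.⌊ suc q /2⌋) (0<j : 0 ℕ.< j) (j≤h : j ℕ.≤ ℕ.⌊ suc q /2⌋) where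
    private
      α α′ : Carrier
      α = ζ ^F i
      α′ = ζ ^F j
      module M = MinimalForm (small-power-irrational 0<i i≤h)
      module M′ = MinimalForm (small-power-irrational 0<j j≤h)

      product⇒≡ : ∀ {a b} → a ≢ K.0# → ι a ⊗ (α ⊗ α′) ≡ ι b → i ≡ j
      product⇒≡ {a} {b} a≢0 eq = product-rational⇒≡ 0<i i≤h j≤h (rational-cancelˡ (ι≢0 a≢0) (a , refl) (b , sym eq))

      ι0+ : ∀ x → ι K.0# ⊕ x ≡ x
      ι0+ x = trans (cong (_⊕ x) ι-0) (+-identityˡ x)

      +ι0 : ∀ x → x ⊕ (α′ ⊗ ι K.0#) ≡ x
      +ι0 x = trans (cong (λ z → x ⊕ (α′ ⊗ z)) ι-0) (solve 2 (λ x a → x :+ a :* con (+ 0) := x) refl x α′)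

      -- The map is multiplication by d/a. If it takes α′ to α, the exponents agree modulo q + 1; if
      -- it takes α′ to the conjugate, multiplying by α shows that αα′ is rational.
      diagonal : ∀ {a d} → a ≢ K.0# → d ≢ K.0# →
        α′ ⊗ ι d ≡ 0# ⊎ ι a ≡ 0# ⊎ α′ ⊗ ι d ≡ α ⊗ ι a ⊎ α′ ⊗ ι d ≡ M.conj ⊗ ι a → i ≡ j
      diagonal a≢0 d≢0 (inj₁ eq) = contradiction eq (x⊗y≢0 M′.α≢0 (ι≢0 d≢0))
      diagonal a≢0 d≢0 (inj₂ (inj₁ eq)) = contradiction eq (ι≢0 a≢0)
      diagonal a≢0 d≢0 (inj₂ (inj₂ (inj₁ eq))) = ratio-rational⇒≡ i≤h j≤h d≢0 a≢0 (sym eq)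
      diagonal {a} {d} a≢0 d≢0 (inj₂ (inj₂ (inj₂ eq))) = product⇒≡ d≢0 (begin
        ι d ⊗ (α ⊗ α′)         ≡⟨ solve 3 (λ d a b → d :* (a :* b) := a :* (b :* d)) refl (ι d) α α′ ⟩
        α ⊗ (α′ ⊗ ι d)         ≡⟨ cong (α ⊗_) eq ⟩
        α ⊗ (M.conj ⊗ ι a)     ≡⟨ *-assoc α M.conj (ι a) ⟨
        (α ⊗ M.conj) ⊗ ι a     ≡⟨ cong (_⊗ ι a) M.α*conj≡norm ⟩
        ι M.norm ⊗ ι a         ≡⟨ ι-⊗ M.norm a ⟨
        ι (M.norm K.⊗ a)       ∎)

      -- The map is β ↦ b/(cβ), so the cases trade places: image α makes αα′ rational, and image
      -- conj, multiplied by α, makes α/α′ rational.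
      antidiagonal : ∀ {b c} → b ≢ K.0# → c ≢ K.0# →
        ι b ≡ 0# ⊎ α′ ⊗ ι c ≡ 0# ⊎ ι b ≡ α ⊗ (α′ ⊗ ι c) ⊎ ι b ≡ M.conj ⊗ (α′ ⊗ ι c) → i ≡ j
      antidiagonal b≢0 c≢0 (inj₁ eq) = contradiction eq (ι≢0 b≢0)
      antidiagonal b≢0 c≢0 (inj₂ (inj₁ eq)) = contradiction eq (x⊗y≢0 M′.α≢0 (ι≢0 c≢0))
      antidiagonal {b} {c} b≢0 c≢0 (inj₂ (inj₂ (inj₁ eq))) = product⇒≡ c≢0
        (trans (solve 3 (λ d a b → d :* (a :* b) := a :* (b :* d)) refl (ι c) α α′) (sym eq))
      antidiagonal {b} {c} b≢0 c≢0 (inj₂ (inj₂ (inj₂ eq))) = ratio-rational⇒≡ i≤h j≤h (K.x⊗y≢0 M.norm≢0 c≢0) b≢0 (begin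
        α ⊗ ι b                       ≡⟨ cong (α ⊗_) eq ⟩
        α ⊗ (M.conj ⊗ (α′ ⊗ ι c))     ≡⟨ solve 4 (λ a n b c → a :* (n :* (b :* c)) := b :* ((a :* n) :* c)) refl α M.conj α′ (ι c) ⟩
        α′ ⊗ ((α ⊗ M.conj) ⊗ ι c)     ≡⟨ cong (λ z → α′ ⊗ (z ⊗ ι c)) M.α*conj≡norm ⟩
        α′ ⊗ (ι M.norm ⊗ ι c)         ≡⟨ cong (α′ ⊗_) (ι-⊗ M.norm c) ⟨
        α′ ⊗ ι (M.norm K.⊗ c)         ∎)

      -- Sending both 0 and ∞ to the same point would make the determinant vanish; what remains is
      -- fixing or exchanging them.
      monomial : ∀ {p q r s} → det p q r s ≢ K.0# → q ≡ K.0# ⊎ s ≡ K.0# → p ≡ K.0# ⊎ r ≡ K.0# →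
        (let X = ι p ⊕ (α′ ⊗ ι q) ; Y = ι r ⊕ (α′ ⊗ ι s) in X ≡ 0# ⊎ Y ≡ 0# ⊎ X ≡ α ⊗ Y ⊎ X ≡ M.conj ⊗ Y) → i ≡ j
      monomial {r = r} {s} det≢0 (inj₁ refl) (inj₁ refl) _ = contradiction
        (K.solve 2 (λ r s → r K.:* K.con (+ 0) K.:- K.con (+ 0) K.:* s K.:= K.con (+ 0)) refl r s) det≢0
      monomial {p} {q} det≢0 (inj₂ refl) (inj₂ refl) _ = contradiction
        (K.solve 2 (λ p q → K.con (+ 0) K.:* q K.:- p K.:* K.con (+ 0) K.:= K.con (+ 0)) refl p q) det≢0
      monomial {p} {_} {_} {s} det≢0 (inj₁ refl) (inj₂ refl) image = antidiagonal (K.x⊗y≢0⇒x≢0 ps≢0) (K.x⊗y≢0⇒y≢0 ps≢0)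
          (subst₂ (λ X Y → X ≡ 0# ⊎ Y ≡ 0# ⊎ X ≡ α ⊗ Y ⊎ X ≡ M.conj ⊗ Y) (+ι0 (ι p)) (ι0+ (α′ ⊗ ι s)) image)
        where
        ps≢0 : p K.⊗ s ≢ K.0#
        ps≢0 ps≡0 = det≢0 (trans (cong (λ z → (K.0# K.⊗ K.0#) K.⊕ (K.⊝ z)) ps≡0)
          (K.solve 0 ((K.con (+ 0) K.:* K.con (+ 0)) K.:- K.con (+ 0) K.:= K.con (+ 0)) refl))
      monomial {_} {q} {r} {_} det≢0 (inj₂ refl) (inj₁ refl) image = diagonal (K.x⊗y≢0⇒x≢0 rq≢0) (K.x⊗y≢0⇒y≢0 rq≢0)
          (subst₂ (λ X Y → X ≡ 0# ⊎ Y ≡ 0# ⊎ X ≡ α ⊗ Y ⊎ X ≡ M.conj ⊗ Y) (ι0+ (α′ ⊗ ι q)) (+ι0 (ι r)) image)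
        where
        rq≢0 : r K.⊗ q ≢ K.0#
        rq≢0 rq≡0 = det≢0 (trans (cong (λ z → z K.⊕ (K.⊝ (K.0# K.⊗ K.0#))) rq≡0)
          (K.solve 0 (K.con (+ 0) K.:- (K.con (+ 0) K.:* K.con (+ 0)) K.:= K.con (+ 0)) refl))

    abstract
      inOrbit⇒≡ : InOrbit (4 , mul xy M.minimalForm) (4 , mul xy M′.minimalForm) → i ≡ j
      inOrbit⇒≡ (a , b , c , d , ad-bc≢0 , _ , k , eq) = monomial
          (λ det≡0 → ad-bc≢0 (trans (K.solve 4 (λ a b c d → a K.:* d K.:- b K.:* c K.:= a K.:* d K.:- (K.:- b) K.:* (K.:- c)) refl a b c d) det≡0))
          (image-of-∞ α∉K α′∉K same) (image-of-0 α∉K α′∉K same) (image-of-α′ α∉K α′∉K same)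
        where
        α∉K : ¬ Rational (ζ ^F i)
        α∉K = small-power-irrational 0<i i≤h
        α′∉K : ¬ Rational (ζ ^F j)
        α′∉K = small-power-irrational 0<j j≤h
        same : scale k (Poly.subst K (K.⊝ b ∷ d ∷ []) (a ∷ K.⊝ c ∷ []) (mul xy M.minimalForm)) ≡ mul xy M′.minimalForm
        same = form-injective eq

  representatives-inequivalent : ∀ f f′ → R211 L emb q ζ f → R211 L emb q ζ f′ → InOrbit f f′ → f ≡ f′
  representatives-inequivalent f f′ (lift (i , 0<i , i≤h , g , minPoly , refl)) (lift (j , 0<j , j≤h , g′ , minPoly′ , refl)) orbit
    with refl ← MinimalForm.homMinPoly-unique (small-power-irrational 0<i i≤h) minPoly
       | refl ← MinimalForm.homMinPoly-unique (small-power-irrational 0<j j≤h) minPoly′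
    with refl ← inOrbit⇒≡ 0<i i≤h 0<j j≤h orbit = refl

open import Data.Nat using (_*_)

theorem3p6 : (q : ℕ) → IsPrimePower q →
    (K L : Field) → HasSize K q → HasSize L (q * q) →
    (emb : Embedding K L) → (ζ : Field.Carrier L) → Generator L ζ →
    Poly.CompleteReps K (Over.Quartic211 K) (Over.R211 K L emb q ζ)
theorem3p6 q _ K L K-size L-size emb ζ gen = reps⊆quartics , every-orbit-represented , representatives-inequivalent
  where open Classification K-size L-size emb ζ gen
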